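{- Let $n,k$ be integers with $k\geq 2$ and $n\geq 50(k+1)^2$. Then \[ ar(n,F_{k+1})=\mathrm{ex}(n,F_k)+2. \]
   Context: All graphs are finite and simple. For $k\ge 1$, the friendship graph $F_k$ is the graph on $2k+1$ vertices consisting of $k$ triangles that share exactly one common vertex (and are otherwise vertex-disjoint). An edge-colored graph is rainbow if all its edges have distinct colors. For a positive integer $n$ and a family of graphs $\mathcal{G}$, the anti-Ramsey number $ar(n,\mathcal{G})$ is the minimum number $r$ such that every edge-coloring of the complete graph $K_n$ using exactly $r$ colors contains a rainbow copy of some graph in $\mathcal{G}$; $ar(n,G)$ means $ar(n,\{G\})$. The Turán number $\mathrm{ex}(n,G)$ is the maximum number of edges of an $n$-vertex graph containing no subgraph isomorphic to $G$. -}

module Defs where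

open import Data.Nat using (ℕ; zero; suc; _+_; _*_; _≤_; _<_; _<ᵇ_)
open import Data.Fin using (Fin; toℕ)
open import Data.Bool using (Bool; true; false; if_then_else_; _∧_)
open import Data.List using (List; map; allFin)
open import Data.Nat.ListAction using (sum)
open import Data.Product using (Σ; ∃; ∃-syntax; _×_; _,_)
open import Data.Sum using (_⊎_)
open import Relation.Nullary using (¬_)
open import Relation.Binary.PropositionalEquality using (_≡_; _≢_)
open import Function.Definitions using (Injective)

record SimpleGraph (n : ℕ) : Set where
  field
    adj   : Fin n → Fin n → Bool
    sym   : ∀ i j → adj i j ≡ adj j i
    irrefl : ∀ i → adj i i ≡ false

open SimpleGraph public

edgeCount : ∀ {n} → SimpleGraph n → ℕ
edgeCount {n} G =
  sum (map (λ i → sum (map (λ j → if (adj G i j ∧ (toℕ i <ᵇ toℕ j)) then 1 else 0)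
                            (allFin n)))
           (allFin n))

-- Friendship graph F_k on vertex set Fin (2k+1):
-- vertex 0 is the common centre, triangle number i (i < k) is
-- {0, 2i+1, 2i+2}.

FriendEdgeℕ : ℕ → ℕ → Set
FriendEdgeℕ a b =
    (a ≡ 0 × b ≢ 0)
  ⊎ (b ≡ 0 × a ≢ 0)
  ⊎ (∃[ i ] ((a ≡ suc (2 * i) × b ≡ suc (suc (2 * i)))
           ⊎ (b ≡ suc (2 * i) × a ≡ suc (suc (2 * i)))))

fsize : ℕ → ℕ
fsize k = suc (2 * k)

FriendEdge : (k : ℕ) → Fin (fsize k) → Fin (fsize k) → Set
FriendEdge k a b = FriendEdgeℕ (toℕ a) (toℕ b)

Contains : ∀ {n m} → SimpleGraph n → (Fin m → Fin m → Set) → Set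
Contains {n} {m} G E =
  Σ (Fin m → Fin n) λ φ → Injective _≡_ _≡_ φ × (∀ a b → E a b → adj G (φ a) (φ b) ≡ true)

IsEx : ℕ → ℕ → ℕ → Set
IsEx n k e =
    (Σ (SimpleGraph n) λ G → edgeCount G ≡ e × ¬ Contains G (FriendEdge k))
  × (∀ (G : SimpleGraph n) → ¬ Contains G (FriendEdge k) → edgeCount G ≤ e)

-- Edge-colourings of K_n using exactly r colours: a symmetric map from
-- pairs of vertices to Fin r (diagonal values irrelevant) such that every
-- colour in Fin r is used on some edge.

IsColouring : ∀ {n r} → (Fin n → Fin n → Fin r) → Set
IsColouring {n} {r} c =
    (∀ i j → c i j ≡ c j i)
  × (∀ (x : Fin r) → ∃[ i ] ∃[ j ] (i ≢ j × c i j ≡ x))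

HasRainbow : ∀ {n r m} → (Fin n → Fin n → Fin r) → (Fin m → Fin m → Set) → Set
HasRainbow {n} {r} {m} c E =
  Σ (Fin m → Fin n) λ φ → Injective _≡_ _≡_ φ ×
    (∀ a b a′ b′ → E a b → E a′ b′ → c (φ a) (φ b) ≡ c (φ a′) (φ b′) →
       (a ≡ a′ × b ≡ b′) ⊎ (a ≡ b′ × b ≡ a′))

ARProp : ℕ → ℕ → ℕ → Set
ARProp n k r =
  ∀ (c : Fin n → Fin n → Fin r) → IsColouring c → HasRainbow c (FriendEdge k)

IsAR : ℕ → ℕ → ℕ → Set
IsAR n k r = 1 ≤ r × ARProp n k r × (∀ r′ → 1 ≤ r′ → r′ < r → ¬ ARProp n k r′)

{-# OPTIONS --safe #-}
module Submission where

-- Write k = K + 1 and let G contain one edge of each colour of a colouring with ex(n,F_k) + 2 colours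
-- and no rainbow F_{k+1}. Deleting vertices of degree less than ⌊N/2⌋ raises the excess over ⌊N²/4⌋,
-- and when this stops, two large independent sets (neighbourhoods minus a maximal matching) show that
-- G is a nearly complete bipartite graph on parts A and B plus few inner edges. Choose two vertices of
-- each part which have no inner edges and no missing edges, let α and β be the colours of the two inner
-- pairs so obtained, and discard these colours from G. If deg x + ν(G[A ∩ N(x)]) > K for some x in B,
-- then the α-pair would complete a rainbow F_{k+1}; likewise with A and B exchanged, and for α ≠ β
-- using both pairs gives ν < K in both parts. Hence deg x ≤ K - ν(A) + miss(x) on B, and
-- symmetrically on A, and the inner edges minus the missing edges number at most
-- ex(n,F_k) - ⌊n²/4⌋, with strict inequality when α ≠ β. The comparison needs no exact value of
-- ex(n,F_k): either one part can be replaced by stars K_{1,K}, or a degree sum truncated at K - ν,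
-- estimated with Gallai's lemma, bounds the two parts together by K².

open import Defs renaming (sym to adj-sym; irrefl to adj-irrefl)
open import Data.Nat using (ℕ; zero; suc; _+_; _*_; _∸_; _^_; _≤_; _<_; z≤n; s≤s; _≤?_; _<?_; _<ᵇ_; _⊓_; ⌊_/2⌋; ⌈_/2⌉)
open import Data.Nat.Properties hiding (_≟_)
import Data.Nat.Properties as ℕ
open import Data.Nat.ListAction using () renaming (sum to sumℓ)
open import Data.Nat.Tactic.RingSolver using (solve-∀)
open import Data.Fin using (Fin; zero; suc; toℕ; fromℕ; fromℕ<)
open import Data.Fin.Properties using (_≟_; any?; all?; toℕ<n; toℕ-injective; toℕ-fromℕ<; fromℕ<-injective)
open import Data.Bool using (Bool; true; false; if_then_else_; _∧_; _∨_; not; T)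
open import Data.Bool.Properties using (∧-comm; ∨-comm; ∧-identityʳ)
import Data.Bool.Properties as Bool
open import Data.List using (List; []; _∷_; length; map; _++_; tabulate; allFin; take)
open import Data.List.Properties using (length-++; length-map; length-take; map-tabulate; ++-identityʳ)
open import Data.List.Membership.Propositional using (_∈_; _∉_; find)
open import Data.List.Membership.Propositional.Properties using (∈-++⁻; ∈-++⁺ˡ; ∈-++⁺ʳ; ∈-map⁻)
import Data.List.Membership.DecPropositional as DecMembership
open import Data.List.Relation.Unary.Any as Any using (here; there)
open import Data.List.Relation.Unary.All as All using (All; []; _∷_)
open import Data.List.Relation.Unary.All.Properties using (¬Any⇒All¬; All¬⇒¬Any; ¬All⇒Any¬) renaming (++⁺ to All-++⁺; map⁺ to All-map⁺; take⁺ to All-take⁺)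
open import Data.List.Relation.Unary.AllPairs using ([]; _∷_)
open import Data.List.Relation.Unary.Unique.Propositional using (Unique)
open import Data.List.Relation.Unary.Unique.Propositional.Properties using (allFin⁺; take⁺; map⁺) renaming (++⁺ to Unique-++⁺)
open import Data.List.Relation.Binary.Permutation.Propositional using (_↭_; prep; swap; ↭-refl; ↭-sym; ↭-trans; ↭⇒↭ₛ)
open import Data.List.Relation.Binary.Permutation.Propositional.Properties using (∈-resp-↭; shifts; ++⁺ˡ)
import Data.List.Relation.Binary.Permutation.Setoid.Properties as Permₛ
open import Data.Product using (Σ; ∃; ∃₂; _×_; _,_; proj₁; proj₂)
open import Data.Product.Properties using (,-injectiveʳ; ≡-dec)
open import Data.Sum as Sum using (_⊎_; inj₁; inj₂; [_,_]′)
open import Data.Empty using (⊥; ⊥-elim)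
open import Data.Unit using (tt)
open import Function using (_∘_; id)
open import Function.Definitions using (Injective)
open import Relation.Nullary using (¬_; Dec; yes; no; does; ¬?)
open import Relation.Nullary.Decidable using (dec-true; _×-dec_; _→-dec_; _⊎-dec_; map′; decidable-stable)
open import Relation.Binary.Definitions using (tri<; tri≈; tri>)
open import Relation.Binary.PropositionalEquality using (_≡_; _≢_; refl; sym; trans; cong; cong₂; subst; setoid; ≢-sym; module ≡-Reasoning)
import Algebra.Properties.Semiring.Sum +-*-semiring as FinSum

-- The opposite inequality colours the edges of an extremal `F_k`-free graph differently and all
-- other pairs with one further colour: a rainbow `F_{k+1}` has at most one edge of that colour, so
-- dropping one triangle leaves an `F_k`. Giving own colours to only some of the edges settles all
-- smaller numbers of colours. For the upper bound the obstacle is that avoiding `F_{k+1}` does not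
-- by itself bound the number of edges of G by ex(n,F_k) + 1; the colours of pairs outside G have to
-- be used. Exchanging an inner pair for the edge of G of the same colour yields one more triangle,
-- and α and β are discarded because of this exchanged edge. Of the two surplus edges one remains
-- when α = β, and possibly none when α ≠ β; this is why strictness is needed there. The constant 50
-- makes both parts have at least 8(k+1)² vertices after a crude estimate of 32(k+1)² inner edges.

private variable
  n m : ℕ

-- Turns a hypothesis L ≤ R, typically a nonnegative combination of several inequalities,
-- into a ≤ b by a semiring identity.
lin : ∀ {a b L R} s → L ≤ R → a + R + s ≡ b + L → a ≤ b
lin {a} {b} {L} {R} s L≤R eq = +-cancelʳ-≤ R a b
  (≤-trans (m≤m+n (a + R) s) (≤-trans (≤-reflexive eq) (+-monoʳ-≤ b L≤R)))

infixr 6 _⊕_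
_⊕_ : ∀ {a b c d} → a ≤ b → c ≤ d → a + c ≤ b + d
_⊕_ = +-mono-≤

-- Excluded middle for goals that are negations. Maximum matchings are obtained only in this form;
-- `stable-≤` recovers the estimates derived from them.
em : (P : Set) → ((P ⊎ ¬ P) → ⊥) → ⊥
em P f = f (inj₂ (f ∘ inj₁))

stable-≤ : ∀ {a b} → ¬ ¬ (a ≤ b) → a ≤ b
stable-≤ {a} {b} f with a ≤? b
... | yes p = p
... | no ¬p = ⊥-elim (f ¬p)

-- Bool-valued subsets of Fin n

infix 4 _∋_ _∌_
_∋_ _∌_ : (Fin n → Bool) → Fin n → Set
p ∋ i = p i ≡ true
p ∌ i = p i ≡ false

true≢false : ∀ {b} → b ≡ true → b ≡ false → ⊥
true≢false refl ()

¬true⇒false : ∀ {b} → ¬ b ≡ true → b ≡ false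
¬true⇒false {true} f = ⊥-elim (f refl)
¬true⇒false {false} f = refl

bool : ∀ b → b ≡ true ⊎ b ≡ false
bool true = inj₁ refl
bool false = inj₂ refl

∧⁺ : ∀ {a b} → a ≡ true → b ≡ true → a ∧ b ≡ true
∧⁺ refl refl = refl

∧⁻ : ∀ {a b} → a ∧ b ≡ true → a ≡ true × b ≡ true
∧⁻ {true} {true} _ = refl , refl

∨⁻ : ∀ {a b} → a ∨ b ≡ true → a ≡ true ⊎ b ≡ true
∨⁻ {true} _ = inj₁ refl
∨⁻ {false} e = inj₂ e

∨⁺ʳ : ∀ {a b} → b ≡ true → a ∨ b ≡ true
∨⁺ʳ {true} _ = refl
∨⁺ʳ {false} e = e

∨⁺ˡ : ∀ {a b} → a ≡ true → a ∨ b ≡ true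
∨⁺ˡ refl = refl

not⁺ : ∀ {b} → b ≡ false → not b ≡ true
not⁺ refl = refl

not⁻ : ∀ {b} → not b ≡ true → b ≡ false
not⁻ {false} _ = refl

does⁺ : ∀ {P : Set} (d : Dec P) → P → does d ≡ true
does⁺ = dec-true

does⁻ : ∀ {P : Set} (d : Dec P) → does d ≡ true → P
does⁻ (yes p) _ = p

-- Sums over `Fin n` and cardinalities

⟦_⟧ : Bool → ℕ
⟦ b ⟧ = if b then 1 else 0

⟦⟧≤1 : ∀ b → ⟦ b ⟧ ≤ 1
⟦⟧≤1 true = ≤-refl
⟦⟧≤1 false = z≤n

-- Opaque, so that the summand can be inferred by unification.
opaque
  ∑ : (Fin n → ℕ) → ℕ
  ∑ = FinSum.sum

  ∑-zero : (f : Fin 0 → ℕ) → ∑ f ≡ 0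
  ∑-zero f = refl

  ∑-suc : (f : Fin (suc n) → ℕ) → ∑ f ≡ f zero + ∑ (f ∘ suc)
  ∑-suc f = refl

  ∑-+ : (f g : Fin n → ℕ) → ∑ (λ i → f i + g i) ≡ ∑ f + ∑ g
  ∑-+ = FinSum.∑-distrib-+

  ∑-swap : (f : Fin m → Fin n → ℕ) → ∑ (λ i → ∑ (λ j → f i j)) ≡ ∑ (λ j → ∑ (λ i → f i j))
  ∑-swap = FinSum.∑-comm

  ∑-* : ∀ c (f : Fin n → ℕ) → ∑ (λ i → c * f i) ≡ c * ∑ f
  ∑-* c f = sym (FinSum.*-distribˡ-sum c f)

  ∑-cong : {f g : Fin n → ℕ} → (∀ i → f i ≡ g i) → ∑ f ≡ ∑ g
  ∑-cong = FinSum.sum-cong-≗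

  ∑-mono : {f g : Fin n → ℕ} → (∀ i → f i ≤ g i) → ∑ f ≤ ∑ g
  ∑-mono {zero} h = z≤n
  ∑-mono {suc n} h = +-mono-≤ (h zero) (∑-mono (h ∘ suc))

  ∑-const : ∀ c → ∑ {n} (λ _ → c) ≡ n * c
  ∑-const {zero} c = refl
  ∑-const {suc n} c = cong (c +_) (∑-const {n} c)

∑-0 : ∑ {n} (λ _ → 0) ≡ 0
∑-0 {n} = trans (∑-const 0) (*-zeroʳ n)

# : (Fin n → Bool) → ℕ
# p = ∑ (λ i → ⟦ p i ⟧)

infix 5 _==_
_==_ : Fin n → Fin n → Bool
i == j = does (i ≟ j)

==⁺ : {i j : Fin n} → i ≡ j → (i == j) ≡ true
==⁺ {i = i} {j} = does⁺ (i ≟ j)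

==⁻ : {i j : Fin n} → (i == j) ≡ true → i ≡ j
==⁻ {i = i} {j} = does⁻ (i ≟ j)

∑-δ : (x : Fin n) (f : Fin n → ℕ) → ∑ (λ i → ⟦ i == x ⟧ * f i) ≡ f x
∑-δ zero f = trans (∑-suc _) (trans (cong (f zero + 0 +_) ∑-0) (trans (+-identityʳ _) (+-identityʳ _)))
∑-δ (suc x) f = trans (∑-suc _) (∑-δ x (f ∘ suc))

module _ {n : ℕ} where
  open DecMembership (_≟_ {n}) public using (_∈?_)

mem : List (Fin n) → Fin n → Bool
mem xs i = does (i ∈? xs)

⟦⟧-⊆ : ∀ {a b} → (a ≡ true → b ≡ true) → ⟦ a ⟧ ≤ ⟦ b ⟧
⟦⟧-⊆ {true} f rewrite f refl = ≤-refl
⟦⟧-⊆ {false} f = z≤n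

⟦⟧-cover : ∀ {a b c} → (a ≡ true → b ≡ true ⊎ c ≡ true) → ⟦ a ⟧ ≤ ⟦ b ⟧ + ⟦ c ⟧
⟦⟧-cover {false} f = z≤n
⟦⟧-cover {true} {b} {c} f with f refl
... | inj₁ refl = m≤m+n 1 _
... | inj₂ refl = m≤n+m 1 ⟦ b ⟧

⟦⟧-disjoint : ∀ {a b c} → (a ≡ true → c ≡ true) → (b ≡ true → c ≡ true) →
  (a ≡ true → b ≡ true → ⊥) → ⟦ a ⟧ + ⟦ b ⟧ ≤ ⟦ c ⟧
⟦⟧-disjoint {true} {true} f g h = ⊥-elim (h refl refl)
⟦⟧-disjoint {true} {false} f g h rewrite f refl = ≤-refl
⟦⟧-disjoint {false} {b} f g h = ⟦⟧-⊆ g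

#-⊆ : {p q : Fin n → Bool} → (∀ i → p ∋ i → q ∋ i) → # p ≤ # q
#-⊆ {p = p} h = ∑-mono (λ i → ⟦⟧-⊆ (h i))

#-cover : {p q r : Fin n → Bool} → (∀ i → p ∋ i → q ∋ i ⊎ r ∋ i) → # p ≤ # q + # r
#-cover {p = p} {q} {r} h =
  ≤-trans (∑-mono (λ i → ⟦⟧-cover (h i)))
          (≤-reflexive (∑-+ (⟦_⟧ ∘ q) (⟦_⟧ ∘ r)))

#-disjoint : {p q r : Fin n → Bool} → (∀ i → p ∋ i → r ∋ i) → (∀ i → q ∋ i → r ∋ i) →
  (∀ i → p ∋ i → q ∋ i → ⊥) → # p + # q ≤ # r
#-disjoint {p = p} {q} {r} f g h =
  ≤-trans (≤-reflexive (sym (∑-+ (⟦_⟧ ∘ p) (⟦_⟧ ∘ q))))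
          (∑-mono (λ i → ⟦⟧-disjoint (f i) (g i) (h i)))

#-all : # {n} (λ _ → true) ≡ n
#-all {n} = trans (∑-const 1) (*-identityʳ n)

#≤n : (p : Fin n → Bool) → # p ≤ n
#≤n p = ≤-trans (∑-mono (λ i → ⟦⟧≤1 (p i))) (≤-reflexive #-all)

∑-mem-≤ : (xs : List (Fin n)) (f : Fin n → ℕ) → ∑ (λ i → ⟦ mem xs i ⟧ * f i) ≤ sumℓ (map f xs)
∑-mem-≤ [] f = ≤-reflexive ∑-0
∑-mem-≤ (x ∷ xs) f = begin
  ∑ (λ i → ⟦ mem (x ∷ xs) i ⟧ * f i) ≤⟨ ∑-mono pointwise ⟩
  ∑ (λ i → ⟦ i == x ⟧ * f i + ⟦ mem xs i ⟧ * f i) ≡⟨ ∑-+ _ _ ⟩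
  ∑ (λ i → ⟦ i == x ⟧ * f i) + ∑ (λ i → ⟦ mem xs i ⟧ * f i) ≤⟨ ≤-reflexive (∑-δ x f) ⊕ ∑-mem-≤ xs f ⟩
  f x + sumℓ (map f xs) ∎
  where
  open ≤-Reasoning
  pointwise : ∀ i → ⟦ mem (x ∷ xs) i ⟧ * f i ≤ ⟦ i == x ⟧ * f i + ⟦ mem xs i ⟧ * f i
  pointwise i = ≤-trans (*-monoˡ-≤ (f i) (⟦⟧-cover {mem (x ∷ xs) i} (split ∘ does⁻ (i ∈? (x ∷ xs)))))
                        (≤-reflexive (*-distribʳ-+ (f i) ⟦ i == x ⟧ ⟦ mem xs i ⟧))
    where
    split : i ∈ x ∷ xs → (i == x) ≡ true ⊎ mem xs i ≡ true
    split (here e) = inj₁ (==⁺ e)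
    split (there i∈) = inj₂ (does⁺ (i ∈? xs) i∈)

∑-mem-≥ : (xs : List (Fin n)) (f : Fin n → ℕ) → Unique xs → sumℓ (map f xs) ≤ ∑ (λ i → ⟦ mem xs i ⟧ * f i)
∑-mem-≥ [] f [] = z≤n
∑-mem-≥ (x ∷ xs) f (x∉ ∷ u) = begin
  f x + sumℓ (map f xs) ≤⟨ ≤-reflexive (sym (∑-δ x f)) ⊕ ∑-mem-≥ xs f u ⟩
  ∑ (λ i → ⟦ i == x ⟧ * f i) + ∑ (λ i → ⟦ mem xs i ⟧ * f i) ≡⟨ sym (∑-+ _ _) ⟩
  ∑ (λ i → ⟦ i == x ⟧ * f i + ⟦ mem xs i ⟧ * f i) ≤⟨ ∑-mono pointwise ⟩
  ∑ (λ i → ⟦ mem (x ∷ xs) i ⟧ * f i) ∎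
  where
  open ≤-Reasoning
  pointwise : ∀ i → ⟦ i == x ⟧ * f i + ⟦ mem xs i ⟧ * f i ≤ ⟦ mem (x ∷ xs) i ⟧ * f i
  pointwise i = ≤-trans (≤-reflexive (sym (*-distribʳ-+ (f i) ⟦ i == x ⟧ ⟦ mem xs i ⟧)))
    (*-monoˡ-≤ (f i) (⟦⟧-disjoint {i == x}
      (λ e → does⁺ (i ∈? (x ∷ xs)) (here (==⁻ e)))
      (λ e → does⁺ (i ∈? (x ∷ xs)) (there (does⁻ (i ∈? xs) e)))
      (λ e e′ → All¬⇒¬Any x∉ (subst (_∈ xs) (==⁻ e) (does⁻ (i ∈? xs) e′)))))

sum-map-const : ∀ {A : Set} (xs : List A) c → sumℓ (map (λ _ → c) xs) ≡ length xs * c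
sum-map-const [] c = refl
sum-map-const (x ∷ xs) c = cong (c +_) (sum-map-const xs c)

#-mem : (xs : List (Fin n)) → # (mem xs) ≤ length xs
#-mem xs = begin
  # (mem xs) ≡⟨ ∑-cong (λ i → sym (*-identityʳ ⟦ mem xs i ⟧)) ⟩
  ∑ (λ i → ⟦ mem xs i ⟧ * 1) ≤⟨ ∑-mem-≤ xs (λ _ → 1) ⟩
  sumℓ (map (λ _ → 1) xs) ≡⟨ trans (sum-map-const xs 1) (*-identityʳ _) ⟩
  length xs ∎
  where open ≤-Reasoning

length≤# : {p : Fin n → Bool} {xs : List (Fin n)} → Unique xs → All (p ∋_) xs → length xs ≤ # p
length≤# {p = p} {xs} u a = begin
  length xs ≡⟨ sym (trans (sum-map-const xs 1) (*-identityʳ _)) ⟩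
  sumℓ (map (λ _ → 1) xs) ≤⟨ ∑-mem-≥ xs (λ _ → 1) u ⟩
  ∑ (λ i → ⟦ mem xs i ⟧ * 1) ≡⟨ ∑-cong (λ i → *-identityʳ ⟦ mem xs i ⟧) ⟩
  # (mem xs) ≤⟨ #-⊆ (λ i e → All.lookup a (does⁻ (i ∈? xs) e)) ⟩
  # p ∎
  where open ≤-Reasoning

inhabited : {p : Fin n → Bool} → 1 ≤ # p → ∃ (p ∋_)
inhabited {zero} h = ⊥-elim (1+n≰n (≤-trans h (≤-reflexive (∑-zero _))))
inhabited {suc n} {p} h with p zero in e
... | true = zero , e
... | false with i , q ← inhabited {n} {p ∘ suc} (≤-trans h (≤-reflexive (trans (∑-suc _) (cong (λ b → ⟦ b ⟧ + # (p ∘ suc)) e))))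
  = suc i , q

fresh : {p : Fin n → Bool} (zs : List (Fin n)) → length zs < # p → ∃ λ i → p ∋ i × i ∉ zs
fresh {p = p} zs h = let i , e = inhabited pos
                         e₁ , e₂ = ∧⁻ {p i} e
                     in i , e₁ , λ i∈ → true≢false (does⁺ (i ∈? zs) i∈) (not⁻ e₂)
  where
  p′ : Fin _ → Bool
  p′ i = p i ∧ not (mem zs i)
  split : ∀ i → p ∋ i → mem zs i ≡ true ⊎ p′ i ≡ true
  split i e with mem zs i
  ... | true = inj₁ refl
  ... | false = inj₂ (∧⁺ e refl)
  pos : 1 ≤ # p′
  pos = +-cancelˡ-≤ (length zs) 1 (# p′) (≤-trans (≤-reflexive (+-comm _ 1))
    (≤-trans h (≤-trans (#-cover split) (+-monoˡ-≤ _ (#-mem zs)))))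

choose : ∀ m {p : Fin n → Bool} → m ≤ # p → ∃ λ xs → length xs ≡ m × Unique xs × All (p ∋_) xs
choose zero h = [] , refl , [] , []
choose (suc m) {p} h =
  let xs , len , u , a = choose m (≤-trans (n≤1+n m) h)
      i , e , i∉ = fresh xs (subst (λ l → l < # p) (sym len) h)
  in i ∷ xs , cong suc len , ¬Any⇒All¬ _ i∉ ∷ u , e ∷ a

#≤1 : {p : Fin n → Bool} → (∀ i j → p ∋ i → p ∋ j → i ≡ j) → # p ≤ 1
#≤1 {p = p} h with # p ≤? 1
... | yes le = le
... | no ¬le with i ∷ j ∷ [] , refl , (i≢j ∷ []) ∷ _ , ei ∷ ej ∷ [] ← choose 2 (≰⇒> ¬le)
  = ⊥-elim (i≢j (h i j ei ej))

#-split : (p q : Fin n → Bool) → # (λ i → p i ∧ q i) + # (λ i → p i ∧ not (q i)) ≡ # p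
#-split p q = trans (sym (∑-+ _ _)) (∑-cong (λ i → pt (p i) (q i)))
  where
  pt : ∀ a b → ⟦ a ∧ b ⟧ + ⟦ a ∧ not b ⟧ ≡ ⟦ a ⟧
  pt true true = refl
  pt true false = refl
  pt false b = refl

#-suc : (p : Fin (suc n) → Bool) → # p ≡ ⟦ p zero ⟧ + # (p ∘ suc)
#-suc p = ∑-suc _

extend : Bool → (Fin n → Bool) → Fin (suc n) → Bool
extend b q zero = b
extend b q (suc i) = q i

superset : ∀ m (p : Fin n → Bool) → # p ≤ m → m ≤ n → ∃ λ q → (∀ i → p ∋ i → q ∋ i) × # q ≡ m
superset {zero} zero p h _ = p , (λ ()) , ∑-zero _
superset {suc n} m p h m≤n with p zero in e | ≤-trans (≤-reflexive (sym (#-suc p))) h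
superset {suc n} (suc m) p h (s≤s m≤n) | true | s≤s h′ with q , sub , eq ← superset m (p ∘ suc) h′ m≤n
  = extend true q , (λ { zero _ → refl ; (suc i) → sub i }) , trans (#-suc _) (cong suc eq)
superset {suc n} zero p h m≤n | false | h′ with q , sub , eq ← superset zero (p ∘ suc) h′ z≤n
  = extend false q , (λ { zero e′ → ⊥-elim (true≢false e′ e) ; (suc i) → sub i }) , trans (#-suc _) eq
superset {suc n} (suc m) p h (s≤s m≤n) | false | h′ with # (p ∘ suc) ≤? m
... | yes le with q , sub , eq ← superset m (p ∘ suc) le m≤n
  = extend true q , (λ { zero _ → refl ; (suc i) → sub i }) , trans (#-suc _) (cong suc eq)
... | no ¬le = p , (λ _ → id) , trans (#-suc p) (trans (cong (λ b → ⟦ b ⟧ + # (p ∘ suc)) e) (≤-antisym h′ (≰⇒> ¬le)))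

Unique-resp-↭ : ∀ {A : Set} {xs ys : List A} → xs ↭ ys → Unique xs → Unique ys
Unique-resp-↭ {A} p = Permₛ.Unique-resp-↭ (setoid A) (↭⇒↭ₛ p)

infixr 5 _∷ᵘ_
_∷ᵘ_ : ∀ {A : Set} {x : A} {xs} → x ∉ xs → Unique xs → Unique (x ∷ xs)
x∉ ∷ᵘ u = ¬Any⇒All¬ _ x∉ ∷ u

Unique-head : ∀ {A : Set} {x : A} {xs} → Unique (x ∷ xs) → x ∉ xs
Unique-head (x∉ ∷ _) = All¬⇒¬Any x∉

Unique-tail : ∀ {A : Set} {x : A} {xs} → Unique (x ∷ xs) → Unique xs
Unique-tail (_ ∷ u) = u

Unique-++ʳ : ∀ {A : Set} (xs : List A) {ys} → Unique (xs ++ ys) → Unique ys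
Unique-++ʳ [] u = u
Unique-++ʳ (x ∷ xs) u = Unique-++ʳ xs (Unique-tail u)

Unique-⊆-length : (xs ys : List (Fin n)) → Unique xs → (∀ {x} → x ∈ xs → x ∈ ys) → length xs ≤ length ys
Unique-⊆-length xs ys u sub =
  ≤-trans (length≤# u (All.tabulate (λ {x} x∈ → does⁺ (x ∈? ys) (sub x∈)))) (#-mem ys)

-- Graphs

-- The vertex set stays `Fin n` and vertices outside `A` become isolated, so degrees and sums need
-- no reindexing.
restrict : SimpleGraph n → (Fin n → Bool) → SimpleGraph n
restrict G A = record
  { adj = λ i j → adj G i j ∧ (A i ∧ A j)
  ; sym = λ i j → cong₂ _∧_ (adj-sym G i j) (∧-comm (A i) (A j))
  ; irrefl = λ i → cong (_∧ (A i ∧ A i)) (adj-irrefl G i) }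

deg : SimpleGraph n → Fin n → ℕ
deg G i = # (adj G i)

-- Twice the number of edges. Counting ordered pairs keeps double counting symmetric; later
-- inequalities are doubled accordingly.
edges₂ : SimpleGraph n → ℕ
edges₂ G = ∑ (deg G)

adj-flip : (G : SimpleGraph n) {i j : Fin n} → adj G i j ≡ true → adj G j i ≡ true
adj-flip G {i} {j} e = trans (adj-sym G j i) e

adj⇒≢ : (G : SimpleGraph n) {i j : Fin n} → adj G i j ≡ true → i ≢ j
adj⇒≢ G {i} e refl = true≢false e (adj-irrefl G i)

restrict⁻ : (G : SimpleGraph n) (A : Fin n → Bool) {i j : Fin n} →
  adj (restrict G A) i j ≡ true → adj G i j ≡ true × A ∋ i × A ∋ j
restrict⁻ G A {i} {j} e = let e₁ , e₂ = ∧⁻ {adj G i j} e in e₁ , ∧⁻ e₂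

deg≥1 : (G : SimpleGraph n) {i j : Fin n} → adj G i j ≡ true → 1 ≤ deg G i
deg≥1 G {i} {j} e = length≤# {p = adj G i} {xs = j ∷ []} ([] ∷ []) (e ∷ [])

-- Matchings

flat : ∀ {A : Set} → List (A × A) → List A
flat [] = []
flat ((u , v) ∷ L) = u ∷ v ∷ flat L

flat-++ : ∀ {A : Set} (L M : List (A × A)) → flat (L ++ M) ≡ flat L ++ flat M
flat-++ [] M = refl
flat-++ ((u , v) ∷ L) M = cong (λ xs → u ∷ v ∷ xs) (flat-++ L M)

length-flat : ∀ {A : Set} (L : List (A × A)) → length (flat L) ≡ 2 * length L
length-flat [] = refl
length-flat (_ ∷ L) = trans (cong (2 +_) (length-flat L)) (sym (*-suc 2 (length L)))

Edge : SimpleGraph n → Fin n × Fin n → Set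
Edge G (u , v) = adj G u v ≡ true

-- Distinct entries in `flat L` mean that the edges are disjoint and that none is listed twice.
IsMatching : SimpleGraph n → List (Fin n × Fin n) → Set
IsMatching G L = All (Edge G) L × Unique (flat L)

-- The matching number enters only through upper bounds, so no maximum has to be computed.
ν≤ : SimpleGraph n → ℕ → Set
ν≤ G m = ∀ L → IsMatching G L → length L ≤ m

-- Descent on the bound: either it is attained or it can be lowered by one. The alternative is not
-- decided, whence the double negation.
max-matching : (G : SimpleGraph n) → ν≤ G m →
  ¬ ¬ (∃ λ L → IsMatching G L × ν≤ G (length L))
max-matching {m = zero} G h k = k ([] , ([] , []) , h)
max-matching {m = suc m} G h k = em (∃ λ L → IsMatching G L × suc m ≤ length L) λ where
  (inj₁ (L , M , len)) → k (L , M , λ L′ M′ → ≤-trans (h L′ M′) len)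
  (inj₂ none) → max-matching {m = m} G (λ L M → ≤-pred (≰⇒> (λ len → none (L , M , len)))) k

pair-∈ : (E : Fin n × Fin n → Set) (L : List (Fin n × Fin n)) {u v : Fin n} → All E L → (u , v) ∈ L →
  ∃ λ L₀ → E (u , v) × All E L₀ × length L ≡ suc (length L₀) × flat L ↭ u ∷ v ∷ flat L₀
pair-∈ E (_ ∷ L) (e ∷ a) (here refl) = L , e , a , refl , ↭-refl
pair-∈ E ((x , y) ∷ L) {u} {v} (e ∷ a) (there p) =
  let L₀ , e′ , a′ , len , per = pair-∈ E L a p
  in (x , y) ∷ L₀ , e′ , e ∷ a′ , cong suc len ,
     ↭-trans (prep x (prep y per)) (shifts (x ∷ y ∷ []) (u ∷ v ∷ []))

flat-∈ : ∀ {A : Set} (L : List (A × A)) {u : A} → u ∈ flat L → ∃ λ v → (u , v) ∈ L ⊎ (v , u) ∈ L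
flat-∈ ((x , y) ∷ L) (here refl) = y , inj₁ (here refl)
flat-∈ ((x , y) ∷ L) (there (here refl)) = x , inj₂ (here refl)
flat-∈ (_ ∷ L) (there (there p)) with flat-∈ L p
... | v , inj₁ q = v , inj₁ (there q)
... | v , inj₂ q = v , inj₂ (there q)

∈-flat : ∀ {A : Set} {L : List (A × A)} {u v : A} → (u , v) ∈ L → u ∈ flat L × v ∈ flat L
∈-flat (here refl) = here refl , there (here refl)
∈-flat (there p) = let a , b = ∈-flat p in there (there a) , there (there b)

partner : (G : SimpleGraph n) (L : List (Fin n × Fin n)) {u : Fin n} → All (Edge G) L → u ∈ flat L →
  ∃₂ λ v L₀ → adj G u v ≡ true × All (Edge G) L₀ × length L ≡ suc (length L₀) × flat L ↭ u ∷ v ∷ flat L₀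
partner G L {u} a u∈ with flat-∈ L u∈
... | v , inj₁ p = let L₀ , r = pair-∈ (Edge G) L a p in v , L₀ , r
... | v , inj₂ p = let L₀ , e , a′ , len , per = pair-∈ (Edge G) L a p
                   in v , L₀ , adj-flip G e , a′ , len , ↭-trans per (swap v u ↭-refl)

matching-covers : (G : SimpleGraph n) {L : List (Fin n × Fin n)} → IsMatching G L → ν≤ G (length L) →
  ∀ {i j} → adj G i j ≡ true → i ∈ flat L ⊎ j ∈ flat L
matching-covers G {L} (a , u) mx {i} {j} e with i ∈? flat L | j ∈? flat L
... | yes i∈ | _ = inj₁ i∈
... | no _ | yes j∈ = inj₂ j∈
... | no i∉ | no j∉ = ⊥-elim (1+n≰n (mx ((i , j) ∷ L) (e ∷ a , i∉′ ∷ᵘ j∉ ∷ᵘ u)))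
  where
  i∉′ : i ∉ j ∷ flat L
  i∉′ (here i≡j) = adj⇒≢ G e i≡j
  i∉′ (there i∈) = i∉ i∈

∑-mem-deg : (G : SimpleGraph n) {L : List (Fin n × Fin n)} {y D : ℕ} {ms : Fin n → ℕ} →
  length L ≤ y → (∀ i → deg G i ≤ D + ms i) →
  ∑ (λ i → ⟦ mem (flat L) i ⟧ * deg G i) ≤ 2 * y * D + ∑ ms
∑-mem-deg G {L} {y} {D} {ms} len h = begin
  ∑ (λ i → ⟦ mem (flat L) i ⟧ * deg G i) ≤⟨ ∑-mono (λ i → pt (mem (flat L) i) (h i)) ⟩
  ∑ (λ i → D * ⟦ mem (flat L) i ⟧ + ms i) ≡⟨ trans (∑-+ _ _) (cong (_+ ∑ ms) (∑-* D _)) ⟩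
  D * # (mem (flat L)) + ∑ ms ≤⟨ +-monoˡ-≤ (∑ ms) (*-monoʳ-≤ D (≤-trans (#-mem (flat L)) (≤-trans (≤-reflexive (length-flat L)) (*-monoʳ-≤ 2 len)))) ⟩
  D * (2 * y) + ∑ ms ≡⟨ cong (_+ ∑ ms) (*-comm D (2 * y)) ⟩
  2 * y * D + ∑ ms ∎
  where
  open ≤-Reasoning
  pt : ∀ b {d mi} → d ≤ D + mi → ⟦ b ⟧ * d ≤ D * ⟦ b ⟧ + mi
  pt true {d} {mi} h′ = ≤-trans (≤-reflexive (*-identityˡ d)) (≤-trans h′ (≤-reflexive (cong (_+ mi) (sym (*-identityʳ D)))))
  pt false h′ = z≤n

edges₂-cover : (G : SimpleGraph n) (p : Fin n → Bool) → (∀ {i j} → adj G i j ≡ true → p ∋ i ⊎ p ∋ j) →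
  edges₂ G ≤ 2 * ∑ (λ i → ⟦ p i ⟧ * deg G i)
edges₂-cover G p cov = begin
  ∑ (λ i → ∑ (λ j → ⟦ adj G i j ⟧))
    ≤⟨ ∑-mono (λ i → ∑-mono (λ j → pt i j)) ⟩
  ∑ (λ i → ∑ (λ j → ⟦ p i ⟧ * ⟦ adj G i j ⟧ + ⟦ p j ⟧ * ⟦ adj G i j ⟧))
    ≡⟨ ∑-cong (λ i → ∑-+ _ _) ⟩
  ∑ (λ i → ∑ (λ j → ⟦ p i ⟧ * ⟦ adj G i j ⟧) + ∑ (λ j → ⟦ p j ⟧ * ⟦ adj G i j ⟧))
    ≡⟨ ∑-+ _ _ ⟩
  ∑ (λ i → ∑ (λ j → ⟦ p i ⟧ * ⟦ adj G i j ⟧)) + ∑ (λ i → ∑ (λ j → ⟦ p j ⟧ * ⟦ adj G i j ⟧))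
    ≡⟨ cong₂ _+_ (∑-cong (λ i → ∑-* ⟦ p i ⟧ _))
        (trans (∑-swap _) (∑-cong (λ j → trans (∑-* ⟦ p j ⟧ _)
          (cong (⟦ p j ⟧ *_) (∑-cong (λ i → cong ⟦_⟧ (adj-sym G i j))))))) ⟩
  s + s ≡⟨ cong (s +_) (sym (+-identityʳ s)) ⟩
  2 * s ∎
  where
  open ≤-Reasoning
  s = ∑ (λ i → ⟦ p i ⟧ * deg G i)
  pt : ∀ i j → ⟦ adj G i j ⟧ ≤ ⟦ p i ⟧ * ⟦ adj G i j ⟧ + ⟦ p j ⟧ * ⟦ adj G i j ⟧
  pt i j with adj G i j in e
  ... | false = z≤n
  ... | true with cov e
  ... | inj₁ pi rewrite pi = m≤m+n 1 _
  ... | inj₂ pj rewrite pj = m≤n+m 1 (⟦ p i ⟧ * 1)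

-- By maximality the at most `2 * y` endpoints of a maximum matching cover all edges. The error
-- terms `ms` are charged once per vertex and are not multiplied by the size of the cover.
edges₂-cover-bound : (G : SimpleGraph n) {y D : ℕ} {ms : Fin n → ℕ} → ν≤ G y →
  (∀ i → deg G i ≤ D + ms i) → edges₂ G ≤ 2 * (2 * y * D + ∑ ms)
edges₂-cover-bound G {y} {D} {ms} ν h = stable-≤ λ k → max-matching G ν λ (L , M , mx) → k
  (≤-trans (edges₂-cover G (mem (flat L)) (λ {i} {j} e → Sum.map (does⁺ (i ∈? flat L)) (does⁺ (j ∈? flat L)) (matching-covers G M mx e)))
    (*-monoʳ-≤ 2 (∑-mem-deg G {L} (ν L M) h)))

touched : SimpleGraph n → Fin n → Bool
touched G i = does (1 ≤? deg G i)

touched⁻ : (G : SimpleGraph n) {i : Fin n} → touched G ∋ i → ∃ λ j → adj G i j ≡ true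
touched⁻ G {i} t = inhabited (does⁻ (1 ≤? deg G i) t)

touched⁺ : (G : SimpleGraph n) {i j : Fin n} → adj G i j ≡ true → touched G ∋ i × touched G ∋ j
touched⁺ G {i} {j} e = does⁺ (1 ≤? deg G i) (deg≥1 G e) , does⁺ (1 ≤? deg G j) (deg≥1 G (adj-flip G e))

-- A vertex that is not isolated is an endpoint of a maximum matching or a neighbour of one: at most
-- `2 * y` plus `2 * y * K` vertices.
touched-bound : (G : SimpleGraph n) {y K : ℕ} → ν≤ G y → (∀ i → deg G i ≤ K) →
  # (touched G) ≤ 2 * y * suc K
touched-bound {n} G {y} {K} ν h = stable-≤ λ k → max-matching G ν λ (L , M , mx) → k (begin
  ∑ (λ j → ⟦ touched G j ⟧)
    ≤⟨ ∑-mono (λ j → pt L M mx j) ⟩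
  ∑ (λ j → ⟦ mem (flat L) j ⟧ + ∑ (λ i → ⟦ mem (flat L) i ⟧ * ⟦ adj G i j ⟧))
    ≡⟨ trans (∑-+ _ _) (cong (# (mem (flat L)) +_) (trans (∑-swap _) (∑-cong (λ i → ∑-* ⟦ mem (flat L) i ⟧ _)))) ⟩
  # (mem (flat L)) + ∑ (λ i → ⟦ mem (flat L) i ⟧ * deg G i)
    ≤⟨ ≤-trans (#-mem (flat L)) (≤-trans (≤-reflexive (length-flat L)) (*-monoʳ-≤ 2 (ν L M)))
       ⊕ ∑-mem-deg G {L} {D = K} {ms = λ _ → 0} (ν L M) (λ i → ≤-trans (h i) (m≤m+n K 0)) ⟩
  2 * y + (2 * y * K + ∑ {n} (λ _ → 0))
    ≡⟨ cong (λ z → 2 * y + (2 * y * K + z)) ∑-0 ⟩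
  2 * y + (2 * y * K + 0)
    ≡⟨ trans (cong (2 * y +_) (+-identityʳ _)) (sym (*-suc (2 * y) K)) ⟩
  2 * y * suc K ∎)
  where
  open ≤-Reasoning
  pt : ∀ L → IsMatching G L → ν≤ G (length L) → ∀ j →
    ⟦ touched G j ⟧ ≤ ⟦ mem (flat L) j ⟧ + ∑ (λ i → ⟦ mem (flat L) i ⟧ * ⟦ adj G i j ⟧)
  pt L M mx j with touched G j in e
  ... | false = z≤n
  ... | true with i , ji ← touched⁻ G e with matching-covers G M mx ji
  ... | inj₁ j∈ rewrite does⁺ (j ∈? flat L) j∈ = m≤m+n 1 _
  ... | inj₂ i∈ = ≤-trans (begin
      1 ≡⟨ sym (cong₂ (λ a b → ⟦ a ⟧ * ⟦ b ⟧) (does⁺ (i ∈? flat L) i∈) (adj-flip G ji)) ⟩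
      ⟦ mem (flat L) i ⟧ * ⟦ adj G i j ⟧ ≡⟨ sym (∑-δ i _) ⟩
      ∑ (λ x → ⟦ x == i ⟧ * (⟦ mem (flat L) x ⟧ * ⟦ adj G x j ⟧))
        ≤⟨ ∑-mono (λ x → ≤-trans (*-monoˡ-≤ _ (⟦⟧≤1 (x == i))) (≤-reflexive (*-identityˡ _))) ⟩
      ∑ (λ x → ⟦ mem (flat L) x ⟧ * ⟦ adj G x j ⟧) ∎)
      (m≤n+m _ ⟦ mem (flat L) j ⟧)

-- Gallai's lemma and truncated degree sums

-- Gallai's lemma for two vertices at distance two. C is the part already common to both
-- matchings; each step enlarges it, so that N ends up agreeing with C ++ M outside s₁, s₂ and t.
gallai : (G : SimpleGraph n) {y : ℕ} → ν≤ G y → {t s₁ s₂ : Fin n} →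
  adj G t s₁ ≡ true → adj G t s₂ ≡ true → s₁ ≢ s₂ →
  ∀ f C M N → length M ≤ f →
  All (Edge G) C → All (Edge G) M → All (Edge G) N →
  Unique (flat C ++ flat M) → Unique (flat C ++ flat N) →
  length M ≡ length N → length C + length N ≡ y →
  t ∉ flat C ++ flat N → s₁ ∉ flat C ++ flat M → s₂ ∉ flat C ++ flat M → ⊥
gallai {n} G {y} ν {t} {s₁} {s₂} e₁ e₂ s₁≢s₂ f C M N len aC aM aN uM uN lenMN lenN t∉ s₁∉ s₂∉
  with Any.any? (λ x → ¬? (x ∈? flat N) ×-dec ¬? (x ≟ t)) (flat M)
-- Now `flat M` lies in `t ∷ flat N`. So do `s₁` and `s₂`, since otherwise the edge from `t` would
-- augment `C ++ N`. But `M` and `N` cover equally many vertices, so there is room for one more and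
-- not for two.
... | no none = 1+n≰n (≤-trans (Unique-⊆-length (s₁ ∷ s₂ ∷ flat M) (t ∷ flat N) u sub) lenle)
  where
  augment : ∀ {x z} → adj G x z ≡ true → x ∉ flat C ++ flat N → z ∉ flat C ++ flat N → ⊥
  augment {x} {z} e x∉ z∉ = 1+n≰n (≤-trans (≤-reflexive (cong suc (sym (trans (length-++ C) lenN))))
    (ν ((x , z) ∷ C ++ N) (e ∷ All-++⁺ aC aN , subst (λ xs → Unique (x ∷ z ∷ xs)) (sym (flat-++ C N)) (x∉z ∷ᵘ z∉ ∷ᵘ uN))))
    where
    x∉z : x ∉ z ∷ flat C ++ flat N
    x∉z (here p) = adj⇒≢ G e p
    x∉z (there p) = x∉ p
  in-N : ∀ {s} → adj G t s ≡ true → s ∉ flat C ++ flat M → s ∈ flat N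
  in-N {s} e s∉ with s ∈? (flat C ++ flat N)
  ... | no s∉N = ⊥-elim (augment e t∉ s∉N)
  ... | yes s∈ with ∈-++⁻ (flat C) s∈
  ... | inj₁ s∈C = ⊥-elim (s∉ (∈-++⁺ˡ s∈C))
  ... | inj₂ s∈N = s∈N
  sub : ∀ {x} → x ∈ s₁ ∷ s₂ ∷ flat M → x ∈ t ∷ flat N
  sub (here refl) = there (in-N e₁ s₁∉)
  sub (there (here refl)) = there (in-N e₂ s₂∉)
  sub {x} (there (there x∈)) with x ∈? flat N | x ≟ t
  ... | yes p | _ = there p
  ... | no _ | yes refl = here refl
  ... | no p | no q = ⊥-elim (none (Any.map (λ { refl → p , q }) x∈))
  u : Unique (s₁ ∷ s₂ ∷ flat M)
  u = (λ { (here p) → s₁≢s₂ p ; (there p) → s₁∉ (∈-++⁺ʳ (flat C) p) }) ∷ᵘ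
      (λ p → s₂∉ (∈-++⁺ʳ (flat C) p)) ∷ᵘ Unique-++ʳ (flat C) uM
  lenle : suc (length (flat N)) ≤ suc (length (flat M))
  lenle = s≤s (≤-reflexive (trans (length-flat N) (trans (cong (2 *_) (sym lenMN)) (sym (length-flat M)))))
... | yes any with x , x∈M , x∉N , x≢t ← find any
  with z , M₀ , xz , aM₀ , lenM , perM ← partner G M aM x∈M
  with uM′ ← Unique-resp-↭ (++⁺ˡ (flat C) perM) uM
  with uM″ ← Unique-resp-↭ (shifts (flat C) (x ∷ z ∷ [])) uM′
  with z ∈? flat N
-- `x` and its partner `z` are both uncovered by `C ++ N`, so the edge `x z` augments it.
... | no z∉N = 1+n≰n (≤-trans (≤-reflexive (cong suc (sym (trans (length-++ C) lenN))))
    (ν ((x , z) ∷ C ++ N) (xz ∷ All-++⁺ aC aN , subst (λ xs → Unique (x ∷ z ∷ xs)) (sym (flat-++ C N)) (x∉ ∷ᵘ z∉ ∷ᵘ uN))))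
  where
  z∉ : z ∉ flat C ++ flat N
  z∉ p with ∈-++⁻ (flat C) p
  ... | inj₁ q = Unique-head (Unique-tail uM″) (∈-++⁺ˡ q)
  ... | inj₂ q = z∉N q
  x∉ : x ∉ z ∷ flat C ++ flat N
  x∉ (here p) = adj⇒≢ G xz p
  x∉ (there p) with ∈-++⁻ (flat C) p
  ... | inj₁ q = Unique-head uM″ (there (∈-++⁺ˡ q))
  ... | inj₂ q = x∉N q
... | yes z∈N with w , N₀ , zw , aN₀ , lenN₀ , perN ← partner G N aN z∈N | f
... | zero = 1+n≰n (≤-trans (≤-reflexive (sym lenM)) (≤-trans len z≤n))
-- In `N` the edge `z w` is exchanged for `x z`, which now belongs to both matchings and moves to
-- `C`. The vertex `t` stays uncovered because `x ≢ t`.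
... | suc f′ = gallai G ν e₁ e₂ s₁≢s₂ f′ ((x , z) ∷ C) M₀ N₀ (≤-pred (≤-trans (≤-reflexive (sym lenM)) len))
    (xz ∷ aC) aM₀ aN₀ uM″ (x∉ ∷ᵘ uN₀) (suc-injective (trans (sym lenM) (trans lenMN lenN₀)))
    (trans (sym (+-suc (length C) (length N₀))) (trans (cong (length C +_) (sym lenN₀)) lenN)) t∉′
    (s∉′ s₁∉) (s∉′ s₂∉)
  where
  perN′ : flat C ++ flat N ↭ z ∷ w ∷ flat C ++ flat N₀
  perN′ = ↭-trans (++⁺ˡ (flat C) perN) (shifts (flat C) (z ∷ w ∷ []))
  uN′ : Unique (z ∷ w ∷ flat C ++ flat N₀)
  uN′ = Unique-resp-↭ perN′ uN
  uN₀ : Unique (z ∷ flat C ++ flat N₀)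
  uN₀ = (λ p → Unique-head uN′ (there p)) ∷ᵘ Unique-tail (Unique-tail uN′)
  x∉ : x ∉ z ∷ flat C ++ flat N₀
  x∉ (here p) = adj⇒≢ G xz p
  x∉ (there p) with ∈-++⁻ (flat C) p
  ... | inj₁ q = Unique-head uM″ (there (∈-++⁺ˡ q))
  ... | inj₂ q = x∉N (∈-resp-↭ (↭-sym perN) (there (there q)))
  t∉′ : t ∉ x ∷ z ∷ flat C ++ flat N₀
  t∉′ (here p) = x≢t (sym p)
  t∉′ (there (here refl)) = t∉ (∈-++⁺ʳ (flat C) z∈N)
  t∉′ (there (there p)) = t∉ (∈-resp-↭ (↭-sym perN′) (there (there p)))
  s∉′ : ∀ {s} → s ∉ flat C ++ flat M → s ∉ x ∷ z ∷ flat C ++ flat M₀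
  s∉′ s∉ p = s∉ (∈-resp-↭ (↭-sym (↭-trans (++⁺ˡ (flat C) perM) (shifts (flat C) (x ∷ z ∷ [])))) p)

near : SimpleGraph n → List (Fin n × Fin n) → Fin n → Bool
near G [] i = false
near G ((u , v) ∷ L) i = (adj G u i ∨ adj G v i) ∨ near G L i

near⁺ : (G : SimpleGraph n) {L : List (Fin n × Fin n)} {t i : Fin n} → t ∈ flat L → adj G t i ≡ true → near G L i ≡ true
near⁺ G {(u , v) ∷ L} (here refl) e = ∨⁺ˡ (∨⁺ˡ e)
near⁺ G {(u , v) ∷ L} {i = i} (there (here refl)) e = ∨⁺ˡ (∨⁺ʳ {adj G u i} e)
near⁺ G {(u , v) ∷ L} {i = i} (there (there p)) e = ∨⁺ʳ {adj G u i ∨ adj G v i} (near⁺ G p e)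

-- If every vertex is missed by a maximum matching, the components are factor-critical; all that is
-- used here is that each edge of a maximum matching is adjacent to at most one unmatched vertex.
touched≤3ν : (G : SimpleGraph n) {y : ℕ} → ν≤ G y →
  (∀ v → ¬ ¬ (∃ λ N → IsMatching G N × v ∉ flat N × length N ≡ y)) →
  ∀ L → IsMatching G L → length L ≡ y → # (touched G) ≤ 3 * y
touched≤3ν {n} G {y} ν miss L (aL , uL) lenL = begin
  # (touched G) ≤⟨ #-cover split ⟩
  # (mem (flat L)) + # (out L) ≤⟨ ≤-trans (#-mem (flat L)) (≤-reflexive (length-flat L)) ⊕ out-bound L id ⟩
  2 * length L + length L ≡⟨ ar (length L) ⟩
  3 * length L ≡⟨ cong (3 *_) lenL ⟩
  3 * y ∎
  where
  open ≤-Reasoning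
  ar : ∀ l → 2 * l + l ≡ 3 * l
  ar = solve-∀
  out : List (Fin n × Fin n) → Fin n → Bool
  out L′ i = not (mem (flat L) i) ∧ near G L′ i
  mx : ν≤ G (length L)
  mx = subst (ν≤ G) (sym lenL) ν
  split : ∀ i → touched G ∋ i → mem (flat L) i ≡ true ⊎ out L i ≡ true
  split i t with mem (flat L) i in em′
  ... | true = inj₁ refl
  ... | false with j , e ← touched⁻ G t with matching-covers G (aL , uL) mx e
  ... | inj₁ i∈ = ⊥-elim (true≢false (does⁺ (i ∈? flat L) i∈) em′)
  ... | inj₂ j∈ = inj₂ (near⁺ G j∈ (adj-flip G e))
  -- `L` misses `s₁` and `s₂`, and some maximum matching misses `t`: this is the situation excluded
  -- by `gallai`.
  same-end : ∀ {t s₁ s₂} → s₁ ∉ flat L → s₂ ∉ flat L → adj G t s₁ ≡ true → adj G t s₂ ≡ true → s₁ ≢ s₂ → ⊥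
  same-end {t} s₁∉ s₂∉ e₁ e₂ ne = miss t λ (N , (aN , uN) , t∉ , lenN) →
    gallai G ν e₁ e₂ ne (length L) [] L N ≤-refl [] aL aN uL uN (trans lenL (sym lenN)) lenN t∉ s₁∉ s₂∉
  -- The path `s₁ t t′ s₂` augments `L`.
  other-end : ∀ {t t′ s₁ s₂} → (t , t′) ∈ L → s₁ ∉ flat L → s₂ ∉ flat L →
    adj G t s₁ ≡ true → adj G t′ s₂ ≡ true → s₁ ≢ s₂ → ⊥
  other-end {t} {t′} {s₁} {s₂} p s₁∉ s₂∉ e₁ e₂ ne =
    let L₀ , tt′ , a₀ , len , per = pair-∈ (Edge G) L aL p
        u₀ = Unique-resp-↭ per uL
        t∈ , t′∈ = ∈-flat p
        s₁∉₀ = λ q → s₁∉ (∈-resp-↭ (↭-sym per) q)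
        s₂∉₀ = λ q → s₂∉ (∈-resp-↭ (↭-sym per) q)
        uniq : Unique (s₁ ∷ s₂ ∷ t ∷ t′ ∷ flat L₀)
        uniq = (λ { (here q) → ne q ; (there q) → s₁∉₀ q }) ∷ᵘ s₂∉₀ ∷ᵘ u₀
        uniq′ : Unique (s₁ ∷ t ∷ s₂ ∷ t′ ∷ flat L₀)
        uniq′ = Unique-resp-↭ (prep s₁ (swap s₂ t ↭-refl)) uniq
    in 1+n≰n (≤-trans (≤-reflexive (cong suc (trans (sym lenL) len)))
         (ν ((s₁ , t) ∷ (s₂ , t′) ∷ L₀) (adj-flip G e₁ ∷ adj-flip G e₂ ∷ a₀ , uniq′)))
  one : ∀ {t t′} → (t , t′) ∈ L → ∀ s₁ s₂ →
    not (mem (flat L) s₁) ∧ (adj G t s₁ ∨ adj G t′ s₁) ≡ true →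
    not (mem (flat L) s₂) ∧ (adj G t s₂ ∨ adj G t′ s₂) ≡ true → s₁ ≡ s₂
  one {t} {t′} p s₁ s₂ h₁ h₂ with s₁ ≟ s₂
  ... | yes eq = eq
  ... | no ne with m₁ , o₁ ← ∧⁻ {not (mem (flat L) s₁)} h₁ | m₂ , o₂ ← ∧⁻ {not (mem (flat L) s₂)} h₂
    with s₁∉ ← (λ q → true≢false (does⁺ (s₁ ∈? flat L) q) (not⁻ m₁))
       | s₂∉ ← (λ q → true≢false (does⁺ (s₂ ∈? flat L) q) (not⁻ m₂))
    with ∨⁻ {adj G t s₁} o₁ | ∨⁻ {adj G t s₂} o₂
  ... | inj₁ e₁ | inj₁ e₂ = ⊥-elim (same-end s₁∉ s₂∉ e₁ e₂ ne)
  ... | inj₁ e₁ | inj₂ e₂ = ⊥-elim (other-end p s₁∉ s₂∉ e₁ e₂ ne)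
  ... | inj₂ e₁ | inj₁ e₂ = ⊥-elim (other-end p s₂∉ s₁∉ e₂ e₁ (≢-sym ne))
  ... | inj₂ e₁ | inj₂ e₂ = ⊥-elim (same-end s₁∉ s₂∉ e₁ e₂ ne)
  out-bound : ∀ L′ → (∀ {p} → p ∈ L′ → p ∈ L) → # (out L′) ≤ length L′
  out-bound [] sub = ≤-trans (#-⊆ {q = λ _ → false} (λ i e → ⊥-elim (true≢false (proj₂ (∧⁻ {not (mem (flat L) i)} e)) refl))) (≤-reflexive ∑-0)
  out-bound ((t , t′) ∷ L′) sub = ≤-trans (#-cover sp) (#≤1 (one (sub (here refl))) ⊕ out-bound L′ (sub ∘ there))
    where
    sp : ∀ i → out ((t , t′) ∷ L′) i ≡ true →
      not (mem (flat L) i) ∧ (adj G t i ∨ adj G t′ i) ≡ true ⊎ out L′ i ≡ true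
    sp i e with m , o ← ∧⁻ {not (mem (flat L) i)} e with ∨⁻ {adj G t i ∨ adj G t′ i} o
    ... | inj₁ x = inj₁ (∧⁺ m x)
    ... | inj₂ x = inj₂ (∧⁺ m x)

⊓-step : ∀ a b c D → a ≤ b + c → a ⊓ D ≤ b ⊓ D + c
⊓-step a b c D h with ≤-total b D
... | inj₁ b≤D = ≤-trans (m⊓n≤m a D) (≤-trans h (≤-reflexive (cong (_+ c) (sym (m≤n⇒m⊓n≡m b≤D)))))
... | inj₂ D≤b = ≤-trans (m⊓n≤n a D) (≤-trans (m≤m+n D c) (≤-reflexive (cong (_+ c) (sym (m≥n⇒m⊓n≡n D≤b)))))

del : Fin n → Fin n → Bool
del v i = not (i == v)

-- Induction on `y`. If deleting some `v` lowers the bound on the matching number, the sum loses at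
-- most `D` at `v` and 1 at each of at most `K` neighbours. If no deletion lowers it and the bound
-- is attained, every vertex is missed by a maximum matching; then at most three times the matching
-- number of vertices are not isolated, and `3 * D ≤ K + D`.
truncated-degree-bound : ∀ y {K D} (G : SimpleGraph n) → ν≤ G y → (∀ i → deg G i ≤ K) → 2 * D ≤ K →
  ∑ (λ i → deg G i ⊓ D) ≤ y * (K + D)
truncated-degree-bound zero {K} {D} G ν h 2D≤K = ≤-trans (∑-mono isolated) (≤-reflexive ∑-0)
  where
  isolated : ∀ i → deg G i ⊓ D ≤ 0
  isolated i with deg G i ≤? 0
  ... | yes d≤0 = ≤-trans (m⊓n≤m _ D) d≤0
  ... | no d≰0 with j , e ← inhabited (≰⇒> d≰0)
    = ⊥-elim (1+n≰n (ν ((i , j) ∷ []) (e ∷ [] , (adj⇒≢ G e ∷ []) ∷ ([] ∷ []))))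
truncated-degree-bound {n} (suc y) {K} {D} G ν h 2D≤K = stable-≤ λ k →
  em (∃ λ v → ν≤ (restrict G (del v)) y) λ where
    (inj₁ (v , ν′)) → k (delete-vertex v ν′)
    (inj₂ none) → em (∃ λ L → IsMatching G L × length L ≡ suc y) λ where
      (inj₂ none′) → k (≤-trans
        (truncated-degree-bound y G (λ L M → ≤-pred (≤∧≢⇒< (ν L M) (λ len → none′ (L , M , len)))) h 2D≤K)
        (m≤n+m _ (K + D)))
      (inj₁ (L , M , len)) → k (few-touched (touched≤3ν G ν (missing none) L M len))
  where
  open ≤-Reasoning
  K-bound : ∀ v i → deg (restrict G (del v)) i ≤ K
  K-bound v i = ≤-trans (#-⊆ (λ j e → proj₁ (restrict⁻ G (del v) {i} e))) (h i)
  missing : ¬ (∃ λ v → ν≤ (restrict G (del v)) y) → ∀ v → ¬ ¬ (∃ λ N → IsMatching G N × v ∉ flat N × length N ≡ suc y)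
  missing none v k = none (v , λ N (a , u) → ≤-pred (≤∧≢⇒<
    (ν N (All.map (λ e → proj₁ (restrict⁻ G (del v) e)) a , u))
    (λ len → k (N , (All.map (λ e → proj₁ (restrict⁻ G (del v) e)) a , u) , avoids N a , len))))
    where
    avoids : ∀ N → All (Edge (restrict G (del v))) N → v ∉ flat N
    avoids ((x , z) ∷ N) (e ∷ a) (here refl) =
      true≢false (==⁺ {i = v} refl) (not⁻ (proj₁ (proj₂ (restrict⁻ G (del v) {x} {z} e))))
    avoids ((x , z) ∷ N) (e ∷ a) (there (here refl)) =
      true≢false (==⁺ {i = v} refl) (not⁻ (proj₂ (proj₂ (restrict⁻ G (del v) {x} {z} e))))
    avoids (_ ∷ N) (e ∷ a) (there (there p)) = avoids N a p
  few-touched : # (touched G) ≤ 3 * suc y → ∑ (λ i → deg G i ⊓ D) ≤ suc y * (K + D)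
  few-touched t = begin
    ∑ (λ i → deg G i ⊓ D) ≤⟨ ∑-mono pt ⟩
    ∑ (λ i → D * ⟦ touched G i ⟧) ≡⟨ ∑-* D _ ⟩
    D * # (touched G) ≤⟨ *-monoʳ-≤ D t ⟩
    D * (3 * suc y) ≡⟨ ar D (suc y) ⟩
    suc y * (2 * D + D) ≤⟨ *-monoʳ-≤ (suc y) (+-monoˡ-≤ D 2D≤K) ⟩
    suc y * (K + D) ∎
    where
    ar : ∀ D y → D * (3 * y) ≡ y * (2 * D + D)
    ar = solve-∀
    pt : ∀ i → deg G i ⊓ D ≤ D * ⟦ touched G i ⟧
    pt i with touched G i in eq
    ... | true = ≤-trans (m⊓n≤n (deg G i) D) (≤-reflexive (sym (*-identityʳ D)))
    ... | false = ≤-trans (m⊓n≤m (deg G i) D)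
      (≤-trans (≤-pred (≰⇒> (λ d → true≢false (does⁺ (1 ≤? deg G i) d) eq))) z≤n)
  delete-vertex : ∀ v → ν≤ (restrict G (del v)) y → ∑ (λ i → deg G i ⊓ D) ≤ suc y * (K + D)
  delete-vertex v ν′ = begin
    ∑ (λ i → deg G i ⊓ D) ≤⟨ ∑-mono pt ⟩
    ∑ (λ i → deg G′ i ⊓ D + (⟦ i == v ⟧ * D + ⟦ adj G v i ⟧))
      ≡⟨ trans (∑-+ _ _) (cong (∑ (λ i → deg G′ i ⊓ D) +_) (trans (∑-+ _ _) (cong (_+ deg G v) (∑-δ v _)))) ⟩
    ∑ (λ i → deg G′ i ⊓ D) + (D + deg G v)
      ≤⟨ truncated-degree-bound y G′ ν′ (K-bound v) 2D≤K ⊕ +-monoʳ-≤ D (h v) ⟩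
    y * (K + D) + (D + K) ≡⟨ ar (y * (K + D)) D K ⟩
    suc y * (K + D) ∎
    where
    G′ = restrict G (del v)
    ar : ∀ z D K → z + (D + K) ≡ K + D + z
    ar = solve-∀
    pt : ∀ i → deg G i ⊓ D ≤ deg G′ i ⊓ D + (⟦ i == v ⟧ * D + ⟦ adj G v i ⟧)
    pt i with bool (i == v)
    ... | inj₁ eq = ≤-trans (m⊓n≤n (deg G i) D)
      (≤-trans (≤-reflexive (trans (sym (*-identityˡ D)) (cong (λ b → ⟦ b ⟧ * D) (sym eq))))
        (≤-trans (m≤m+n (⟦ i == v ⟧ * D) _) (m≤n+m _ (deg G′ i ⊓ D))))
    ... | inj₂ eq = ≤-trans (⊓-step (deg G i) (deg G′ i) ⟦ adj G v i ⟧ D (≤-trans (#-cover sp) (+-monoʳ-≤ (deg G′ i) last)))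
      (+-monoʳ-≤ (deg G′ i ⊓ D) (m≤n+m ⟦ adj G v i ⟧ (⟦ i == v ⟧ * D)))
      where
      sp : ∀ j → adj G i j ≡ true → adj G′ i j ≡ true ⊎ (j == v) ∧ adj G v i ≡ true
      sp j e with j == v in eq′
      ... | false = inj₁ (∧⁺ e (∧⁺ (not⁺ eq) refl))
      ... | true with refl ← ==⁻ {i = j} eq′ = inj₂ (adj-flip G e)
      last : # (λ j → (j == v) ∧ adj G v i) ≤ ⟦ adj G v i ⟧
      last = begin
        # (λ j → (j == v) ∧ adj G v i) ≤⟨ ∑-mono (λ j → ind (j == v) (adj G v i)) ⟩
        ∑ (λ j → ⟦ j == v ⟧ * ⟦ adj G v i ⟧) ≡⟨ ∑-δ v _ ⟩
        ⟦ adj G v i ⟧ ∎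
        where
        ind : ∀ a b → ⟦ a ∧ b ⟧ ≤ ⟦ a ⟧ * ⟦ b ⟧
        ind true b = ≤-reflexive (sym (*-identityˡ ⟦ b ⟧))
        ind false b = z≤n

-- Copies of friendship graphs, as a centre with a list of disjoint pairs

Blade : (Fin n → Fin n → Set) → Fin n → Fin n × Fin n → Set
Blade R x (u , v) = R x u × R x v × R u v

Flower : (Fin n → Fin n → Set) → Fin n → List (Fin n × Fin n) → Set
Flower R x L = All (Blade R x) L × Unique (x ∷ flat L)

Sym : (Fin n → Fin n → Set) → Set
Sym R = ∀ {i j} → R i j → R j i

Embedding : (Fin n → Fin n → Set) → (Fin m → Fin m → Set) → Set
Embedding {n} {m} R E = Σ (Fin m → Fin n) λ φ → Injective _≡_ _≡_ φ × (∀ a b → E a b → R (φ a) (φ b))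

nth : ∀ {A : Set} → A → List A → ℕ → A
nth d [] _ = d
nth d (x ∷ xs) zero = x
nth d (x ∷ xs) (suc i) = nth d xs i

nth-∈ : ∀ {A : Set} (d : A) xs {i} → i < length xs → nth d xs i ∈ xs
nth-∈ d (x ∷ xs) {zero} _ = here refl
nth-∈ d (x ∷ xs) {suc i} (s≤s p) = there (nth-∈ d xs p)

nth-injective : ∀ {A : Set} (d : A) {xs} → Unique xs → ∀ {i j} → i < length xs → j < length xs →
  nth d xs i ≡ nth d xs j → i ≡ j
nth-injective d {x ∷ xs} u {zero} {zero} p q e = refl
nth-injective d {x ∷ xs} u {zero} {suc j} p (s≤s q) e = ⊥-elim (Unique-head u (subst (_∈ xs) (sym e) (nth-∈ d xs q)))
nth-injective d {x ∷ xs} u {suc i} {zero} (s≤s p) q e = ⊥-elim (Unique-head u (subst (_∈ xs) e (nth-∈ d xs p)))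
nth-injective d {x ∷ xs} u {suc i} {suc j} (s≤s p) (s≤s q) e = cong suc (nth-injective d (Unique-tail u) p q e)

flower-spoke : {R : Fin n → Fin n → Set} {x : Fin n} {L : List (Fin n × Fin n)} → All (Blade R x) L → ∀ {z} → z ∈ flat L → R x z
flower-spoke {L = _ ∷ L} ((r , _ , _) ∷ a) (here refl) = r
flower-spoke {L = _ ∷ L} ((_ , r , _) ∷ a) (there (here refl)) = r
flower-spoke {L = _ ∷ L} (_ ∷ a) (there (there p)) = flower-spoke a p

flower-rim : {R : Fin n → Fin n → Set} {x d : Fin n} {L : List (Fin n × Fin n)} → All (Blade R x) L →
  ∀ i → suc (2 * i) < length (flat L) → R (nth d (flat L) (2 * i)) (nth d (flat L) (suc (2 * i)))
flower-rim {L = _ ∷ L} ((_ , _ , r) ∷ a) zero p = r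
flower-rim {R = R} {d = d} {L = (u , v) ∷ L} (_ ∷ a) (suc i) p = go (2 * suc i) (*-suc 2 i) p
  where
  go : ∀ j → j ≡ 2 + 2 * i → suc j < 2 + length (flat L) →
    R (nth d (u ∷ v ∷ flat L) j) (nth d (u ∷ v ∷ flat L) (suc j))
  go _ refl (s≤s (s≤s q)) = flower-rim a i q

-- Positions in `x ∷ flat L` match the numbering of `FriendEdgeℕ`: the centre at 0, blade `i` at
-- `2 * i + 1` and `2 * i + 2`.
flower⇒embedding : {R : Fin n → Fin n → Set} → Sym R → ∀ {x L} → Flower R x L → Embedding R (FriendEdge (length L))
flower⇒embedding {R = R} R-sym {x} {L} (a , u) = φ , inj , edge
  where
  k = length L
  φ : Fin (fsize k) → Fin _
  φ i = nth x (x ∷ flat L) (toℕ i)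
  bound : ∀ i → toℕ {fsize k} i < suc (length (flat L))
  bound i = ≤-trans (toℕ<n i) (≤-reflexive (cong suc (sym (length-flat L))))
  inj : Injective _≡_ _≡_ φ
  inj {i} {j} e = toℕ-injective (nth-injective x u (bound i) (bound j) e)
  spoke : ∀ b → b ≢ 0 → b < suc (length (flat L)) → R x (nth x (x ∷ flat L) b)
  spoke zero b≢0 _ = ⊥-elim (b≢0 refl)
  spoke (suc b) _ (s≤s p) = flower-spoke a (nth-∈ x (flat L) p)
  rim : ∀ {b c} i → b ≡ suc (2 * i) → c ≡ suc (suc (2 * i)) → c < suc (length (flat L)) →
    R (nth x (x ∷ flat L) b) (nth x (x ∷ flat L) c)
  rim i refl refl (s≤s p) = flower-rim a i p
  centre : ∀ {b} → b ≡ 0 → nth x (x ∷ flat L) b ≡ x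
  centre refl = refl
  edge : ∀ b c → FriendEdge k b c → R (φ b) (φ c)
  edge b c (inj₁ (b≡0 , c≢0)) = subst (λ y → R y (φ c)) (sym (centre b≡0)) (spoke (toℕ c) c≢0 (bound c))
  edge b c (inj₂ (inj₁ (c≡0 , b≢0))) = R-sym (subst (λ y → R y (φ b)) (sym (centre c≡0)) (spoke (toℕ b) b≢0 (bound b)))
  edge b c (inj₂ (inj₂ (i , inj₁ (p , q)))) = rim i p q (bound c)
  edge b c (inj₂ (inj₂ (i , inj₂ (p , q)))) = R-sym (rim i p q (bound b))

embedding⇒flower : {R : Fin n → Fin n → Set} {k : ℕ} → Embedding R (FriendEdge k) →
  ∃₂ λ x L → Flower R x L × length L ≡ k
embedding⇒flower {n} {R} {k} (φ , inj , edge) = ψ 0 , blades k , (blades-ok k ≤-refl , ¬Any⇒All¬ _ (centre∉ k ≤-refl) ∷ uniq k ≤-refl) , len k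
  where
  -- Extending `φ` to ℕ avoids arithmetic in `Fin`; the default is arbitrary, since only indices
  -- below `fsize k` occur.
  ψ : ℕ → Fin n
  ψ i with i <? fsize k
  ... | yes p = φ (fromℕ< p)
  ... | no _ = φ zero
  ψ-eq : ∀ {i} (p : i < fsize k) → ψ i ≡ φ (fromℕ< p)
  ψ-eq {i} p with i <? fsize k
  ... | yes q = refl
  ... | no ¬q = ⊥-elim (¬q p)
  ψ-inj : ∀ {i j} → i < fsize k → j < fsize k → ψ i ≡ ψ j → i ≡ j
  ψ-inj {i} {j} p q e = fromℕ<-injective i j p q (inj (trans (sym (ψ-eq p)) (trans e (ψ-eq q))))
  ψ-edge : ∀ {i j} → i < fsize k → j < fsize k → FriendEdgeℕ i j → R (ψ i) (ψ j)
  ψ-edge p q e rewrite ψ-eq p | ψ-eq q = edge _ _ (subst (λ i → FriendEdgeℕ i _) (sym (toℕ-fromℕ< p)) (subst (FriendEdgeℕ _) (sym (toℕ-fromℕ< q)) e))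
  blades : ℕ → List (Fin n × Fin n)
  blades zero = []
  blades (suc j) = (ψ (suc (2 * j)) , ψ (suc (suc (2 * j)))) ∷ blades j
  len : ∀ j → length (blades j) ≡ j
  len zero = refl
  len (suc j) = cong suc (len j)
  hi : ∀ {j} → suc j ≤ k → suc (suc (2 * j)) < fsize k
  hi {j} p = s≤s (≤-trans (≤-reflexive (sym (*-suc 2 j))) (*-monoʳ-≤ 2 p))
  lo : ∀ {j} → suc j ≤ k → suc (2 * j) < fsize k
  lo p = ≤-trans (n≤1+n _) (hi p)
  blades-ok : ∀ j → j ≤ k → All (Blade R (ψ 0)) (blades j)
  blades-ok zero _ = []
  blades-ok (suc j) p =
    (ψ-edge (s≤s z≤n) (lo p) (inj₁ (refl , λ ())) , ψ-edge (s≤s z≤n) (hi p) (inj₁ (refl , λ ())) ,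
     ψ-edge (lo p) (hi p) (inj₂ (inj₂ (j , inj₁ (refl , refl))))) ∷ blades-ok j (≤-trans (n≤1+n j) p)
  index : ∀ j {z} → z ∈ flat (blades j) → ∃ λ i → 1 ≤ i × i ≤ 2 * j × z ≡ ψ i
  index (suc j) (here e) = suc (2 * j) , s≤s z≤n , ≤-trans (n≤1+n _) (≤-reflexive (sym (*-suc 2 j))) , e
  index (suc j) (there (here e)) = suc (suc (2 * j)) , s≤s z≤n , ≤-reflexive (sym (*-suc 2 j)) , e
  index (suc j) (there (there p)) = let i , a , b , e = index j p in i , a , ≤-trans b (*-monoʳ-≤ 2 (n≤1+n j)) , e
  small : ∀ {i j} → i ≤ 2 * j → j ≤ k → i < fsize k
  small p q = s≤s (≤-trans p (*-monoʳ-≤ 2 q))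
  centre∉ : ∀ j → j ≤ k → ψ 0 ∉ flat (blades j)
  centre∉ j p q = let i , a , b , e = index j q in <⇒≢ a (ψ-inj (s≤s z≤n) (small b p) e)
  uniq : ∀ j → j ≤ k → Unique (flat (blades j))
  uniq zero _ = []
  uniq (suc j) p =
    (λ { (here e) → 1+n≢n (sym (ψ-inj (lo p) (hi p) e))
       ; (there q) → let i , _ , b , e = index j q in <⇒≢ (s≤s b) (sym (ψ-inj (lo p) (small b (≤-trans (n≤1+n j) p)) e)) }) ∷ᵘ
    (λ q → let i , _ , b , e = index j q in <⇒≢ (≤-trans (s≤s b) (n≤1+n _)) (sym (ψ-inj (hi p) (small b (≤-trans (n≤1+n j) p)) e))) ∷ᵘ
    uniq j (≤-trans (n≤1+n j) p)

flower-shrink : {R : Fin n → Fin n → Set} {x : Fin n} (L : List (Fin n × Fin n)) {q : ℕ} → Flower R x L → q ≤ length L →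
  ∃ λ L′ → Flower R x L′ × length L′ ≡ q
flower-shrink L {q} F le with q <? length L
flower-shrink L {q} F le | no ¬lt = L , F , ≤-antisym (≮⇒≥ ¬lt) le
flower-shrink (_ ∷ L) {q} (_ ∷ a , (_ ∷ x≢) ∷ (_ ∷ (_ ∷ u))) le | yes (s≤s lt) = flower-shrink L (a , All.tail x≢ ∷ u) lt

-- Each vertex of `us` awaits a third vertex outside what has been built so far. `B` bounds the
-- number of vertices of the final flower, which is invariant under the recursion, so one extension
-- hypothesis serves every step.
greedy : {R : Fin n → Fin n → Set} {x : Fin n} (B : ℕ) (us : List (Fin n)) (L : List (Fin n × Fin n)) →
  All (Blade R x) L → Unique (x ∷ us ++ flat L) →
  All (λ u → R x u × (∀ zs → length zs ≤ B → ∃ λ w → w ∉ zs × R x w × R u w)) us →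
  1 + 2 * (length us + length L) ≤ B →
  ∃ λ L′ → Flower R x L′ × length L′ ≡ length us + length L
greedy B [] L a u [] le = L , (a , u) , refl
greedy {x = x} B (v ∷ us) L a u ((xv , ext) ∷ h) le =
  let w , w∉ , xw , vw = ext (x ∷ v ∷ us ++ flat L) bound
      u′ : Unique (w ∷ x ∷ v ∷ us ++ flat L)
      u′ = w∉ ∷ᵘ u
      per : w ∷ x ∷ v ∷ us ++ flat L ↭ x ∷ us ++ v ∷ w ∷ flat L
      per = ↭-trans (swap w x ↭-refl) (prep x (↭-trans (swap w v ↭-refl) (shifts (v ∷ w ∷ []) us)))
      L′ , F , len = greedy B us ((v , w) ∷ L) ((xv , xw , vw) ∷ a) (Unique-resp-↭ per u′) h
                       (≤-trans (≤-reflexive (cong (λ z → 1 + 2 * z) (+-suc (length us) (length L)))) le)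
  in L′ , F , trans len (+-suc (length us) (length L))
  where
  ar : ∀ a b B → 2 + (a + 2 * b) + B + suc a ≡ B + (1 + 2 * (suc a + b))
  ar = solve-∀
  bound : length (x ∷ v ∷ us ++ flat L) ≤ B
  bound = ≤-trans (≤-reflexive (cong (2 +_) (trans (length-++ us) (cong (length us +_) (length-flat L)))))
    (lin (suc (length us)) le (ar (length us) (length L) B))

-- Rainbow relations

Rainbow : ∀ {r} → (Fin n → Fin n → Fin r) → (Fin n → Fin n → Set) → Set
Rainbow c R = ∀ {i j i′ j′} → R i j → R i′ j′ → c i j ≡ c i′ j′ → (i ≡ i′ × j ≡ j′) ⊎ (i ≡ j′ × j ≡ i′)

rainbow-flower : ∀ {r} {c : Fin n → Fin n → Fin r} {R : Fin n → Fin n → Set} → Sym R → Rainbow c R →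
  ∀ {x L q} → Flower R x L → q ≤ length L → HasRainbow c (FriendEdge q)
rainbow-flower R-sym rb {L = L} F le with L′ , F′ , refl ← flower-shrink L F le
  with φ , inj , edge ← flower⇒embedding R-sym F′
  = φ , inj , λ a b a′ b′ E E′ eq → [ (λ (p , q) → inj₁ (inj p , inj q)) , (λ (p , q) → inj₂ (inj p , inj q)) ]′
      (rb (edge a b E) (edge a′ b′ E′) eq)

-- The exchange: the pairs of `P` enter and the edges carrying their colours leave. The result is
-- rainbow as soon as different pairs of `P` have different colours.
AddPairs : ∀ {r} → (Fin n → Fin n → Fin r) → (Fin n → Fin n → Set) → List (Fin n × Fin n) → Fin n → Fin n → Set
AddPairs c R P i j = ((i , j) ∈ P ⊎ (j , i) ∈ P) ⊎ (R i j × (∀ {u v} → (u , v) ∈ P → c i j ≢ c u v))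

addPairs-sym : ∀ {r} {c : Fin n → Fin n → Fin r} → (∀ i j → c i j ≡ c j i) → {R : Fin n → Fin n → Set} → Sym R →
  ∀ {P} → Sym (AddPairs c R P)
addPairs-sym c-sym R-sym (inj₁ (inj₁ p)) = inj₁ (inj₂ p)
addPairs-sym c-sym R-sym (inj₁ (inj₂ p)) = inj₁ (inj₁ p)
addPairs-sym c-sym R-sym {i = i} {j} (inj₂ (r , new)) = inj₂ (R-sym r , λ p e → new p (trans (c-sym i j) e))

addPairs-rainbow : ∀ {r} {c : Fin n → Fin n → Fin r} → (∀ i j → c i j ≡ c j i) → {R : Fin n → Fin n → Set} → Rainbow c R →
  ∀ {P} → (∀ {u v u′ v′} → (u , v) ∈ P → (u′ , v′) ∈ P → c u v ≡ c u′ v′ → u ≡ u′ × v ≡ v′) →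
  Rainbow c (AddPairs c R P)
addPairs-rainbow {c = c} c-sym rb P-inj = go
  where
  go : Rainbow c _
  go (inj₁ (inj₁ p)) (inj₁ (inj₁ q)) e = inj₁ (P-inj p q e)
  go {i′ = i′} {j′} (inj₁ (inj₁ p)) (inj₁ (inj₂ q)) e = inj₂ (P-inj p q (trans e (c-sym i′ j′)))
  go {i} {j} (inj₁ (inj₂ p)) (inj₁ (inj₁ q)) e = let a , b = P-inj p q (trans (c-sym j i) e) in inj₂ (b , a)
  go {i} {j} {i′} {j′} (inj₁ (inj₂ p)) (inj₁ (inj₂ q)) e =
    let a , b = P-inj p q (trans (c-sym j i) (trans e (c-sym i′ j′))) in inj₁ (b , a)
  go (inj₁ (inj₁ p)) (inj₂ (_ , new)) e = ⊥-elim (new p (sym e))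
  go {i} {j} (inj₁ (inj₂ p)) (inj₂ (_ , new)) e = ⊥-elim (new p (trans (sym e) (c-sym i j)))
  go (inj₂ (_ , new)) (inj₁ (inj₁ p)) e = ⊥-elim (new p e)
  go {i′ = i′} {j′} (inj₂ (_ , new)) (inj₁ (inj₂ p)) e = ⊥-elim (new p (trans e (c-sym i′ j′)))
  go (inj₂ (r , _)) (inj₂ (r′ , _)) e = rb r r′ e

-- Edge counts and the function `τ`

sum-allFin : (f : Fin n → ℕ) → sumℓ (map f (allFin n)) ≡ ∑ f
sum-allFin f = trans (cong sumℓ (map-tabulate id f)) (go f)
  where
  go : ∀ {n} (f : Fin n → ℕ) → sumℓ (tabulate f) ≡ ∑ f
  go {zero} f = sym (∑-zero f)
  go {suc n} f = trans (cong (f zero +_) (go (f ∘ suc))) (sym (∑-suc f))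

<ᵇ⁺ : ∀ {a b} → a < b → (a <ᵇ b) ≡ true
<ᵇ⁺ {a} {b} p with a <ᵇ b | <⇒<ᵇ p
... | true | _ = refl

<ᵇ⁻ : ∀ {a b} → (a <ᵇ b) ≡ true → a < b
<ᵇ⁻ {a} {b} e = <ᵇ⇒< a b (subst T (sym e) tt)

≮ᵇ : ∀ {a b} → b ≤ a → (a <ᵇ b) ≡ false
≮ᵇ {a} {b} p = ¬true⇒false (λ e → <⇒≱ (<ᵇ⁻ e) p)

edgeCount-∑ : (G : SimpleGraph n) → edgeCount G ≡ ∑ (λ i → ∑ (λ j → ⟦ adj G i j ∧ (toℕ i <ᵇ toℕ j) ⟧))
edgeCount-∑ G = trans (sum-allFin _) (∑-cong (λ i → sum-allFin _))

2*edgeCount : (G : SimpleGraph n) → edges₂ G ≡ 2 * edgeCount G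
2*edgeCount G = begin
  ∑ (λ i → ∑ (λ j → ⟦ adj G i j ⟧)) ≡⟨ ∑-cong (λ i → trans (∑-cong (λ j → pt i j)) (∑-+ _ _)) ⟩
  ∑ (λ i → ∑ (λ j → ⟦ adj G i j ∧ (toℕ i <ᵇ toℕ j) ⟧) + ∑ (λ j → ⟦ adj G j i ∧ (toℕ j <ᵇ toℕ i) ⟧)) ≡⟨ ∑-+ _ _ ⟩
  s + ∑ (λ i → ∑ (λ j → ⟦ adj G j i ∧ (toℕ j <ᵇ toℕ i) ⟧)) ≡⟨ cong (s +_) (∑-swap _) ⟩
  s + s ≡⟨ cong (s +_) (sym (+-identityʳ s)) ⟩
  2 * s ≡⟨ cong (2 *_) (sym (edgeCount-∑ G)) ⟩
  2 * edgeCount G ∎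
  where
  open ≡-Reasoning
  s = ∑ (λ i → ∑ (λ j → ⟦ adj G i j ∧ (toℕ i <ᵇ toℕ j) ⟧))
  pt : ∀ i j → ⟦ adj G i j ⟧ ≡ ⟦ adj G i j ∧ (toℕ i <ᵇ toℕ j) ⟧ + ⟦ adj G j i ∧ (toℕ j <ᵇ toℕ i) ⟧
  pt i j rewrite adj-sym G j i with adj G i j in e
  ... | false = refl
  ... | true with <-cmp (toℕ i) (toℕ j)
  ... | tri< lt _ _ rewrite <ᵇ⁺ lt | ≮ᵇ (<⇒≤ lt) = refl
  ... | tri> _ _ gt rewrite <ᵇ⁺ gt | ≮ᵇ (<⇒≤ gt) = refl
  ... | tri≈ _ eq _ = ⊥-elim (adj⇒≢ G e (toℕ-injective eq))

-- τ n = ⌊ n ² / 4 ⌋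
τ : ℕ → ℕ
τ n = ⌊ n /2⌋ * ⌈ n /2⌉

-- The increment is the degree threshold of `delete-low`.
τ-suc : ∀ n → τ (suc n) ≡ ⌊ suc n /2⌋ + τ n
τ-suc n = trans (*-suc ⌈ n /2⌉ ⌊ n /2⌋) (cong (⌈ n /2⌉ +_) (*-comm ⌈ n /2⌉ ⌊ n /2⌋))

*≤τ : ∀ a b → a * b ≤ τ (a + b)
*≤τ zero b = z≤n
*≤τ (suc a) zero = ≤-trans (≤-reflexive (*-zeroʳ a)) z≤n
*≤τ (suc a) (suc b) = begin
  suc a * suc b ≡⟨ ar a b ⟩
  suc (a + b) + a * b ≤⟨ +-monoʳ-≤ (suc (a + b)) (*≤τ a b) ⟩
  suc (a + b) + τ (a + b) ≡⟨ cong (λ z → suc z + τ (a + b)) (sym (⌊n/2⌋+⌈n/2⌉≡n (a + b))) ⟩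
  suc ⌊ a + b /2⌋ + ⌈ a + b /2⌉ + τ (a + b) ≡⟨ +-assoc (suc ⌊ a + b /2⌋) _ _ ⟩
  suc ⌊ a + b /2⌋ + (⌈ a + b /2⌉ + τ (a + b)) ≡⟨ cong (suc ⌊ a + b /2⌋ +_) (sym (τ-suc (a + b))) ⟩
  suc ⌊ a + b /2⌋ + τ (suc (a + b)) ≡⟨ sym (τ-suc (suc (a + b))) ⟩
  τ (suc (suc (a + b))) ≡⟨ cong (τ ∘ suc) (sym (+-suc a b)) ⟩
  τ (suc a + suc b) ∎
  where
  open ≤-Reasoning
  ar : ∀ a b → suc a * suc b ≡ suc (a + b) + a * b
  ar = solve-∀

∑∑-product : (p q : Fin n → Bool) → ∑ (λ i → ∑ (λ j → ⟦ p i ∧ q j ⟧)) ≡ # p * # q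
∑∑-product p q = begin
  ∑ (λ i → ∑ (λ j → ⟦ p i ∧ q j ⟧)) ≡⟨ ∑-cong (λ i → trans (∑-cong (λ j → pt (p i) (q j))) (∑-* ⟦ p i ⟧ _)) ⟩
  ∑ (λ i → ⟦ p i ⟧ * # q) ≡⟨ ∑-cong (λ i → *-comm ⟦ p i ⟧ (# q)) ⟩
  ∑ (λ i → # q * ⟦ p i ⟧) ≡⟨ ∑-* (# q) _ ⟩
  # q * # p ≡⟨ *-comm (# q) (# p) ⟩
  # p * # q ∎
  where
  open ≡-Reasoning
  pt : ∀ a b → ⟦ a ∧ b ⟧ ≡ ⟦ a ⟧ * ⟦ b ⟧
  pt true b = sym (*-identityˡ ⟦ b ⟧)
  pt false b = refl

-- Complete bipartite graphs with a sparse graph inside one part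

adjoin : SimpleGraph n → (P Q : Fin n → Bool) → (∀ i → P ∋ i → Q ∋ i → ⊥) → SimpleGraph n
adjoin H P Q dis = record
  { adj = λ i j → adj H i j ∨ ((P i ∧ Q j) ∨ (P j ∧ Q i))
  ; sym = λ i j → cong₂ _∨_ (adj-sym H i j) (∨-comm (P i ∧ Q j) (P j ∧ Q i))
  ; irrefl = λ i → ¬true⇒false (λ e → loop i (∨⁻ {adj H i i} e)) }
  where
  loop : ∀ i → adj H i i ≡ true ⊎ (P i ∧ Q i) ∨ (P i ∧ Q i) ≡ true → ⊥
  loop i (inj₁ e) = true≢false e (adj-irrefl H i)
  loop i (inj₂ e) = let a , b = ∧⁻ {P i} ([ id , id ]′ (∨⁻ {P i ∧ Q i} e)) in dis i a b

adjoin⁻ : (H : SimpleGraph n) {P Q : Fin n → Bool} {dis : ∀ i → P ∋ i → Q ∋ i → ⊥} → ∀ {i j} →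
  adj (adjoin H P Q dis) i j ≡ true → adj H i j ≡ true ⊎ (P ∋ i × Q ∋ j) ⊎ (P ∋ j × Q ∋ i)
adjoin⁻ H {P} {Q} {i = i} {j} e with ∨⁻ {adj H i j} e
... | inj₁ h = inj₁ h
... | inj₂ h with ∨⁻ {P i ∧ Q j} h
... | inj₁ p = inj₂ (inj₁ (∧⁻ p))
... | inj₂ p = inj₂ (inj₂ (∧⁻ p))

edges₂-adjoin : (H : SimpleGraph n) (P Q : Fin n → Bool) (dis : ∀ i → P ∋ i → Q ∋ i → ⊥) →
  (∀ {i} → Q ∋ i → touched H ∌ i) →
  edges₂ H + 2 * (# P * # Q) ≤ edges₂ (adjoin H P Q dis)
edges₂-adjoin H P Q dis untouched = begin
  edges₂ H + 2 * (# P * # Q)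
    ≡⟨ cong (edges₂ H +_) (cong (# P * # Q +_) (+-identityʳ _)) ⟩
  edges₂ H + (# P * # Q + # P * # Q)
    ≡⟨ cong (edges₂ H +_) (cong₂ _+_ (sym (∑∑-product P Q)) (trans (sym (∑∑-product P Q)) (∑-swap _))) ⟩
  edges₂ H + (∑ (λ i → ∑ (λ j → ⟦ P i ∧ Q j ⟧)) + ∑ (λ i → ∑ (λ j → ⟦ P j ∧ Q i ⟧)))
    ≡⟨ sym (trans (∑-cong (λ i → trans (∑-+ _ _) (cong (deg H i +_) (∑-+ _ _))))
         (trans (∑-+ _ _) (cong (edges₂ H +_) (∑-+ _ _)))) ⟩
  ∑ (λ i → ∑ (λ j → ⟦ adj H i j ⟧ + (⟦ P i ∧ Q j ⟧ + ⟦ P j ∧ Q i ⟧)))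
    ≤⟨ ∑-mono (λ i → ∑-mono (λ j → pt i j)) ⟩
  edges₂ (adjoin H P Q dis) ∎
  where
  open ≤-Reasoning
  pt : ∀ i j → ⟦ adj H i j ⟧ + (⟦ P i ∧ Q j ⟧ + ⟦ P j ∧ Q i ⟧) ≤ ⟦ adj H i j ∨ ((P i ∧ Q j) ∨ (P j ∧ Q i)) ⟧
  pt i j = ≤-trans (+-monoʳ-≤ ⟦ adj H i j ⟧
      (⟦⟧-disjoint {P i ∧ Q j} {P j ∧ Q i} {(P i ∧ Q j) ∨ (P j ∧ Q i)} ∨⁺ˡ (∨⁺ʳ {P i ∧ Q j})
        (λ a b → dis i (proj₁ (∧⁻ {P i} a)) (proj₂ (∧⁻ {P j} b)))))
    (⟦⟧-disjoint {adj H i j} ∨⁺ˡ (∨⁺ʳ {adj H i j}) excl)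
    where
    excl : adj H i j ≡ true → (P i ∧ Q j) ∨ (P j ∧ Q i) ≡ true → ⊥
    excl e h with ∨⁻ {P i ∧ Q j} h
    ... | inj₁ p = true≢false (proj₂ (touched⁺ H e)) (untouched (proj₂ (∧⁻ {P i} p)))
    ... | inj₂ p = true≢false (proj₁ (touched⁺ H e)) (untouched (proj₂ (∧⁻ {P j} p)))

-- With the centre in `Q` all petals lie in `P`, and the outer edges of the blades form a matching
-- of `H`. With the centre in `P` every blade has a petal outside the independent set `Q`, and the
-- spoke to it is an edge of `H`. So the matching number or the degree bounds the number of blades.
adjoin-free : (H : SimpleGraph n) {P Q : Fin n → Bool} (dis : ∀ i → P ∋ i → Q ∋ i → ⊥) → (∀ i → Q ∌ i → P ∋ i) →
  (∀ {i} → Q ∋ i → touched H ∌ i) → ∀ {K} → ν≤ H K → (∀ i → deg H i ≤ K) →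
  ¬ Contains (adjoin H P Q dis) (FriendEdge (suc K))
adjoin-free {n} H {P} {Q} dis total untouched {K} ν Δ cont
  with x , L , (a , _ ∷ u) , len ← embedding⇒flower cont with bool (Q x)
... | inj₁ qx = 1+n≰n (≤-trans (≤-reflexive (sym len)) (ν L (All.map blade a , u)))
  where
  G = adjoin H P Q dis
  side : ∀ {z} → adj G x z ≡ true → P ∋ z
  side {z} e with adjoin⁻ H {P} {Q} {dis} {x} {z} e
  ... | inj₁ h = ⊥-elim (true≢false (proj₁ (touched⁺ H h)) (untouched qx))
  ... | inj₂ (inj₁ (px , _)) = ⊥-elim (dis x px qx)
  ... | inj₂ (inj₂ (pz , _)) = pz
  blade : ∀ {p} → Blade (λ i j → adj G i j ≡ true) x p → Edge H p
  blade {v , w} (xv , xw , vw) with adjoin⁻ H {P} {Q} {dis} {v} {w} vw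
  ... | inj₁ h = h
  ... | inj₂ (inj₁ (_ , qw)) = ⊥-elim (dis w (side xw) qw)
  ... | inj₂ (inj₂ (_ , qv)) = ⊥-elim (dis v (side xv) qv)
... | inj₂ qx = let ys , lenys , uys , ays , _ = inner L a u in
    1+n≰n (≤-trans (≤-reflexive (sym (trans lenys len))) (≤-trans (length≤# uys ays) (Δ x)))
  where
  G = adjoin H P Q dis
  px = total x qx
  inner-edge : ∀ {z} → adj G x z ≡ true → Q ∌ z → adj H x z ≡ true
  inner-edge {z} e qz with adjoin⁻ H {P} {Q} {dis} {x} {z} e
  ... | inj₁ h = h
  ... | inj₂ (inj₁ (_ , q)) = ⊥-elim (true≢false q qz)
  ... | inj₂ (inj₂ (_ , q)) = ⊥-elim (true≢false q qx)
  pick : ∀ {v w} → Blade (λ i j → adj G i j ≡ true) x (v , w) → adj H x v ≡ true ⊎ adj H x w ≡ true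
  pick {v} {w} (xv , xw , vw) with bool (Q v) | bool (Q w)
  ... | inj₂ qv | _ = inj₁ (inner-edge xv qv)
  ... | inj₁ _ | inj₂ qw = inj₂ (inner-edge xw qw)
  ... | inj₁ qv | inj₁ qw with adjoin⁻ H {P} {Q} {dis} {v} {w} vw
  ... | inj₁ h = ⊥-elim (true≢false (proj₁ (touched⁺ H h)) (untouched qv))
  ... | inj₂ (inj₁ (pv , _)) = ⊥-elim (dis v pv qv)
  ... | inj₂ (inj₂ (pw , _)) = ⊥-elim (dis w pw qw)
  inner : ∀ L → All (Blade (λ i j → adj G i j ≡ true) x) L → Unique (flat L) →
    ∃ λ ys → length ys ≡ length L × Unique ys × All (adj H x ∋_) ys × (∀ {y} → y ∈ ys → y ∈ flat L)
  inner [] _ _ = [] , refl , [] , [] , id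
  inner ((v , w) ∷ L) (b ∷ a) uvw@(_ ∷ (_ ∷ u)) with inner L a u | pick b
  ... | ys , len , uys , ays , sub | inj₁ h =
    v ∷ ys , cong suc len , (λ q → Unique-head uvw (there (sub q))) ∷ᵘ uys , h ∷ ays ,
    λ { (here e) → here e ; (there q) → there (there (sub q)) }
  ... | ys , len , uys , ays , sub | inj₂ h =
    w ∷ ys , cong suc len , (λ q → Unique-head (Unique-tail uvw) (sub q)) ∷ᵘ uys , h ∷ ays ,
    λ { (here e) → there (here e) ; (there q) → there (there (sub q)) }

single : Fin n → Fin n → Bool
single s i = i == s

#-single : (s : Fin n) → # (single s) ≡ 1
#-single s = trans (∑-cong (λ i → sym (*-identityʳ ⟦ i == s ⟧))) (∑-δ s (λ _ → 1))

-- `adjoin` with a singleton `P` adds a star on isolated vertices. All new edges meet `s`, so the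
-- matching number grows by at most one; the leaves get degree 1, which is where `1 ≤ K` enters.
add-star-at : (H : SimpleGraph n) {y K : ℕ} → 1 ≤ K → ν≤ H y → (∀ i → deg H i ≤ K) →
  ∀ s leaves → length leaves ≡ K → Unique (s ∷ leaves) → All (λ i → touched H ∌ i) (s ∷ leaves) →
  ∃ λ (H′ : SimpleGraph n) → ν≤ H′ (suc y) × (∀ i → deg H′ i ≤ K) × edges₂ H + 2 * K ≤ edges₂ H′
add-star-at {n} H {y} {K} 1≤K ν Δ s leaves len u@(_ ∷ uℓ) (es ∷ eℓ) = H′ , ν′ , Δ′ , count
  where
  P = single s
  Q = mem leaves
  dis : ∀ i → P ∋ i → Q ∋ i → ⊥
  dis i p q = Unique-head u (subst (_∈ leaves) (==⁻ p) (does⁻ (i ∈? leaves) q))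
  H′ = adjoin H P Q dis
  untouched : ∀ {i} → Q ∋ i → touched H ∌ i
  untouched {i} q = All.lookup eℓ (does⁻ (i ∈? leaves) q)
  s-isolated : ∀ {j} → adj H s j ≡ true → ⊥
  s-isolated e = true≢false (proj₁ (touched⁺ H e)) es
  count : edges₂ H + 2 * K ≤ edges₂ H′
  count = ≤-trans (+-monoʳ-≤ (edges₂ H) (*-monoʳ-≤ 2 (≤-trans
    (≤-trans (≤-reflexive (sym len)) (length≤# {p = Q} uℓ (All.tabulate (λ {z} p → does⁺ (z ∈? leaves) p))))
    (≤-reflexive (trans (sym (*-identityˡ (# Q))) (cong (_* # Q) (sym (#-single s))))))))
    (edges₂-adjoin H P Q dis untouched)
  old : ∀ {i j} → i ≢ s → j ≢ s → adj H′ i j ≡ true → adj H i j ≡ true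
  old {i} {j} i≢ j≢ e with adjoin⁻ H {P} {Q} {dis} {i} {j} e
  ... | inj₁ h = h
  ... | inj₂ (inj₁ (p , _)) = ⊥-elim (i≢ (==⁻ p))
  ... | inj₂ (inj₂ (p , _)) = ⊥-elim (j≢ (==⁻ p))
  olds : ∀ L → s ∉ flat L → All (Edge H′) L → All (Edge H) L
  olds [] _ [] = []
  olds ((v , w) ∷ L) s∉ (e ∷ a) = old (λ { refl → s∉ (here refl) }) (λ { refl → s∉ (there (here refl)) }) e
    ∷ olds L (λ p → s∉ (there (there p))) a
  ν′ : ν≤ H′ (suc y)
  ν′ L (a , u) with s ∈? flat L
  ... | no s∉ = ≤-trans (ν L (olds L s∉ a , u)) (n≤1+n y)
  ... | yes s∈ with v , L₀ , _ , a₀ , lenL , per ← partner H′ L a s∈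
    with u₀ ← Unique-resp-↭ per u
    = ≤-trans (≤-reflexive lenL) (s≤s (ν L₀ (olds L₀ (λ p → Unique-head u₀ (there p)) a₀ , Unique-tail (Unique-tail u₀))))
  Δ′ : ∀ i → deg H′ i ≤ K
  Δ′ i = bound (i ≟ s) (i ∈? leaves)
    where
    star : ∀ j → adj H′ s j ≡ true → Q ∋ j
    star j e with adjoin⁻ H {P} {Q} {dis} {s} {j} e
    ... | inj₁ h = ⊥-elim (s-isolated h)
    ... | inj₂ (inj₁ (_ , q)) = q
    ... | inj₂ (inj₂ (_ , q)) = ⊥-elim (dis s (==⁺ {i = s} refl) q)
    leaf : i ≢ s → i ∈ leaves → ∀ j → adj H′ i j ≡ true → single s ∋ j
    leaf i≢ i∈ j e with adjoin⁻ H {P} {Q} {dis} {i} {j} e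
    ... | inj₁ h = ⊥-elim (true≢false (proj₁ (touched⁺ H h)) (untouched (does⁺ (i ∈? leaves) i∈)))
    ... | inj₂ (inj₁ (p , _)) = ⊥-elim (i≢ (==⁻ p))
    ... | inj₂ (inj₂ (p , _)) = p
    other : i ≢ s → i ∉ leaves → ∀ j → adj H′ i j ≡ true → adj H i j ≡ true
    other i≢ i∉ j e with adjoin⁻ H {P} {Q} {dis} {i} {j} e
    ... | inj₁ h = h
    ... | inj₂ (inj₁ (p , _)) = ⊥-elim (i≢ (==⁻ p))
    ... | inj₂ (inj₂ (_ , q)) = ⊥-elim (i∉ (does⁻ (i ∈? leaves) q))
    bound : Dec (i ≡ s) → Dec (i ∈ leaves) → deg H′ i ≤ K
    bound (yes refl) _ = ≤-trans (#-⊆ {q = Q} star) (≤-trans (#-mem leaves) (≤-reflexive len))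
    bound (no i≢) (yes i∈) = ≤-trans (#-⊆ {q = single s} (leaf i≢ i∈)) (≤-trans (≤-reflexive (#-single s)) 1≤K)
    bound (no i≢) (no i∉) = ≤-trans (#-⊆ {q = adj H i} (other i≢ i∉)) (Δ i)

add-star : (H : SimpleGraph n) {y K : ℕ} → 1 ≤ K → 2 * y * suc K + suc K ≤ n → ν≤ H y → (∀ i → deg H i ≤ K) →
  ∃ λ (H′ : SimpleGraph n) → ν≤ H′ (suc y) × (∀ i → deg H′ i ≤ K) × edges₂ H + 2 * K ≤ edges₂ H′
add-star {n} H {y} {K} 1≤K size ν Δ = from (choose (suc K) {not ∘ touched H} enough)
  where
  enough : suc K ≤ # (not ∘ touched H)
  enough = +-cancelˡ-≤ (2 * y * suc K) (suc K) _ (≤-trans size (≤-trans (≤-reflexive (sym #-all))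
    (≤-trans (≤-reflexive (sym (#-split (λ _ → true) (touched H)))) (+-monoˡ-≤ _ (touched-bound H ν Δ)))))
  from : (∃ λ xs → length xs ≡ suc K × Unique xs × All ((not ∘ touched H) ∋_) xs) → _
  from (s ∷ leaves , len , u , a) = add-star-at H 1≤K ν Δ s leaves (suc-injective len) u (All.map not⁻ a)

add-stars : ∀ j (H : SimpleGraph n) {y K : ℕ} → 1 ≤ K → 2 * K * suc K + suc K ≤ n → y + j ≡ K → ν≤ H y → (∀ i → deg H i ≤ K) →
  ∃ λ (H′ : SimpleGraph n) → ν≤ H′ K × (∀ i → deg H′ i ≤ K) × edges₂ H + 2 * (K * j) ≤ edges₂ H′
add-stars zero H {y} {K} 1≤K size eq ν Δ = H , subst (ν≤ H) (trans (sym (+-identityʳ y)) eq) ν , Δ ,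
  ≤-reflexive (trans (cong (λ z → edges₂ H + 2 * z) (*-zeroʳ K)) (+-identityʳ _))
add-stars (suc j) H {y} {K} 1≤K size eq ν Δ =
  let H₁ , ν₁ , Δ₁ , c₁ = add-star H {y} 1≤K (≤-trans (+-monoˡ-≤ (suc K) (*-monoˡ-≤ (suc K) (*-monoʳ-≤ 2 (m+n≤o⇒m≤o y (≤-reflexive eq))))) size) ν Δ
      H₂ , ν₂ , Δ₂ , c₂ = add-stars j H₁ 1≤K size (trans (sym (+-suc y j)) eq) ν₁ Δ₁
  in H₂ , ν₂ , Δ₂ , ≤-trans (≤-reflexive (ar (edges₂ H) K j)) (≤-trans (+-monoˡ-≤ (2 * (K * j)) c₁) c₂)
  where
  ar : ∀ e K j → e + 2 * (K * suc j) ≡ e + 2 * K + 2 * (K * j)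
  ar = solve-∀

touched≤half : (H : SimpleGraph n) {K : ℕ} → 4 * K * suc K + suc K ≤ n → ν≤ H K → (∀ i → deg H i ≤ K) → # (touched H) ≤ ⌊ n /2⌋
touched≤half H {K} size ν Δ = ≤-trans (touched-bound H ν Δ) (≤-trans (≤-reflexive (trans (n≡⌊n+n/2⌋ _) (cong ⌊_/2⌋ (ar K))))
    (⌊n/2⌋-mono (≤-trans (m≤m+n _ (suc K)) size)))
  where
  ar : ∀ K → 2 * K * suc K + 2 * K * suc K ≡ 4 * K * suc K
  ar = solve-∀

-- The competing graph is the balanced complete bipartite graph with `H` and `j` further stars
-- `K_{1,K}` in the part of `⌊ n /2⌋` vertices. Each star brings `K` edges and costs one unit of the
-- matching number, so `j` of them fill the gap between `y` and `K`.
ex-lower-bound : ∀ {n y j K e} (H : SimpleGraph n) → 1 ≤ K → 4 * K * suc K + suc K ≤ n → y + j ≡ K →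
  ν≤ H y → (∀ i → deg H i ≤ K) →
  (∀ (G : SimpleGraph n) → ¬ Contains G (FriendEdge (suc K)) → edgeCount G ≤ e) →
  edges₂ H + 2 * (K * j) + 2 * τ n ≤ 2 * e
ex-lower-bound {n} {y} {j} {K} {e} H 1≤K size eq ν Δ ub
  with H′ , ν′ , Δ′ , c ← add-stars j H 1≤K (≤-trans (+-monoˡ-≤ (suc K) (*-monoˡ-≤ (suc K) (*-monoˡ-≤ K (s≤s (s≤s (z≤n {2})))))) size) eq ν Δ
  -- All vertices touched by the sparse graph fit into one half, so the other part stays
  -- independent.
  with P , sub , #P ← superset ⌊ n /2⌋ (touched H′) (touched≤half H′ size ν′ Δ′) (⌊n/2⌋≤n n)
  = begin
    edges₂ H + 2 * (K * j) + 2 * τ n ≤⟨ +-monoˡ-≤ (2 * τ n) c ⟩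
    edges₂ H′ + 2 * τ n ≡⟨ cong (λ z → edges₂ H′ + 2 * z) (cong₂ _*_ (sym #P) (sym #Q)) ⟩
    edges₂ H′ + 2 * (# P * # (not ∘ P)) ≤⟨ edges₂-adjoin H′ P (not ∘ P) dis untouched ⟩
    edges₂ G ≡⟨ 2*edgeCount G ⟩
    2 * edgeCount G ≤⟨ *-monoʳ-≤ 2 (ub G (adjoin-free H′ {P} {not ∘ P} dis (λ i → total) untouched ν′ Δ′)) ⟩
    2 * e ∎
  where
  open ≤-Reasoning
  #Q : # (not ∘ P) ≡ ⌈ n /2⌉
  #Q = +-cancelˡ-≡ ⌊ n /2⌋ _ _ (trans (cong (_+ # (not ∘ P)) (sym #P))
    (trans (#-split (λ _ → true) P) (trans #-all (sym (⌊n/2⌋+⌈n/2⌉≡n n)))))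
  dis : ∀ i → P ∋ i → (not ∘ P) ∋ i → ⊥
  dis i p q = true≢false p (not⁻ q)
  total : ∀ {i} → (not ∘ P) ∌ i → P ∋ i
  total {i} q with P i
  ... | true = refl
  untouched : ∀ {i} → (not ∘ P) ∋ i → touched H′ ∌ i
  untouched {i} q = ¬true⇒false (λ t → true≢false (sub i t) (not⁻ q))
  G = adjoin H′ P (not ∘ P) dis

-- Deletion of vertices of low degree

Adj : SimpleGraph n → Fin n → Fin n → Set
Adj G i j = adj G i j ≡ true

without : (Fin n → Bool) → Fin n → Fin n → Bool
without U v i = U i ∧ not (i == v)

#-without : (U : Fin n → Bool) {v : Fin n} → U ∋ v → # U ≡ suc (# (without U v))
#-without U {v} e = begin
  # U ≡⟨ sym (#-split U (single v)) ⟩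
  # (λ i → U i ∧ (i == v)) + # (without U v) ≡⟨ cong (_+ # (without U v)) (trans (∑-cong pt) (#-single v)) ⟩
  suc (# (without U v)) ∎
  where
  open ≡-Reasoning
  pt : ∀ i → ⟦ U i ∧ (i == v) ⟧ ≡ ⟦ i == v ⟧
  pt i with i ≟ v
  ... | yes refl rewrite e = refl
  ... | no _ with U i
  ... | true = refl
  ... | false = refl

edges₂-without : (G : SimpleGraph n) (U : Fin n → Bool) (v : Fin n) →
  edges₂ (restrict G U) ≤ edges₂ (restrict G (without U v)) + 2 * deg (restrict G U) v
edges₂-without G U v = begin
  ∑ (λ i → ∑ (λ j → ⟦ a i j ⟧))
    ≤⟨ ∑-mono (λ i → ∑-mono (λ j → pt i j)) ⟩
  ∑ (λ i → ∑ (λ j → ⟦ a′ i j ⟧ + (⟦ i == v ⟧ * ⟦ a i j ⟧ + ⟦ j == v ⟧ * ⟦ a i j ⟧)))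
    ≡⟨ trans (∑-cong (λ i → trans (∑-+ _ _) (cong (∑ (λ j → ⟦ a′ i j ⟧) +_) (∑-+ _ _)))) (trans (∑-+ _ _) (cong (edges₂ (restrict G (without U v)) +_) (∑-+ _ _))) ⟩
  edges₂ (restrict G (without U v)) + (∑ (λ i → ∑ (λ j → ⟦ i == v ⟧ * ⟦ a i j ⟧)) + ∑ (λ i → ∑ (λ j → ⟦ j == v ⟧ * ⟦ a i j ⟧)))
    ≡⟨ cong (edges₂ (restrict G (without U v)) +_) (cong₂ _+_
        (trans (∑-cong (λ i → ∑-* ⟦ i == v ⟧ _)) (∑-δ v _))
        (trans (∑-cong (λ i → ∑-δ v _)) (trans (∑-cong (λ i → cong ⟦_⟧ (adj-sym (restrict G U) i v))) (sym (+-identityʳ d))))) ⟩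
  edges₂ (restrict G (without U v)) + 2 * d ∎
  where
  open ≤-Reasoning
  a = adj (restrict G U)
  a′ = adj (restrict G (without U v))
  d = deg (restrict G U) v
  pt : ∀ i j → ⟦ a i j ⟧ ≤ ⟦ a′ i j ⟧ + (⟦ i == v ⟧ * ⟦ a i j ⟧ + ⟦ j == v ⟧ * ⟦ a i j ⟧)
  pt i j with adj G i j | U i | U j
  ... | false | _ | _ = z≤n
  ... | true | false | _ = z≤n
  ... | true | true | false = z≤n
  ... | true | true | true with i == v | j == v
  ... | true | _ = m≤m+n 1 _
  ... | false | true = ≤-refl
  ... | false | false = ≤-refl

-- The deleted vertex has at most `⌊ # U /2⌋ - 1` edges, one less than the drop of `τ`, so each
-- deletion raises the excess by at least one edge. In doubled counts the term `2 * # U` records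
-- this; `Y` and `Z` carry the initial excess without subtraction, and `m` bounds the recursion.
delete-low : (G : SimpleGraph n) (Y Z : ℕ) → ∀ m (U : Fin n → Bool) → # U ≤ m →
  2 * τ (# U) + Y ≤ edges₂ (restrict G U) + 2 * # U + Z →
  ∃ λ U′ → 2 * τ (# U′) + Y ≤ edges₂ (restrict G U′) + 2 * # U′ + Z ×
           (∀ v → U′ ∋ v → ⌊ # U′ /2⌋ ≤ deg (restrict G U′) v)
delete-low {n} G Y Z m U #U≤m inv = step (1 ≤? # low)
  where
  low : Fin n → Bool
  low v = U v ∧ does (deg (restrict G U) v <? ⌊ # U /2⌋)
  ar : ∀ t′ Y e N′ Z e′ d f → 2 * t′ + Y + ((e + 2 * suc N′ + Z) + ((e′ + 2 * d) + 2 * f)) + 0 ≡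
                              e′ + 2 * N′ + Z + ((2 * (f + t′) + Y) + (e + 2 * suc d))
  ar = solve-∀
  step : Dec (1 ≤ # low) → _
  step (no none) = U , inv , λ v e → ≮⇒≥ (λ lt → none (length≤# {p = low} {xs = v ∷ []} ([] ∷ []) (∧⁺ e (does⁺ (deg (restrict G U) v <? ⌊ # U /2⌋) lt) ∷ [])))
  step (yes some) with v , e ← inhabited some with e₁ , e₂ ← ∧⁻ {U v} e = again m #U≤m
    where
    N′ = # (without U v)
    N≡ : # U ≡ suc N′
    N≡ = #-without U e₁
    d = deg (restrict G U) v
    d< : suc d ≤ ⌊ suc N′ /2⌋
    d< = subst (λ N → suc d ≤ ⌊ N /2⌋) N≡ (does⁻ (deg (restrict G U) v <? ⌊ # U /2⌋) e₂)
    inv₁ : 2 * (⌊ suc N′ /2⌋ + τ N′) + Y ≤ edges₂ (restrict G U) + 2 * suc N′ + Z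
    inv₁ = ≤-trans (≤-reflexive (cong (λ t → 2 * t + Y) (sym (trans (cong τ N≡) (τ-suc N′)))))
      (≤-trans inv (≤-reflexive (cong (λ N → edges₂ (restrict G U) + 2 * N + Z) N≡)))
    inv′ : 2 * τ N′ + Y ≤ edges₂ (restrict G (without U v)) + 2 * N′ + Z
    inv′ = lin 0 (inv₁ ⊕ (edges₂-without G U v ⊕ *-monoʳ-≤ 2 d<))
      (ar (τ N′) Y (edges₂ (restrict G U)) N′ Z (edges₂ (restrict G (without U v))) d ⌊ suc N′ /2⌋)
    again : ∀ m → # U ≤ m → _
    again zero le = ⊥-elim (1+n≰n (≤-trans (≤-reflexive (sym N≡)) (≤-trans le z≤n)))
    again (suc m) le = delete-low G Y Z m (without U v) (≤-pred (≤-trans (≤-reflexive (sym N≡)) le)) inv′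

no-edges : {H : SimpleGraph n} {i : Fin n} → (∀ j → ¬ adj H i j ≡ true) → ∀ {m} → deg H i ≤ m
no-edges {H = H} {i} h = ≤-trans (#-⊆ {q = λ _ → false} (λ j e → ⊥-elim (h j e))) (≤-trans (≤-reflexive ∑-0) z≤n)

-- Partitions, inner edges and missing edges

deg-split : (G : SimpleGraph n) (U A B : Fin n → Bool) → (∀ i → U ∋ i → A ∋ i ⊎ B ∋ i) → ∀ {v} → A ∋ v →
  deg (restrict G U) v ≤ deg (restrict G A) v + # (λ w → B w ∧ adj G v w)
deg-split G U A B cov {v} av = #-cover sp
  where
  sp : ∀ w → adj (restrict G U) v w ≡ true → adj (restrict G A) v w ≡ true ⊎ B w ∧ adj G v w ≡ true
  sp w e with e₁ , _ , uw ← restrict⁻ G U {v} {w} e with cov w uw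
  ... | inj₁ aw = inj₁ (∧⁺ e₁ (∧⁺ av aw))
  ... | inj₂ bw = inj₂ (∧⁺ bw e₁)

misses : SimpleGraph n → (Fin n → Bool) → Fin n → ℕ
misses G B v = # (λ w → B w ∧ not (adj G v w))

common : SimpleGraph n → (Fin n → Bool) → Fin n → Fin n → Fin n → Bool
common G B x u w = B w ∧ (adj G x w ∧ adj G u w)

common-bound : (G : SimpleGraph n) (B : Fin n → Bool) (x u : Fin n) → # B ≤ # (common G B x u) + (misses G B x + misses G B u)
common-bound G B x u = ≤-trans (#-cover {q = common G B x u} {r = λ w → (B w ∧ not (adj G x w)) ∨ (B w ∧ not (adj G u w))} sp) (+-monoʳ-≤ (# (common G B x u)) (#-cover (λ w → ∨⁻)))
  where
  sp : ∀ w → B ∋ w → common G B x u w ≡ true ⊎ (B w ∧ not (adj G x w)) ∨ (B w ∧ not (adj G u w)) ≡ true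
  sp w bw with B w | adj G x w | adj G u w
  ... | true | true | true = inj₁ refl
  ... | true | true | false = inj₂ refl
  ... | true | false | _ = inj₂ refl

record Partition (U A B : Fin n → Bool) : Set where
  field
    A⊆ : ∀ i → A ∋ i → U ∋ i
    B⊆ : ∀ i → B ∋ i → U ∋ i
    dis : ∀ i → A ∋ i → B ∋ i → ⊥
    cov : ∀ i → U ∋ i → A ∋ i ⊎ B ∋ i

flip-partition : {U A B : Fin n → Bool} → Partition U A B → Partition U B A
flip-partition P = record { A⊆ = B⊆ ; B⊆ = A⊆ ; dis = λ i b a → dis i a b ; cov = λ i u → Sum.swap (cov i u) }
  where open Partition P

#-partition : {U A B : Fin n → Bool} → Partition U A B → # A + # B ≡ # U
#-partition P = ≤-antisym (#-disjoint A⊆ B⊆ dis) (#-cover cov)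
  where open Partition P

cross : SimpleGraph n → (A B : Fin n → Bool) → ℕ
cross G A B = ∑ (λ i → ∑ (λ j → ⟦ adj G i j ∧ (A i ∧ B j) ⟧))

cross≤ : (G : SimpleGraph n) (A B : Fin n → Bool) → cross G A B ≤ # A * # B
cross≤ G A B = ≤-trans (∑-mono (λ i → ∑-mono (λ j → ⟦⟧-⊆ {adj G i j ∧ (A i ∧ B j)} (λ e → proj₂ (∧⁻ {adj G i j} e))))) (≤-reflexive (∑∑-product A B))

edges₂-partition : (G : SimpleGraph n) {U A B : Fin n → Bool} → Partition U A B →
  edges₂ (restrict G U) ≤ edges₂ (restrict G A) + edges₂ (restrict G B) + 2 * cross G A B
edges₂-partition G {U} {A} {B} P = begin
  ∑ (λ i → ∑ (λ j → ⟦ adj (restrict G U) i j ⟧))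
    ≤⟨ ∑-mono (λ i → ∑-mono (λ j → pt i j)) ⟩
  ∑ (λ i → ∑ (λ j → (⟦ adj (restrict G A) i j ⟧ + ⟦ adj (restrict G B) i j ⟧) + (⟦ adj G i j ∧ (A i ∧ B j) ⟧ + ⟦ adj G j i ∧ (A j ∧ B i) ⟧)))
    ≡⟨ trans (∑-cong (λ i → trans (∑-+ _ _) (cong₂ _+_ (∑-+ _ _) (∑-+ _ _)))) (trans (∑-+ _ _) (cong₂ _+_ (∑-+ _ _) (∑-+ _ _))) ⟩
  edges₂ (restrict G A) + edges₂ (restrict G B) + (cross G A B + ∑ (λ i → ∑ (λ j → ⟦ adj G j i ∧ (A j ∧ B i) ⟧)))
    ≡⟨ cong (edges₂ (restrict G A) + edges₂ (restrict G B) +_) (cong (cross G A B +_) (trans (∑-swap _) (sym (+-identityʳ _)))) ⟩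
  edges₂ (restrict G A) + edges₂ (restrict G B) + 2 * cross G A B ∎
  where
  open ≤-Reasoning
  open Partition P
  pt : ∀ i j → ⟦ adj (restrict G U) i j ⟧ ≤
    (⟦ adj (restrict G A) i j ⟧ + ⟦ adj (restrict G B) i j ⟧) + (⟦ adj G i j ∧ (A i ∧ B j) ⟧ + ⟦ adj G j i ∧ (A j ∧ B i) ⟧)
  pt i j with adj (restrict G U) i j in e
  ... | false = z≤n
  ... | true with g , ui , uj ← restrict⁻ G U {i} {j} e with cov i ui | cov j uj
  ... | inj₁ ai | inj₁ aj rewrite g | ai | aj = m≤m+n 1 _
  ... | inj₂ bi | inj₂ bj rewrite g | bi | bj = ≤-trans (m≤n+m 1 ⟦ A i ∧ A j ⟧) (m≤m+n _ _)
  ... | inj₁ ai | inj₂ bj rewrite g | ai | bj = ≤-trans (m≤m+n 1 _) (m≤n+m _ (⟦ A j ⟧ + ⟦ B i ∧ true ⟧))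
  ... | inj₂ bi | inj₁ aj rewrite adj-flip G g | aj | bi = ≤-trans (m≤n+m 1 ⟦ adj G i j ∧ (A i ∧ B j) ⟧) (m≤n+m _ (⟦ adj G i j ∧ (A i ∧ true) ⟧ + ⟦ adj G i j ∧ B j ⟧))

-- Stability: large minimum degree without a large flower

module Dense {n : ℕ} (G : SimpleGraph n) (p : ℕ)
  (no-flower : ∀ x L → Flower (Adj G) x L → suc p ≤ length L → ⊥) where

  -- Each of `suc p` inner neighbours of `v` would form a triangle with `v` and a common neighbour
  -- in `B`. Two vertices of `A` share all but at most `2 * D` of `B`; the rest of the bound exceeds
  -- the `1 + 2 * suc p` vertices of the flower by one.
  inner-degree : (A B : Fin n → Bool) → ∀ D → (∀ v → A ∋ v → misses G B v ≤ D) →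
    2 * D + 2 * suc p + 2 ≤ # B → ∀ v → deg (restrict G A) v ≤ p
  inner-degree A B D miss size v with deg (restrict G A) v ≤? p
  ... | yes le = le
  ... | no ¬le with us , len , u , a ← choose (suc p) (≰⇒> ¬le)
    = ⊥-elim (no-flower v _ (proj₁ (proj₂ F)) (≤-reflexive (trans (sym len) (trans (sym (+-identityʳ _)) (sym (proj₂ (proj₂ F)))))))
    where
    nbr : ∀ {w} → w ∈ us → adj G v w ≡ true × A ∋ v × A ∋ w
    nbr {w} w∈ = restrict⁻ G A {v} {w} (All.lookup a w∈)
    v∉ : v ∉ us ++ []
    v∉ v∈ with ∈-++⁻ us v∈
    ... | inj₁ q = adj⇒≢ G (proj₁ (nbr q)) refl
    ext : ∀ {w} → w ∈ us → ∀ zs → length zs ≤ 1 + 2 * suc p → ∃ λ z → z ∉ zs × Adj G v z × Adj G w z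
    ext {w} w∈ zs lz =
      let _ , av , aw = nbr w∈
          z , e , z∉ = fresh {p = common G B v w} zs (lin 0 (size ⊕ common-bound G B v w ⊕ miss v av ⊕ miss w aw ⊕ lz)
            (ar (length zs) (# (common G B v w)) D (suc p) (# B) (misses G B v) (misses G B w)))
          e₁ , e₂ = ∧⁻ {adj G v z} (proj₂ (∧⁻ {B z} e))
      in z , z∉ , e₁ , e₂
      where
      ar : ∀ l k D q b mv mw → suc l + (b + ((k + (mv + mw)) + (D + (D + (1 + 2 * q))))) + 0 ≡ k + ((2 * D + 2 * q + 2) + (b + (mv + (mw + l))))
      ar = solve-∀
    F = greedy {R = Adj G} {v} (1 + 2 * suc p) us [] [] (v∉ ∷ᵘ subst Unique (sym (++-identityʳ us)) u)
      (All.tabulate (λ w∈ → proj₁ (nbr w∈) , ext w∈)) (≤-reflexive (cong (λ l → 1 + 2 * l) (trans (+-identityʳ _) len)))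

  module _ (U : Fin n → Bool) (h : ℕ) (mindeg : ∀ v → U ∋ v → h ≤ deg (restrict G U) v) (≤h : # U ≤ 1 + 2 * h) where

    GU = restrict G U

    -- A matching among the neighbours of `x` is the rim of a flower at `x`, hence has at most `p`
    -- edges. Removing the endpoints of a maximum one, at most `2 * p` vertices, leaves an
    -- independent set.
    independent-neighbourhood : ∀ x → U ∋ x → ¬ ¬ (∃ λ S → (∀ i → S ∋ i → U ∋ i × adj G x i ≡ true) ×
      (∀ i j → S ∋ i → S ∋ j → ¬ adj G i j ≡ true) × h ≤ # S + 2 * p)
    independent-neighbourhood x ux k = max-matching H ν λ (L , M , mx) → k (S L , sub L , indep L M mx , size L M)
      where
      H = restrict G (adj GU x)
      S : List (Fin n × Fin n) → Fin n → Bool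
      S L i = adj GU x i ∧ not (mem (flat L) i)
      x∉ : ∀ L → All (Edge H) L → x ∉ flat L
      x∉ ((v , w) ∷ L) (e ∷ a) (here refl) = adj⇒≢ GU (proj₁ (proj₂ (restrict⁻ G (adj GU x) {v} {w} e))) refl
      x∉ ((v , w) ∷ L) (e ∷ a) (there (here refl)) = adj⇒≢ GU (proj₂ (proj₂ (restrict⁻ G (adj GU x) {v} {w} e))) refl
      x∉ (_ ∷ L) (_ ∷ a) (there (there q)) = x∉ L a q
      ν : ν≤ H p
      ν L (a , u) = ≮⇒≥ (no-flower x L (All.map (λ {vw} e → let r , xv , xw = restrict⁻ G (adj GU x) {proj₁ vw} {proj₂ vw} e in
        proj₁ (restrict⁻ G U {x} xv) , proj₁ (restrict⁻ G U {x} xw) , r) a , x∉ L a ∷ᵘ u))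
      sub : ∀ L i → S L ∋ i → U ∋ i × adj G x i ≡ true
      sub L i e = let r , _ , ui = restrict⁻ G U {x} {i} (proj₁ (∧⁻ {adj GU x i} e)) in ui , r
      out : ∀ L i → S L ∋ i → i ∉ flat L
      out L i e i∈ = true≢false (does⁺ (i ∈? flat L) i∈) (not⁻ (proj₂ (∧⁻ {adj GU x i} e)))
      indep : ∀ L → IsMatching H L → ν≤ H (length L) → ∀ i j → S L ∋ i → S L ∋ j → ¬ adj G i j ≡ true
      indep L M mx i j si sj e = [ out L i si , out L j sj ]′
        (matching-covers H M mx {i} {j} (∧⁺ e (∧⁺ (proj₁ (∧⁻ {adj GU x i} si)) (proj₁ (∧⁻ {adj GU x j} sj)))))
      size : ∀ L → IsMatching H L → h ≤ # (S L) + 2 * p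
      size L M = begin
        h ≤⟨ mindeg x ux ⟩
        # (adj GU x) ≡⟨ sym (#-split (adj GU x) (mem (flat L))) ⟩
        # (λ i → adj GU x i ∧ mem (flat L) i) + # (S L) ≡⟨ +-comm _ (# (S L)) ⟩
        # (S L) + # (λ i → adj GU x i ∧ mem (flat L) i) ≤⟨ +-monoʳ-≤ (# (S L)) (#-⊆ {q = mem (flat L)} (λ i e → proj₂ (∧⁻ {adj GU x i} e))) ⟩
        # (S L) + # (mem (flat L)) ≤⟨ +-monoʳ-≤ (# (S L)) (≤-trans (#-mem (flat L)) (≤-trans (≤-reflexive (length-flat L)) (*-monoʳ-≤ 2 (ν L M)))) ⟩
        # (S L) + 2 * p ∎
        where open ≤-Reasoning

    -- A first partition, read off two independent sets S and S′ which together miss at most 4p + 1 vertices.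
    module Rough (S S′ : Fin n → Bool) (S⊆ : ∀ i → S ∋ i → U ∋ i) (S′⊆ : ∀ i → S′ ∋ i → U ∋ i)
      (S-indep : ∀ i j → S ∋ i → S ∋ j → ¬ adj G i j ≡ true) (S′-indep : ∀ i j → S′ ∋ i → S′ ∋ j → ¬ adj G i j ≡ true)
      (disjoint : ∀ i → S ∋ i → S′ ∋ i → ⊥) (S-size : h ≤ # S + 2 * p) (S′-size : h ≤ # S′ + 2 * p) where

      R : Fin n → Bool
      R i = U i ∧ (not (S i) ∧ not (S′ i))

      N_S N_S′ : Fin n → Fin n → Bool
      N_S v w = S w ∧ adj G v w
      N_S′ v w = S′ w ∧ adj G v w

      #R : # R ≤ 1 + 4 * p
      #R = lin 0 (three ⊕ ≤h ⊕ S-size ⊕ S′-size) (ar (# R) (# S) (# S′) (# U) h p)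
        where
        ar : ∀ r s s′ u h p → r + (u + ((1 + 2 * h) + ((s + 2 * p) + (s′ + 2 * p)))) + 0 ≡ 1 + 4 * p + ((r + (s + s′)) + (u + (h + h)))
        ar = solve-∀
        SS : Fin n → Bool
        SS i = S i ∨ S′ i
        three : # R + (# S + # S′) ≤ # U
        three = ≤-trans (+-monoʳ-≤ (# R) (#-disjoint {r = SS} (λ i → ∨⁺ˡ) (λ i → ∨⁺ʳ {S i}) disjoint))
          (#-disjoint {p = R} {q = SS} (λ i e → proj₁ (∧⁻ {U i} e)) (λ i e → [ S⊆ i , S′⊆ i ]′ (∨⁻ {S i} e))
            (λ i e e′ → let n₁ , n₂ = ∧⁻ {not (S i)} (proj₂ (∧⁻ {U i} e)) in [ (λ s → true≢false s (not⁻ n₁)) , (λ s → true≢false s (not⁻ n₂)) ]′ (∨⁻ {S i} e′)))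

      -- All neighbours of `v` avoid the independent set `S`, and `U` without `S` has at most
      -- `1 + h + 2 * p` vertices, at least `h` of which are adjacent to `v`.
      S-misses : ∀ v → S ∋ v → misses G S′ v ≤ 1 + 2 * p
      S-misses v sv = lin 0 (three ⊕ ≤h ⊕ S-size ⊕ mindeg v (S⊆ v sv)) (ar (misses G S′ v) (deg GU v) (# S) (# U) h p)
        where
        ar : ∀ m d s u h p → m + (u + ((1 + 2 * h) + ((s + 2 * p) + d))) + 0 ≡ 1 + 2 * p + ((m + (d + s)) + (u + (h + h)))
        ar = solve-∀
        Q : Fin n → Bool
        Q i = adj GU v i ∨ S i
        three : misses G S′ v + (deg GU v + # S) ≤ # U
        three = ≤-trans (+-monoʳ-≤ (misses G S′ v) (#-disjoint {p = adj GU v} {q = S} {r = Q} (λ i → ∨⁺ˡ) (λ i → ∨⁺ʳ {adj GU v i})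
            (λ i e s → S-indep v i sv s (proj₁ (restrict⁻ G U {v} e)))))
          (#-disjoint {q = Q} (λ i e → S′⊆ i (proj₁ (∧⁻ {S′ i} e))) (λ i e → [ (λ e′ → proj₂ (proj₂ (restrict⁻ G U {v} e′))) , S⊆ i ]′ (∨⁻ {adj GU v i} e))
            (λ i e e′ → let s′ , na = ∧⁻ {S′ i} e in [ (λ e″ → true≢false (proj₁ (restrict⁻ G U {v} e″)) (not⁻ na)) , (λ s → disjoint i s s′) ]′ (∨⁻ {adj GU v i} e′)))

      -- Otherwise `suc p` neighbours in `S` extend to triangles by neighbours in `S′`: a vertex of
      -- `S` misses at most `1 + 2 * p` of these and the flower occupies at most `1 + 2 * suc p`,
      -- together exactly `4 * suc p`.
      not-both : ∀ v → suc p ≤ # (N_S v) → # (N_S′ v) ≤ 4 * suc p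
      not-both v big with # (N_S′ v) ≤? 4 * suc p
      ... | yes le = le
      ... | no ¬le with us , len , u , a ← choose (suc p) big
        = ⊥-elim (no-flower v _ (proj₁ (proj₂ F)) (≤-reflexive (trans (sym len) (trans (sym (+-identityʳ _)) (sym (proj₂ (proj₂ F)))))))
        where
        nbr : ∀ {w} → w ∈ us → S ∋ w × adj G v w ≡ true
        nbr {w} w∈ = ∧⁻ {S w} (All.lookup a w∈)
        v∉ : v ∉ us ++ []
        v∉ v∈ with ∈-++⁻ us v∈
        ... | inj₁ q = adj⇒≢ G (proj₂ (nbr q)) refl
        ext : ∀ {w} → w ∈ us → ∀ zs → length zs ≤ 1 + 2 * suc p → ∃ λ z → z ∉ zs × Adj G v z × Adj G w z
        ext {w} w∈ zs lz =
          let z , e , z∉ = fresh {p = C} zs (lin 0 (≰⇒> ¬le ⊕ split ⊕ S-misses w (proj₁ (nbr w∈)) ⊕ lz) (ar (length zs) (# C) (# (N_S′ v)) (misses G S′ w) p))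
              e₁ , e₂ = ∧⁻ {N_S′ v z} e
          in z , z∉ , proj₂ (∧⁻ {S′ z} e₁) , e₂
          where
          C : Fin n → Bool
          C z = N_S′ v z ∧ adj G w z
          ar : ∀ l k b m p → suc l + (b + ((k + m) + ((1 + 2 * p) + (1 + 2 * suc p)))) + 0 ≡ k + (suc (4 * suc p) + (b + (m + l)))
          ar = solve-∀
          split : # (N_S′ v) ≤ # C + misses G S′ w
          split = ≤-trans (≤-reflexive (sym (#-split (N_S′ v) (adj G w)))) (+-monoʳ-≤ (# C)
            (#-⊆ {q = λ z → S′ z ∧ not (adj G w z)} (λ z e → let e₁ , e₂ = ∧⁻ {N_S′ v z} e in ∧⁺ (proj₁ (∧⁻ {S′ z} e₁)) e₂)))
        F = greedy {R = Adj G} {v} (1 + 2 * suc p) us [] [] (v∉ ∷ᵘ subst Unique (sym (++-identityʳ us)) u)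
          (All.tabulate (λ w∈ → proj₂ (nbr w∈) , ext w∈)) (≤-reflexive (cong (λ l → 1 + 2 * l) (trans (+-identityʳ _) len)))

      -- A vertex outside `S` and `S′` joins the side of `S` if it has few neighbours there.
      -- Otherwise it goes to `B`, and by `not-both` it has few neighbours in `S′`.
      A B : Fin n → Bool
      A v = U v ∧ (not (S′ v) ∧ does (# (N_S v) ≤? p))
      B v = U v ∧ not (A v)

      parts : Partition U A B
      parts = record
        { A⊆ = λ i e → proj₁ (∧⁻ {U i} e)
        ; B⊆ = λ i e → proj₁ (∧⁻ {U i} e)
        ; dis = λ i a b → true≢false a (not⁻ (proj₂ (∧⁻ {U i} b)))
        ; cov = λ i u → [ inj₁ , (λ e → inj₂ (∧⁺ u (not⁺ e))) ]′ (bool (A i)) }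

      S⊆A : ∀ i → S ∋ i → A ∋ i
      S⊆A i s = ∧⁺ (S⊆ i s) (∧⁺ (not⁺ (¬true⇒false (disjoint i s))) (does⁺ (# (N_S i) ≤? p)
        (≤-trans (#-⊆ {q = λ _ → false} (λ j e → let sj , e′ = ∧⁻ {S j} e in ⊥-elim (S-indep i j s sj e′))) (≤-trans (≤-reflexive ∑-0) z≤n))))

      S′⊆B : ∀ i → S′ ∋ i → B ∋ i
      S′⊆B i s = ∧⁺ (S′⊆ i s) (not⁺ (¬true⇒false (λ a → true≢false s (not⁻ (proj₁ (∧⁻ {not (S′ i)} (proj₂ (∧⁻ {U i} a))))))))

      A-or-R : ∀ i → A ∋ i → S ∋ i ⊎ R ∋ i
      A-or-R i a with bool (S i)
      ... | inj₁ s = inj₁ s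
      ... | inj₂ s = let u , r = ∧⁻ {U i} a in inj₂ (∧⁺ u (∧⁺ (not⁺ s) (proj₁ (∧⁻ {not (S′ i)} r))))

      B-or-R : ∀ i → B ∋ i → S′ ∋ i ⊎ R ∋ i
      B-or-R i b with bool (S′ i)
      ... | inj₁ s = inj₁ s
      ... | inj₂ s = let u , r = ∧⁻ {U i} b in
        inj₂ (∧⁺ u (∧⁺ (not⁺ (¬true⇒false (λ s″ → true≢false (S⊆A i s″) (not⁻ r)))) (not⁺ s)))

      degA : ∀ v → deg (restrict G A) v ≤ 8 * suc p
      degA v with bool (A v)
      ... | inj₂ ¬a = no-edges {H = restrict G A} (λ j e → true≢false (proj₁ (proj₂ (restrict⁻ G A {v} {j} e))) ¬a)
      ... | inj₁ a = ≤-trans (#-cover {q = N_S v} {r = R} sp) (lin (3 * p + 7)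
          (does⁻ (# (N_S v) ≤? p) (proj₂ (∧⁻ {not (S′ v)} (proj₂ (∧⁻ {U v} a)))) ⊕ #R) (ar (# (N_S v)) (# R) p))
        where
        ar : ∀ a r p → a + r + (p + (1 + 4 * p)) + (3 * p + 7) ≡ 8 * suc p + (a + r)
        ar = solve-∀
        sp : ∀ j → adj (restrict G A) v j ≡ true → N_S v ∋ j ⊎ R ∋ j
        sp j e with g , _ , aj ← restrict⁻ G A {v} {j} e = Sum.map₁ (λ s → ∧⁺ s g) (A-or-R j aj)

      degB : ∀ v → deg (restrict G B) v ≤ 8 * suc p
      degB v with bool (B v)
      ... | inj₂ ¬b = no-edges {H = restrict G B} (λ j e → true≢false (proj₁ (proj₂ (restrict⁻ G B {v} {j} e))) ¬b)
      ... | inj₁ b = ≤-trans (#-cover {q = N_S′ v} {r = R} sp) (lin 3 (few ⊕ #R) (ar (# (N_S′ v)) (# R) p))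
        where
        ar : ∀ a r p → a + r + (4 * suc p + (1 + 4 * p)) + 3 ≡ 8 * suc p + (a + r)
        ar = solve-∀
        sp : ∀ j → adj (restrict G B) v j ≡ true → N_S′ v ∋ j ⊎ R ∋ j
        sp j e with g , _ , bj ← restrict⁻ G B {v} {j} e = Sum.map₁ (λ s → ∧⁺ s g) (B-or-R j bj)
        few : # (N_S′ v) ≤ 4 * suc p
        few with bool (S′ v)
        ... | inj₁ s = ≤-trans (#-⊆ {q = λ _ → false} (λ j e → let sj , e′ = ∧⁻ {S′ j} e in ⊥-elim (S′-indep v j s sj e′))) (≤-trans (≤-reflexive ∑-0) z≤n)
        ... | inj₂ ¬s with # (N_S v) ≤? p
        ... | no big = not-both v (≰⇒> big)
        ... | yes small = ⊥-elim (true≢false (∧⁺ (proj₁ (∧⁻ {U v} b)) (∧⁺ (not⁺ ¬s) (does⁺ (# (N_S v) ≤? p) small))) (not⁻ (proj₂ (∧⁻ {U v} b))))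

      -- As `S` and `S′` are independent, every inner edge meets `R`, which has at most `1 + 4 * p`
      -- vertices, each of inner degree at most `8 * suc p`.
      inner-edges : edges₂ (restrict G A) + edges₂ (restrict G B) ≤ 64 * (suc p * suc p)
      inner-edges = lin (48 * suc p) ((bound A degA A-cov ⊕ bound B degB B-cov) ⊕ *-monoʳ-≤ (16 * suc p) halves)
          (ar (edges₂ (restrict G A)) (edges₂ (restrict G B)) (# RA) (# RB) p)
        where
        RA RB : Fin n → Bool
        RA i = R i ∧ A i
        RB i = R i ∧ B i
        ar : ∀ a b x y p → a + b + (2 * (8 * suc p * x) + 2 * (8 * suc p * y) + 16 * suc p * (1 + 4 * p)) + 48 * suc p
           ≡ 64 * (suc p * suc p) + (a + b + 16 * suc p * (x + y))
        ar = solve-∀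
        halves : # RA + # RB ≤ 1 + 4 * p
        halves = ≤-trans (#-disjoint {p = RA} {q = RB} {r = R} (λ i e → proj₁ (∧⁻ {R i} e)) (λ i e → proj₁ (∧⁻ {R i} e))
          (λ i a b → Partition.dis parts i (proj₂ (∧⁻ {R i} a)) (proj₂ (∧⁻ {R i} b)))) #R
        bound : (X : Fin n → Bool) → (∀ v → deg (restrict G X) v ≤ 8 * suc p) →
          (∀ {i j} → adj (restrict G X) i j ≡ true → R i ∧ X i ≡ true ⊎ R j ∧ X j ≡ true) →
          edges₂ (restrict G X) ≤ 2 * (8 * suc p * # (λ i → R i ∧ X i))
        bound X dX covX = ≤-trans (edges₂-cover (restrict G X) (λ i → R i ∧ X i) (λ {i} {j} → covX {i} {j})) (*-monoʳ-≤ 2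
          (≤-trans (∑-mono (λ i → ≤-trans (*-monoʳ-≤ ⟦ R i ∧ X i ⟧ (dX i)) (≤-reflexive (*-comm ⟦ R i ∧ X i ⟧ _)))) (≤-reflexive (∑-* (8 * suc p) _))))
        A-cov : ∀ {i j} → adj (restrict G A) i j ≡ true → R i ∧ A i ≡ true ⊎ R j ∧ A j ≡ true
        A-cov {i} {j} e with g , ai , aj ← restrict⁻ G A {i} {j} e with A-or-R i ai | A-or-R j aj
        ... | inj₂ r | _ = inj₁ (∧⁺ r ai)
        ... | inj₁ _ | inj₂ r = inj₂ (∧⁺ r aj)
        ... | inj₁ s | inj₁ s′ = ⊥-elim (S-indep i j s s′ g)
        B-cov : ∀ {i j} → adj (restrict G B) i j ≡ true → R i ∧ B i ≡ true ⊎ R j ∧ B j ≡ true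
        B-cov {i} {j} e with g , ai , aj ← restrict⁻ G B {i} {j} e with B-or-R i ai | B-or-R j aj
        ... | inj₂ r | _ = inj₁ (∧⁺ r ai)
        ... | inj₁ _ | inj₂ r = inj₂ (∧⁺ r aj)
        ... | inj₁ s | inj₁ s′ = ⊥-elim (S′-indep i j s s′ g)

-- The constants ensure that the `2 * suc p` ends of `suc p` disjoint inner edges have a common
-- neighbour in the other part: `2 * suc p * (1 + 2 * p)` is less than `8 * (suc p * suc p)`.
record Structure {n : ℕ} (G : SimpleGraph n) (p : ℕ) (U A B : Fin n → Bool) : Set where
  field
    parts : Partition U A B
    degA : ∀ v → deg (restrict G A) v ≤ p
    degB : ∀ v → deg (restrict G B) v ≤ p
    missA : ∀ v → A ∋ v → misses G B v ≤ 1 + 2 * p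
    missB : ∀ v → B ∋ v → misses G A v ≤ 1 + 2 * p
    sizeA : 8 * (suc p * suc p) ≤ # A
    sizeB : 8 * (suc p * suc p) ≤ # B

flip-structure : {G : SimpleGraph n} {p : ℕ} {U A B : Fin n → Bool} → Structure G p U A B → Structure G p U B A
flip-structure S = record { parts = flip-partition parts ; degA = degB ; degB = degA ; missA = missB ; missB = missA ; sizeA = sizeB ; sizeB = sizeA }
  where open Structure S

structure : {n : ℕ} (G : SimpleGraph n) (p : ℕ) → (∀ x L → Flower (Adj G) x L → suc p ≤ length L → ⊥) →
  2 ≤ p → 50 * (suc p * suc p) ≤ n →
  (U : Fin n → Bool) → (∀ v → U ∋ v → ⌊ # U /2⌋ ≤ deg (restrict G U) v) →
  2 * τ (# U) + 2 * n ≤ edges₂ (restrict G U) + 2 * # U →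
  ¬ ¬ (∃ λ A → ∃ λ B → Structure G p U A B)
structure {n} G p no-flower 2≤p n≥ U mindeg dense k = cases (h ≤? 2 * p)
  where
  q² h : ℕ
  q² = suc p * suc p
  h = ⌊ # U /2⌋
  ≤h : # U ≤ 1 + 2 * h
  ≤h = ≤-trans (≤-reflexive (sym (⌊n/2⌋+⌈n/2⌉≡n (# U)))) (≤-trans (+-monoʳ-≤ h (⌊n/2⌋-mono (s≤s (n≤1+n (# U)))))
    (≤-reflexive (trans (+-suc h h) (cong (λ z → suc (h + z)) (sym (+-identityʳ h))))))
  open Dense G p no-flower
  q²≥3q : 3 * suc p ≤ q²
  q²≥3q = *-monoˡ-≤ (suc p) (s≤s 2≤p)

  module _ (X Y : Fin n → Bool) (XY : Partition U X Y) where
    open Partition XY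
    misses-bound : ∀ {d t} → (∀ v → deg (restrict G X) v ≤ d) → h ≤ # X + t → ∀ v → X ∋ v → misses G Y v ≤ 1 + t + d
    misses-bound {d} {t} dX hX v xv = lin 0
        (≤-reflexive (#-split Y (adj G v)) ⊕ mindeg v (A⊆ v xv) ⊕ deg-split G U X Y cov xv ⊕ dX v ⊕ hX ⊕ ≤-reflexive (#-partition XY) ⊕ ≤h)
        (ar (misses G Y v) (# (λ w → Y w ∧ adj G v w)) (# Y) (deg (restrict G U) v) (deg (restrict G X) v) d t (# X) (# U) h)
      where
      ar : ∀ m y Y u x d t X U h → m + (Y + (u + (x + y + (d + (X + t + (U + (1 + 2 * h))))))) + 0 ≡
           1 + t + d + (y + m + (h + (u + (x + (h + (X + Y + U))))))
      ar = solve-∀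
    size-bound : ∀ {d} → (∀ v → deg (restrict G X) v ≤ d) → 1 ≤ # X → h ≤ # Y + d
    size-bound {d} dX X≥1 with v , xv ← inhabited X≥1 = begin
      h ≤⟨ mindeg v (A⊆ v xv) ⟩
      deg (restrict G U) v ≤⟨ deg-split G U X Y cov xv ⟩
      deg (restrict G X) v + # (λ w → Y w ∧ adj G v w) ≤⟨ dX v ⊕ #-⊆ {q = Y} (λ w e → proj₁ (∧⁻ {Y w} e)) ⟩
      d + # Y ≡⟨ +-comm d _ ⟩
      # Y + d ∎
      where open ≤-Reasoning

  -- Bootstrapping: the crude inner degree `8 * suc p` limits the missing edges at each vertex well
  -- enough for `inner-degree`, which reduces the inner degree to `p`. This in turn sharpens the
  -- sizes and the missing edges.
  refine : ∀ A B → Partition U A B → (∀ v → deg (restrict G A) v ≤ 8 * suc p) → (∀ v → deg (restrict G B) v ≤ 8 * suc p) →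
    h ≤ # A + 2 * p → h ≤ # B + 2 * p → 9 * q² ≤ h → Structure G p U A B
  refine A B AB dA dB hA hB h≥ = record
    { parts = AB ; degA = dA′ ; degB = dB′
    ; missA = λ v av → ≤-trans (misses-bound A B AB dA′ hA′ v av) 1+p+p
    ; missB = λ v bv → ≤-trans (misses-bound B A BA dB′ hB′ v bv) 1+p+p
    ; sizeA = size A hA′ ; sizeB = size B hB′ }
    where
    BA = flip-partition AB
    D = 1 + 2 * p + 8 * suc p
    room : ∀ X → h ≤ # X + 2 * p → 2 * D + 2 * suc p + 2 ≤ # X
    room X hX = lin (5 + 3 * p) (hX ⊕ h≥ ⊕ *-monoʳ-≤ 9 q²≥3q) (ar (# X) h q² p)
      where
      ar : ∀ x h s p → 2 * (1 + 2 * p + 8 * suc p) + 2 * suc p + 2 + (x + 2 * p + (h + 9 * s)) + (5 + 3 * p) ≡ x + (h + (9 * s + 9 * (3 * suc p)))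
      ar = solve-∀
    dA′ : ∀ v → deg (restrict G A) v ≤ p
    dA′ = inner-degree A B D (misses-bound A B AB dA hA) (room B hB)
    dB′ : ∀ v → deg (restrict G B) v ≤ p
    dB′ = inner-degree B A D (misses-bound B A BA dB hB) (room A hA)
    pos : ∀ X → h ≤ # X + 2 * p → 1 ≤ # X
    pos X hX = ≤-trans (s≤s z≤n) (room X hX)
    hA′ : h ≤ # A + p
    hA′ = size-bound B A BA dB′ (pos B hB)
    hB′ : h ≤ # B + p
    hB′ = size-bound A B AB dA′ (pos A hA)
    1+p+p : 1 + p + p ≤ 1 + 2 * p
    1+p+p = ≤-reflexive (cong (λ z → suc (p + z)) (sym (+-identityʳ p)))
    size : ∀ X → h ≤ # X + p → 8 * q² ≤ # X
    size X hX = lin (3 + 2 * p) (hX ⊕ h≥ ⊕ q²≥3q) (ar (# X) h q² p)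
      where
      ar : ∀ x h s p → 8 * s + (x + p + (h + s)) + (3 + 2 * p) ≡ x + (h + (9 * s + 3 * suc p))
      ar = solve-∀

  finish : ∀ S S′ → (∀ i → S ∋ i → U ∋ i) → (∀ i → S′ ∋ i → U ∋ i) →
    (∀ i j → S ∋ i → S ∋ j → ¬ adj G i j ≡ true) → (∀ i j → S′ ∋ i → S′ ∋ j → ¬ adj G i j ≡ true) →
    (∀ i → S ∋ i → S′ ∋ i → ⊥) → h ≤ # S + 2 * p → h ≤ # S′ + 2 * p → ⊥
  finish S S′ S⊆ S′⊆ S-indep S′-indep disjoint S-size S′-size =
    k (A , B , refine A B parts degA degB (≤-trans S-size (+-monoˡ-≤ (2 * p) (#-⊆ S⊆A))) (≤-trans S′-size (+-monoˡ-≤ (2 * p) (#-⊆ S′⊆B))) h≥)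
    where
    open Rough U h mindeg ≤h S S′ S⊆ S′⊆ S-indep S′-indep disjoint S-size S′-size
    ar₂ : ∀ s n h N t e a b x → 36 * s + (2 * n + (e + 2 * N + (a + b + 2 * x + (64 * s + (2 * t + 2 * (1 + 2 * h)))))) + 0 ≡
          2 + 4 * h + (2 * (50 * s) + (2 * t + 2 * n + (e + (a + b + (2 * x + 2 * N)))))
    ar₂ = solve-∀
    ar₃ : ∀ s h → 1 + (2 + 4 * h + 4 * (9 * s)) + 1 ≡ 0 + (36 * s + 4 * suc h)
    ar₃ = solve-∀
    -- Origin of the constant 50: `2 * n` is at least `100 * q²`, and inner edges account for at
    -- most `64 * q²` of it. The remaining `36 * q²` must come from `2 * # U`, which forces
    -- `9 * q² ≤ h`.
    N≥ : 36 * q² ≤ 2 + 4 * h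
    N≥ = lin 0 (*-monoʳ-≤ 2 n≥ ⊕ dense ⊕ edges₂-partition G parts ⊕ inner-edges
           ⊕ *-monoʳ-≤ 2 (≤-trans (cross≤ G A B) (≤-trans (*≤τ (# A) (# B)) (≤-reflexive (cong τ (#-partition parts)))))
           ⊕ *-monoʳ-≤ 2 ≤h)
           (ar₂ q² n h (# U) (τ (# U)) (edges₂ (restrict G U)) (edges₂ (restrict G A)) (edges₂ (restrict G B)) (cross G A B))
    h≥ : 9 * q² ≤ h
    h≥ = ≮⇒≥ (λ lt → 1+n≰n (lin {1} {0} 1 (N≥ ⊕ *-monoʳ-≤ 4 lt) (ar₃ q² h)))

  cases : Dec (h ≤ 2 * p) → ⊥
  -- Here `U` has at most `1 + 4 * p` vertices, too few to account for `2 * n`.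
  cases (yes small) = 1+n≰n (lin {1} {0} (84 * (p * p) + 184 * p + 96)
      (*-monoʳ-≤ 2 n≥ ⊕ dense ⊕ few ⊕ *-mono-≤ N≤ N≤ ⊕ *-monoʳ-≤ 2 N≤) (ar p n (edges₂ (restrict G U)) (# U) (τ (# U))))
    where
    N≤ : # U ≤ 1 + 4 * p
    N≤ = ≤-trans ≤h (s≤s (≤-trans (*-monoʳ-≤ 2 small) (≤-reflexive (sym (*-assoc 2 2 p)))))
    few : edges₂ (restrict G U) ≤ # U * # U + 2 * τ (# U)
    few = ≤-trans (≤-trans (∑-mono (λ i → ∑-mono (λ j → ⟦⟧-⊆ {adj G i j ∧ (U i ∧ U j)} (λ e → proj₂ (∧⁻ {adj G i j} e))))) (≤-reflexive (∑∑-product U U))) (m≤m+n _ _)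
    ar : ∀ p n e N t → 1 + (2 * n + (e + 2 * N + (N * N + 2 * t + ((1 + 4 * p) * (1 + 4 * p) + 2 * (1 + 4 * p))))) + (84 * (p * p) + 184 * p + 96)
       ≡ 0 + (2 * (50 * (suc p * suc p)) + (2 * t + 2 * n + (e + (N * N + 2 * N))))
    ar = solve-∀
  cases (no big) with x , ux ← inhabited (≤-trans (≤-trans (s≤s z≤n) (≰⇒> big)) (⌊n/2⌋≤n (# U))) =
    independent-neighbourhood U h mindeg ≤h x ux λ (S , S-sub , S-indep , S-size) →
    let y , sy = inhabited {p = S} (lin 0 (≰⇒> big ⊕ S-size) (ar₁ (# S) h p)) in
    -- `S′` consists of neighbours of a vertex `y` of the independent set `S`, which makes the two
    -- sets disjoint.
    independent-neighbourhood U h mindeg ≤h y (proj₁ (S-sub y sy)) λ (S′ , S′-sub , S′-indep , S′-size) →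
    finish S S′ (λ i s → proj₁ (S-sub i s)) (λ i s → proj₁ (S′-sub i s)) S-indep S′-indep
      (λ i s s′ → S-indep y i sy s (proj₂ (S′-sub i s′))) S-size S′-size
    where
    ar₁ : ∀ s h p → 1 + (h + (s + 2 * p)) + 0 ≡ s + (suc (2 * p) + h)
    ar₁ = solve-∀

-- Pairings and common neighbours

flat-All : ∀ {A : Set} {P : A → Set} {L : List (A × A)} → All (λ (u , v) → P u × P v) L → All P (flat L)
flat-All [] = []
flat-All ((pu , pv) ∷ a) = pu ∷ pv ∷ flat-All a

pair-up : ∀ {A : Set} m (xs : List A) → length xs ≡ 2 * m → ∃ λ L → flat L ≡ xs × length L ≡ m
pair-up zero [] _ = [] , refl , refl
pair-up (suc m) [] ()
pair-up (suc m) (x ∷ []) len = ⊥-elim (1+n≢0 (sym (suc-injective (trans len (*-suc 2 m)))))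
pair-up (suc m) (x ∷ y ∷ xs) len with L , refl , len′ ← pair-up m xs (suc-injective (suc-injective (trans len (*-suc 2 m))))
  = (x , y) ∷ L , refl , cong suc len′

pair-unique : ∀ {A : Set} {L : List (A × A)} → Unique (flat L) → ∀ {u v u′ v′ z} → (u , v) ∈ L → (u′ , v′) ∈ L →
  z ≡ u ⊎ z ≡ v → z ≡ u′ ⊎ z ≡ v′ → u ≡ u′ × v ≡ v′
pair-unique {L = _ ∷ L} u (here refl) (here refl) _ _ = refl , refl
pair-unique {L = _ ∷ L} u (here refl) (there q) z₁ z₂ = ⊥-elim (clash z₁ z₂)
  where
  clash : _ → _ → ⊥
  clash (inj₁ refl) (inj₁ refl) = Unique-head u (there (proj₁ (∈-flat q)))
  clash (inj₁ refl) (inj₂ refl) = Unique-head u (there (proj₂ (∈-flat q)))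
  clash (inj₂ refl) (inj₁ refl) = Unique-head (Unique-tail u) (proj₁ (∈-flat q))
  clash (inj₂ refl) (inj₂ refl) = Unique-head (Unique-tail u) (proj₂ (∈-flat q))
pair-unique {L = _ ∷ L} u (there q) (here refl) z₁ z₂ =
  let a , b = pair-unique u (here refl) (there q) z₂ z₁ in sym a , sym b
pair-unique {L = _ ∷ L} u (there q) (there q′) z₁ z₂ = pair-unique (Unique-tail (Unique-tail u)) q q′ z₁ z₂

matching-shrink : {G : SimpleGraph n} (L : List (Fin n × Fin n)) {q : ℕ} → IsMatching G L → q ≤ length L →
  ∃ λ L′ → IsMatching G L′ × length L′ ≡ q
matching-shrink L {q} M le with q <? length L
matching-shrink L {q} M le | no ¬lt = L , M , ≤-antisym (≮⇒≥ ¬lt) le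
matching-shrink {G = G} (_ ∷ L) {q} (_ ∷ a , u) le | yes (s≤s lt) = matching-shrink {G = G} L (a , Unique-tail (Unique-tail u)) lt

all-adj : SimpleGraph n → List (Fin n) → Fin n → Bool
all-adj G [] w = true
all-adj G (z ∷ zs) w = adj G z w ∧ all-adj G zs w

all-adj⁻ : (G : SimpleGraph n) (zs : List (Fin n)) {w : Fin n} → all-adj G zs w ≡ true → All (λ z → adj G z w ≡ true) zs
all-adj⁻ G [] _ = []
all-adj⁻ G (z ∷ zs) {w} e = let e₁ , e₂ = ∧⁻ {adj G z w} e in e₁ ∷ all-adj⁻ G zs e₂

all-adj-bound : (G : SimpleGraph n) (B : Fin n → Bool) (D : ℕ) (zs : List (Fin n)) → All (λ z → misses G B z ≤ D) zs →
  # B ≤ # (λ w → B w ∧ all-adj G zs w) + length zs * D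
all-adj-bound G B D [] [] = ≤-trans (#-⊆ (λ w b → ∧⁺ b refl)) (m≤m+n _ 0)
all-adj-bound G B D (z ∷ zs) (m ∷ ms) = begin
  # B ≤⟨ all-adj-bound G B D zs ms ⟩
  # (λ w → B w ∧ all-adj G zs w) + length zs * D ≤⟨ +-monoˡ-≤ _ (#-cover {q = λ w → B w ∧ all-adj G (z ∷ zs) w} sp) ⟩
  # (λ w → B w ∧ all-adj G (z ∷ zs) w) + misses G B z + length zs * D ≡⟨ +-assoc (# (λ w → B w ∧ all-adj G (z ∷ zs) w)) _ _ ⟩
  # (λ w → B w ∧ all-adj G (z ∷ zs) w) + (misses G B z + length zs * D) ≤⟨ +-monoʳ-≤ (# (λ w → B w ∧ all-adj G (z ∷ zs) w)) (+-monoˡ-≤ (length zs * D) m) ⟩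
  # (λ w → B w ∧ all-adj G (z ∷ zs) w) + (D + length zs * D) ∎
  where
  open ≤-Reasoning
  sp : ∀ w → B w ∧ all-adj G zs w ≡ true → B w ∧ (adj G z w ∧ all-adj G zs w) ≡ true ⊎ B w ∧ not (adj G z w) ≡ true
  sp w e with b , a ← ∧⁻ {B w} e with bool (adj G z w)
  ... | inj₁ g = inj₁ (∧⁺ b (∧⁺ g a))
  ... | inj₂ g = inj₂ (∧⁺ b (not⁺ g))

missing : SimpleGraph n → (A B : Fin n → Bool) → Fin n → ℕ
missing G A B i = ⟦ A i ⟧ * misses G B i

cross+missing : (G : SimpleGraph n) (A B : Fin n → Bool) → cross G A B + ∑ (missing G A B) ≡ # A * # B
cross+missing G A B = begin
  cross G A B + ∑ (λ i → ⟦ A i ⟧ * misses G B i) ≡⟨ sym (∑-+ _ _) ⟩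
  ∑ (λ i → # (λ j → adj G i j ∧ (A i ∧ B j)) + ⟦ A i ⟧ * misses G B i) ≡⟨ ∑-cong pt ⟩
  ∑ (λ i → # B * ⟦ A i ⟧) ≡⟨ trans (∑-* (# B) _) (*-comm (# B) (# A)) ⟩
  # A * # B ∎
  where
  open ≡-Reasoning
  pt : ∀ i → # (λ j → adj G i j ∧ (A i ∧ B j)) + ⟦ A i ⟧ * misses G B i ≡ # B * ⟦ A i ⟧
  pt i with A i
  ... | true = trans (cong₂ _+_ (∑-cong (λ j → cong ⟦_⟧ (∧-comm (adj G i j) (B j)))) (*-identityˡ _)) (trans (#-split B (adj G i)) (sym (*-identityʳ (# B))))
  ... | false = trans (+-identityʳ _) (trans (≤-antisym (≤-trans (#-⊆ {q = λ _ → false} (λ j e → proj₂ (∧⁻ {adj G i j} e))) (≤-reflexive ∑-0)) z≤n) (sym (*-zeroʳ (# B))))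

-- Far vertices and exchangeable pairs

module Far {n r : ℕ} (c : Fin n → Fin n → Fin r) (c-sym : ∀ i j → c i j ≡ c j i)
  (G : SimpleGraph n) (G-rainbow : Rainbow c (Adj G)) (p : ℕ) (no-rainbow : ¬ HasRainbow c (FriendEdge (suc p)))
  (U A B : Fin n → Bool) (St : Structure G p U A B) where

  open Structure St
  open Partition parts

  -- The ends of `suc p` disjoint edges inside `A` have a common neighbour `b` in `B`, the centre of
  -- a rainbow flower.
  matching-bound : ν≤ (restrict G A) p
  matching-bound L M = ≮⇒≥ λ big → contra (matching-shrink {G = restrict G A} L M big)
    where
    contra : (∃ λ L′ → IsMatching (restrict G A) L′ × length L′ ≡ suc p) → ⊥
    contra (L′ , (a , u) , len) = no-rainbow (rainbow-flower (adj-flip G) G-rainbow (blades , b∉ ∷ᵘ u) (≤-reflexive (sym len)))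
      where
      inA : All (λ z → A ∋ z) (flat L′)
      inA = flat-All (All.map (λ {(x , z)} e → proj₂ (restrict⁻ G A {x} {z} e)) a)
      C : Fin n → Bool
      C w = B w ∧ all-adj G (flat L′) w
      ar : ∀ x b p → 1 + (b + (x + 2 * suc p * (1 + 2 * p))) + (4 * (p * p) + 10 * p + 5) ≡ x + (8 * (suc p * suc p) + b)
      ar = solve-∀
      pick : ∃ (C ∋_)
      pick = inhabited (lin (4 * (p * p) + 10 * p + 5) (sizeB ⊕ ≤-trans (all-adj-bound G B (1 + 2 * p) (flat L′) (All.map (λ {z} → missA z) inA))
        (≤-reflexive (cong (λ l → # C + l * (1 + 2 * p)) (trans (length-flat L′) (cong (2 *_) len))))) (ar (# C) (# B) p))
      b = proj₁ pick
      b∈B = proj₁ (∧⁻ {B b} (proj₂ pick))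
      adjb = all-adj⁻ G (flat L′) (proj₂ (∧⁻ {B b} (proj₂ pick)))
      b∉ : b ∉ flat L′
      b∉ q = dis b (All.lookup inA q) b∈B
      blades : All (Blade (Adj G) b) L′
      blades = All.tabulate (λ {(x , z)} q → let x∈ , z∈ = ∈-flat q in
        adj-flip G (All.lookup adjb x∈) , adj-flip G (All.lookup adjb z∈) , proj₁ (restrict⁻ G A {x} {z} (All.lookup a q)))

  inner-edges : edges₂ (restrict G A) ≤ 4 * (p * p)
  inner-edges = ≤-trans (edges₂-cover-bound (restrict G A) {D = p} {ms = λ _ → 0} matching-bound (λ i → ≤-trans (degA i) (m≤m+n p 0)))
    (≤-reflexive (trans (cong (λ z → 2 * (2 * p * p + z)) ∑-0) (ar p)))
    where
    ar : ∀ p → 2 * (2 * p * p + 0) ≡ 4 * (p * p)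
    ar = solve-∀

  far : Fin n → Bool
  far i = A i ∧ (not (touched (restrict G A) i) ∧ not (does (1 ≤? misses G B i)))

  far⊆ : ∀ {i} → far ∋ i → A ∋ i
  far⊆ {i} f = proj₁ (∧⁻ {A i} f)

  far-untouched : ∀ {i} → far ∋ i → touched (restrict G A) ∌ i
  far-untouched {i} f = not⁻ (proj₁ (∧⁻ {not (touched (restrict G A) i)} (proj₂ (∧⁻ {A i} f))))

  far-complete : ∀ {i} → far ∋ i → ∀ {w} → B ∋ w → adj G i w ≡ true
  far-complete {i} f {w} bw with bool (adj G i w)
  ... | inj₁ e = e
  ... | inj₂ e = ⊥-elim (true≢false (does⁺ (1 ≤? misses G B i) (length≤# {p = λ w → B w ∧ not (adj G i w)} {xs = w ∷ []} ([] ∷ []) (∧⁺ bw (not⁺ e) ∷ [])))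
    (not⁻ (proj₂ (∧⁻ {not (touched (restrict G A) i)} (proj₂ (∧⁻ {A i} f))))))

  -- The vertices excluded are the at most `2 * p * suc p` touched ones and those with a missing
  -- edge, each of which contributes at least 1 to the sum.
  far-many : ∑ (missing G A B) ≤ 4 * (p * p) → 2 * suc p ≤ # far
  far-many few = lin (2 * (p * p) + 12 * p + 6) (sizeA ⊕ split ⊕ touched-bound (restrict G A) matching-bound degA ⊕ ≤-trans incomplete few)
      (ar (# far) (# A) (# (touched (restrict G A))) (# inc) p)
    where
    inc : Fin n → Bool
    inc i = A i ∧ does (1 ≤? misses G B i)
    ar : ∀ f a t m p → 2 * suc p + (a + (f + (t + m) + (2 * p * suc p + 4 * (p * p)))) + (2 * (p * p) + 12 * p + 6) ≡ f + (8 * (suc p * suc p) + (a + (t + m)))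
    ar = solve-∀
    TI : Fin n → Bool
    TI i = touched (restrict G A) i ∨ inc i
    split : # A ≤ # far + (# (touched (restrict G A)) + # inc)
    split = ≤-trans (#-cover {q = far} {r = TI} sp) (+-monoʳ-≤ (# far) (#-cover (λ i → ∨⁻)))
      where
      sp : ∀ i → A ∋ i → far ∋ i ⊎ TI ∋ i
      sp i a with bool (touched (restrict G A) i) | bool (does (1 ≤? misses G B i))
      ... | inj₁ t | _ = inj₂ (∨⁺ˡ t)
      ... | inj₂ _ | inj₁ m = inj₂ (∨⁺ʳ {touched (restrict G A) i} (∧⁺ a m))
      ... | inj₂ t | inj₂ m = inj₁ (∧⁺ a (∧⁺ (not⁺ t) (not⁺ m)))
    incomplete : # inc ≤ ∑ (missing G A B)
    incomplete = ∑-mono pt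
      where
      pt : ∀ i → ⟦ inc i ⟧ ≤ ⟦ A i ⟧ * misses G B i
      pt i with bool (inc i)
      ... | inj₂ e = ≤-trans (≤-reflexive (cong ⟦_⟧ e)) z≤n
      ... | inj₁ e = let a , m = ∧⁻ {A i} e in ≤-trans (≤-reflexive (cong ⟦_⟧ e)) (≤-trans (does⁻ (1 ≤? misses G B i) m)
        (≤-reflexive (trans (sym (*-identityˡ _)) (cong (λ b → ⟦ b ⟧ * misses G B i) (sym a)))))

  Good : Fin n × Fin n → Set
  Good (a , a′) = ∀ w → B ∋ w → c a w ≢ c a a′ × c a′ w ≢ c a a′

  Bad : Fin n × Fin n → Set
  Bad (a , a′) = ∃ λ w → B ∋ w × (c a w ≡ c a a′ ⊎ c a′ w ≡ c a a′)

  bad? : ∀ aa → Dec (Bad aa)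
  bad? (a , a′) = any? (λ w → (B w Bool.≟ true) ×-dec ((c a w ≟ c a a′) ⊎-dec (c a′ w ≟ c a a′)))

  -- Otherwise adding suc p disjoint pairs of far vertices in place of the crossing edges of the
  -- same colours would give a rainbow flower.
  good-pair : 2 * suc p ≤ # far → (farB : Fin n → Bool) → (∀ {b} → farB ∋ b → B ∋ b) →
    (∀ {b} → farB ∋ b → ∀ {a} → A ∋ a → adj G b a ≡ true) → suc (suc p) ≤ # farB →
    ∃ λ a → ∃ λ a′ → a ≢ a′ × far ∋ a × far ∋ a′ × Good (a , a′)
  good-pair many farB farB⊆ complete manyB with xs , lenx , ux , ax ← choose (2 * suc p) many
    with P , refl , lenP ← pair-up (suc p) xs lenx with All.all? bad? P
  ... | no ¬all with (a , a′) , p∈ , good ← find (¬All⇒Any¬ bad? P ¬all)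
    = let a∈ , a′∈ = ∈-flat p∈ in
      a , a′ , distinct P ux p∈ , All.lookup ax a∈ , All.lookup ax a′∈ ,
      λ w bw → (λ e → good (w , bw , inj₁ e)) , (λ e → good (w , bw , inj₂ e))
    where
    distinct : ∀ P {a a′} → Unique (flat P) → (a , a′) ∈ P → a ≢ a′
    distinct (_ ∷ P) u (here refl) refl = Unique-head u (here refl)
    distinct (_ ∷ P) u (there q) = distinct P (Unique-tail (Unique-tail u)) q
  ... | yes allbad = ⊥-elim (no-rainbow (rainbow-flower {R = R} (addPairs-sym c-sym (adj-flip G)) (addPairs-rainbow c-sym G-rainbow P-inj) {b} (blades , b∉ ∷ᵘ ux) (≤-reflexive (sym lenP))))
    where
    R = AddPairs c (Adj G) P
    ws : ∀ {P} → All Bad P → List (Fin n)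
    ws [] = []
    ws ((w , _) ∷ a) = w ∷ ws a
    ws-len : ∀ {P} (a : All Bad P) → length (ws a) ≡ length P
    ws-len [] = refl
    ws-len (_ ∷ a) = cong suc (ws-len a)
    ws-∈ : ∀ {P} (a : All Bad P) {aa} (q : aa ∈ P) → proj₁ (All.lookup a q) ∈ ws a
    ws-∈ (_ ∷ a) (here refl) = here refl
    ws-∈ (_ ∷ a) (there q) = there (ws-∈ a q)
    -- `b` avoids the ends in `B` of the crossing edges that carry the colours of the pairs, so no
    -- spoke at `b` is removed by the exchange. There are `suc p` such ends, hence the `suc (suc p)`
    -- candidates.
    pick = fresh {p = farB} (ws allbad) (≤-trans (≤-reflexive (cong suc (trans (ws-len allbad) lenP))) manyB)
    b = proj₁ pick
    fb = proj₁ (proj₂ pick)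
    inA : ∀ {z} → z ∈ flat P → A ∋ z
    inA q = far⊆ (All.lookup ax q)
    witness : ∀ {u v} (q : (u , v) ∈ P) → ∃ λ x → ∃ λ w → (x ≡ u ⊎ x ≡ v) × A ∋ x × B ∋ w × adj G x w ≡ true × c x w ≡ c u v × w ∈ ws allbad
    witness {u} {v} q with All.lookup allbad q | ws-∈ allbad q
    ... | w , bw , inj₁ e | w∈ = u , w , inj₁ refl , inA (proj₁ (∈-flat q)) , bw , far-complete (All.lookup ax (proj₁ (∈-flat q))) bw , e , w∈
    ... | w , bw , inj₂ e | w∈ = v , w , inj₂ refl , inA (proj₂ (∈-flat q)) , bw , far-complete (All.lookup ax (proj₂ (∈-flat q))) bw , e , w∈
    -- Distinct pairs have distinct colours: the edge of `G` of a given colour is unique, and its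
    -- end in `A` determines the pair.
    P-inj : ∀ {u v u′ v′} → (u , v) ∈ P → (u′ , v′) ∈ P → c u v ≡ c u′ v′ → u ≡ u′ × v ≡ v′
    P-inj q q′ e with x , w , xu , ax , bw , xw , e₁ , _ ← witness q | x′ , w′ , xu′ , ax′ , bw′ , xw′ , e₂ , _ ← witness q′
      with G-rainbow xw xw′ (trans e₁ (trans e (sym e₂)))
    ... | inj₁ (refl , _) = pair-unique ux q q′ xu xu′
    ... | inj₂ (refl , _) = ⊥-elim (dis x ax bw′)
    spoke : ∀ {z} → z ∈ flat P → R b z
    spoke {z} z∈ = inj₂ (complete fb (inA z∈) , λ q e → new q e)
      where
      new : ∀ {u v} → (u , v) ∈ P → c b z ≡ c u v → ⊥
      new q e with x , w , _ , ax , bw , xw , e₁ , w∈ ← witness q with G-rainbow (complete fb (inA z∈)) xw (trans e (sym e₁))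
      ... | inj₁ (refl , _) = dis b ax (farB⊆ fb)
      ... | inj₂ (refl , _) = proj₂ (proj₂ pick) w∈
    b∉ : b ∉ flat P
    b∉ q = dis b (inA q) (farB⊆ fb)
    blades : All (Blade R b) P
    blades = All.tabulate (λ q → let x∈ , z∈ = ∈-flat q in spoke x∈ , spoke z∈ , inj₁ (inj₁ q))

-- `good` lets `a a′` serve as the rim of a blade centred in `B`: neither spoke has the colour that
-- the pair takes over.
record FarPair {n r : ℕ} (c : Fin n → Fin n → Fin r) (G : SimpleGraph n) (A B : Fin n → Bool) (a a′ : Fin n) : Set where
  field
    a∈ : A ∋ a
    a′∈ : A ∋ a′
    a≢a′ : a ≢ a′
    complete : ∀ {w} → B ∋ w → adj G a w ≡ true × adj G a′ w ≡ true
    untouched : touched (restrict G A) ∌ a × touched (restrict G A) ∌ a′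
    good : ∀ w → B ∋ w → c a w ≢ c a a′ × c a′ w ≢ c a a′

-- The exchange argument

module Swap {n r : ℕ} (c : Fin n → Fin n → Fin r) (c-sym : ∀ i j → c i j ≡ c j i)
  (G : SimpleGraph n) (G-rainbow : Rainbow c (Adj G)) (K : ℕ)
  (no-rainbow : ¬ HasRainbow c (FriendEdge (suc (suc K))))
  (U A B : Fin n → Bool) (St : Structure G (suc K) U A B)
  (a a′ b b′ : Fin n) (aa : FarPair c G A B a a′) (bb : FarPair c G B A b b′)
  (G₀ : SimpleGraph n) (G₀⊆ : ∀ {i j} → adj G₀ i j ≡ true → adj G i j ≡ true × c i j ≢ c a a′ × c i j ≢ c b b′)
  (G₀⊇ : ∀ {i j} → adj G i j ≡ true → c i j ≢ c a a′ → c i j ≢ c b b′ → adj G₀ i j ≡ true)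
  (miss₀ : ∀ v → B ∋ v → misses G₀ A v ≤ 5 + 2 * K) where

  open Structure St
  open Partition parts
  open FarPair aa
  open FarPair bb using () renaming (a∈ to b∈; a′∈ to b′∈; a≢a′ to b≢b′; complete to b-complete; good to b-good)

  private
    lift : ∀ X L → All (Edge (restrict G₀ X)) L → All (Edge (restrict G X)) L
    lift X L = All.map (λ {(u , v)} e → let e₁ , xu , xv = restrict⁻ G₀ X {u} {v} e in ∧⁺ (proj₁ (G₀⊆ e₁)) (∧⁺ xu xv))

    module F = Far c c-sym G G-rainbow (suc K) no-rainbow U A B St

    matching₀ : ∀ L → IsMatching (restrict G₀ A) L → length L ≤ suc K
    matching₀ L (e , u) = F.matching-bound L (lift A L e , u)

    inA : ∀ L → All (Edge (restrict G₀ A)) L → All (λ z → A ∋ z) (flat L)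
    inA L e = flat-All (All.map (λ {(u , v)} e → proj₂ (restrict⁻ G₀ A {u} {v} e)) e)

    touchedA : ∀ L → All (Edge (restrict G₀ A)) L → All (λ z → touched (restrict G A) ∋ z) (flat L)
    touchedA L e = flat-All (All.map (λ {(u , v)} e → touched⁺ (restrict G A) {u} {v} e) (lift A L e))

    fresh-list : ∀ L → IsMatching (restrict G₀ A) L → Unique (a ∷ a′ ∷ flat L)
    fresh-list L (e , u) = (λ { (here q) → a≢a′ q ; (there q) → true≢false (All.lookup (touchedA L e) q) (proj₁ untouched) })
      ∷ᵘ (λ q → true≢false (All.lookup (touchedA L e) q) (proj₂ untouched)) ∷ᵘ u

    fresh-inA : ∀ L → IsMatching (restrict G₀ A) L → ∀ {z} → z ∈ a ∷ a′ ∷ flat L → A ∋ z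
    fresh-inA L M (here refl) = a∈
    fresh-inA L M (there (here refl)) = a′∈
    fresh-inA L (e , _) (there (there q)) = All.lookup (inA L e) q

    room : ∀ {l k s m m′} → 8 * (suc (suc K) * suc (suc K)) ≤ s → s ≤ k + (m + m′) → m ≤ 5 + 2 * K → m′ ≤ 5 + 2 * K → l ≤ 7 + 2 * K → l < k
    room {l} {k} {s} {m} {m′} h₁ h₂ h₃ h₄ h₅ = lin (8 * (K * K) + 26 * K + 14) (h₁ ⊕ h₂ ⊕ h₃ ⊕ h₄ ⊕ h₅) (ar l k s m m′ K)
      where
      ar : ∀ l k s m m′ K → suc l + (s + (k + (m + m′) + ((5 + 2 * K) + ((5 + 2 * K) + (7 + 2 * K))))) + (8 * (K * K) + 26 * K + 14) ≡
                            k + (8 * (suc (suc K) * suc (suc K)) + (s + (m + (m′ + l))))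
      ar = solve-∀

    third : ∀ {x u} → B ∋ x → B ∋ u → ∀ zs → length zs ≤ 7 + 2 * K → ∃ λ w → w ∉ zs × adj G₀ x w ≡ true × adj G₀ u w ≡ true
    third {x} {u} bx bu zs lz =
      let w , e , w∉ = fresh {p = common G₀ A x u} zs (room sizeA (common-bound G₀ A x u) (miss₀ x bx) (miss₀ u bu) lz)
          e₁ , e₂ = ∧⁻ {adj G₀ x w} (proj₂ (∧⁻ {A w} e))
      in w , w∉ , e₁ , e₂

  -- The forbidden flower at `x` has the edges of `L` and the pair `a a′` as rims, and its other
  -- blades are inner neighbours of `x` completed by common neighbours in `A`.
  degree+matching : ∀ {x} → B ∋ x → ∀ L → IsMatching (restrict G₀ A) L → All (λ z → adj G₀ x z ≡ true) (flat L) →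
    length L + deg (restrict G₀ B) x ≤ K
  degree+matching {x} bx L M@(e , u) xL = ≮⇒≥ contra
    where
    P = (a , a′) ∷ []
    R = AddPairs c (Adj G) P
    R₀ : ∀ {i j} → adj G₀ i j ≡ true → R i j
    R₀ g = let g₁ , g₂ , _ = G₀⊆ g in inj₂ (g₁ , λ { (here refl) → g₂ })
    P-inj : ∀ {u v u′ v′} → (u , v) ∈ P → (u′ , v′) ∈ P → c u v ≡ c u′ v′ → u ≡ u′ × v ≡ v′
    P-inj (here refl) (here refl) _ = refl , refl
    -- `matching₀` makes the subtraction exact; the blade on `a a′` raises the total from `suc K` to
    -- `suc (suc K)`.
    t = suc K ∸ length L
    contra : suc K ≤ length L + deg (restrict G₀ B) x → ⊥
    contra big with us , lenu , uu , au ← choose t {adj (restrict G₀ B) x} (m≤n+o⇒m∸n≤o (suc K) (length L) big)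
      = no-rainbow (rainbow-flower {R = R} (addPairs-sym c-sym (adj-flip G)) (addPairs-rainbow c-sym G-rainbow P-inj)
          (proj₁ (proj₂ grown)) (≤-reflexive (sym (trans (proj₂ (proj₂ grown)) total))))
      where
      nbr : ∀ {w} → w ∈ us → adj G₀ x w ≡ true × B ∋ x × B ∋ w
      nbr {w} w∈ = restrict⁻ G₀ B {x} {w} (All.lookup au w∈)
      total : length us + suc (length L) ≡ suc (suc K)
      total = trans (+-suc _ _) (cong suc (trans (cong (_+ length L) lenu) (m∸n+n≡m (matching₀ L M))))
      x∉ : x ∉ us ++ a ∷ a′ ∷ flat L
      x∉ q with ∈-++⁻ us q
      ... | inj₁ q′ = adj⇒≢ G₀ (proj₁ (nbr q′)) refl
      ... | inj₂ q′ = dis x (fresh-inA L M q′) bx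
      spoke-a : R x a
      spoke-a = inj₂ (adj-flip G (proj₁ (complete bx)) , λ { (here refl) eq → proj₁ (good x bx) (trans (c-sym a x) eq) })
      spoke-a′ : R x a′
      spoke-a′ = inj₂ (adj-flip G (proj₂ (complete bx)) , λ { (here refl) eq → proj₂ (good x bx) (trans (c-sym a′ x) eq) })
      blades : All (Blade R x) ((a , a′) ∷ L)
      blades = (spoke-a , spoke-a′ , inj₁ (inj₁ (here refl))) ∷
        All.tabulate (λ {(v , w)} q → let v∈ , w∈ = ∈-flat q in
          R₀ (All.lookup xL v∈) , R₀ (All.lookup xL w∈) , R₀ (proj₁ (restrict⁻ G₀ A {v} {w} (All.lookup e q))))
      grown = greedy {R = R} {x} (7 + 2 * K) us ((a , a′) ∷ L) blades
        (x∉ ∷ᵘ Unique-++⁺ uu (fresh-list L M) (λ (q , q′) → dis _ (fresh-inA L M q′) (proj₂ (proj₂ (nbr q)))))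
        (All.tabulate (λ {w} w∈ → R₀ (proj₁ (nbr w∈)) , λ zs lz → let z , z∉ , e₁ , e₂ = third bx (proj₂ (proj₂ (nbr w∈))) zs lz in z , z∉ , R₀ e₁ , R₀ e₂))
        (lin 2 ≤-refl (trans (cong (λ l → 1 + 2 * l + 0 + 2) total) (ar K)))
        where
        ar : ∀ K → 1 + 2 * suc (suc K) + 0 + 2 ≡ 7 + 2 * K + 0
        ar = solve-∀

  -- Centre `b`: it is adjacent to all of `A` by edges avoiding the colour of `b b′`, here also that
  -- of `a a′`, so these edges survive in `G₀`.
  matching≤K : c a a′ ≡ c b b′ → ν≤ (restrict G₀ A) K
  matching≤K eq L M@(e , u) = m+n≤o⇒m≤o (length L) (degree+matching b∈ L M
    (All.map (λ {z} az → let g = proj₁ (b-complete az) ; ≢β = proj₁ (b-good z az) in G₀⊇ g (λ e → ≢β (trans e eq)) ≢β) (inA L e)))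

  -- Both pairs enter: `a a′` as the rim of a blade, and `b b′` as a spoke at one of its ends,
  -- completed to a triangle by a vertex of `A`. With `L` this makes `length L + 2` blades.
  matching<K : c a a′ ≢ c b b′ → ∀ L → IsMatching (restrict G₀ A) L → suc (length L) ≤ K
  matching<K α≢β L M@(e , u) = ≰⇒> λ big → centre big (bool hit)
    where
    P = (a , a′) ∷ (b , b′) ∷ []
    R = AddPairs c (Adj G) P
    R₀ : ∀ {i j} → adj G₀ i j ≡ true → R i j
    R₀ g = let g₁ , g₂ , g₃ = G₀⊆ g in inj₂ (g₁ , λ { (here refl) → g₂ ; (there (here refl)) → g₃ })
    P-inj : ∀ {u v u′ v′} → (u , v) ∈ P → (u′ , v′) ∈ P → c u v ≡ c u′ v′ → u ≡ u′ × v ≡ v′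
    P-inj (here refl) (here refl) _ = refl , refl
    P-inj (here refl) (there (here refl)) eq = ⊥-elim (α≢β eq)
    P-inj (there (here refl)) (here refl) eq = ⊥-elim (α≢β (sym eq))
    P-inj (there (here refl)) (there (here refl)) _ = refl , refl
    hit : Bool
    hit = does (1 ≤? # (λ z → A z ∧ (c b z == c a a′)))
    from : K ≤ length L → ∀ x x′ → B ∋ x → B ∋ x′ → x ≢ x′ → R x x′ →
      (∀ {z} → A ∋ z → adj G x z ≡ true × c x z ≢ c a a′ × c x z ≢ c b b′) → ⊥
    from big x x′ bx bx′ x≢ xx′ ok = no-rainbow (rainbow-flower {R = R} (addPairs-sym c-sym (adj-flip G)) (addPairs-rainbow c-sym G-rainbow P-inj)
        (proj₁ (proj₂ grown)) (≤-trans (s≤s (s≤s big)) (≤-reflexive (sym (proj₂ (proj₂ grown))))))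
      where
      spoke : ∀ {z} → A ∋ z → R x z
      spoke az = let g₁ , g₂ , g₃ = ok az in inj₂ (g₁ , λ { (here refl) → g₂ ; (there (here refl)) → g₃ })
      x∉ : x ∉ x′ ∷ a ∷ a′ ∷ flat L
      x∉ (here q) = x≢ q
      x∉ (there q) = dis x (fresh-inA L M q) bx
      blades : All (Blade R x) ((a , a′) ∷ L)
      blades = (spoke a∈ , spoke a′∈ , inj₁ (inj₁ (here refl))) ∷
        All.tabulate (λ {(v , w)} q → let v∈ , w∈ = ∈-flat q in
          spoke (All.lookup (inA L e) v∈) , spoke (All.lookup (inA L e) w∈) , R₀ (proj₁ (restrict⁻ G₀ A {v} {w} (All.lookup e q))))
      grown = greedy {R = R} {x} (7 + 2 * K) (x′ ∷ []) ((a , a′) ∷ L) blades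
        (x∉ ∷ᵘ (λ q → dis x′ (fresh-inA L M q) bx′) ∷ᵘ fresh-list L M)
        ((xx′ , λ zs lz → let z , z∉ , e₁ , e₂ = third bx bx′ zs lz in z , z∉ , R₀ e₁ , R₀ e₂) ∷ [])
        (lin 0 (*-monoʳ-≤ 2 (matching₀ L M)) (ar (length L) K))
        where
        ar : ∀ l K → 1 + 2 * (1 + suc l) + 2 * suc K + 0 ≡ 7 + 2 * K + 2 * l
        ar = solve-∀
    -- The edge of colour c a a′ meets at most one of b and b′.
    centre : K ≤ length L → hit ≡ true ⊎ hit ≡ false → ⊥
    centre big (inj₂ miss) = from big b b′ b∈ b′∈ b≢b′ (inj₁ (inj₁ (there (here refl))))
      (λ {z} az → proj₁ (b-complete az) ,
        (λ eq → true≢false (does⁺ (1 ≤? # (λ z → A z ∧ (c b z == c a a′))) (length≤# {p = λ z → A z ∧ (c b z == c a a′)} {xs = z ∷ []} ([] ∷ []) (∧⁺ az (==⁺ eq) ∷ []))) miss) ,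
        proj₁ (b-good z az))
    centre big (inj₁ h) with z₀ , e₀ ← inhabited {p = λ z → A z ∧ (c b z == c a a′)} (does⁻ (1 ≤? # (λ z → A z ∧ (c b z == c a a′))) h)
      with az₀ , eq₀ ← ∧⁻ {A z₀} e₀
      = from big b′ b b′∈ b∈ (≢-sym b≢b′) (inj₁ (inj₂ (there (here refl))))
        (λ {z} az → proj₂ (b-complete az) , (λ eq → clash az (G-rainbow (proj₂ (b-complete az)) (proj₁ (b-complete az₀)) (trans eq (sym (==⁻ eq₀))))) , proj₂ (b-good z az))
      where
      clash : ∀ {z} → A ∋ z → (b′ ≡ b × z ≡ z₀) ⊎ (b′ ≡ z₀ × z ≡ b) → ⊥
      clash az (inj₁ (q , _)) = b≢b′ (sym q)
      clash az (inj₂ (_ , refl)) = dis b az b∈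

  private
    -- A discarded edge has an end that is not adjacent to `x`. These ends are distinct, so the
    -- number of discarded edges is at most the number of vertices of `A` that `x` misses.
    keep : ∀ x L → IsMatching (restrict G₀ A) L → ∃ λ L′ → IsMatching (restrict G₀ A) L′ × All (λ z → adj G₀ x z ≡ true) (flat L′) ×
      (∀ {z} → z ∈ flat L′ → z ∈ flat L) × length L ≤ length L′ + sumℓ (map (λ z → ⟦ A z ∧ not (adj G₀ x z) ⟧) (flat L))
    keep x [] M = [] , M , [] , id , z≤n
    keep x ((v , w) ∷ L) (e ∷ es , u) with L′ , (es′ , u′) , xs , sub , len ← keep x L (es , Unique-tail (Unique-tail u))
      with _ , av , aw ← restrict⁻ G₀ A {v} {w} e with bool (adj G₀ x v) | bool (adj G₀ x w)
    ... | inj₁ xv | inj₁ xw = (v , w) ∷ L′ , (e ∷ es′ , (λ { (here q) → Unique-head u (here q) ; (there q) → Unique-head u (there (sub q)) }) ∷ᵘ (λ q → Unique-head (Unique-tail u) (sub q)) ∷ᵘ u′) ,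
          xv ∷ xw ∷ xs , (λ { (here q) → here q ; (there (here q)) → there (here q) ; (there (there q)) → there (there (sub q)) }) ,
          s≤s (≤-trans len (+-monoʳ-≤ (length L′) (≤-trans (m≤n+m _ ⟦ A w ∧ not (adj G₀ x w) ⟧) (m≤n+m _ ⟦ A v ∧ not (adj G₀ x v) ⟧))))
    ... | inj₂ xv | _ rewrite av | xv = L′ , (es′ , u′) , xs , there ∘ there ∘ sub ,
          ≤-trans (s≤s (≤-trans len (+-monoʳ-≤ (length L′) (m≤n+m _ ⟦ A w ∧ not (adj G₀ x w) ⟧)))) (≤-reflexive (sym (+-suc (length L′) _)))
    ... | inj₁ _ | inj₂ xw rewrite aw | xw = L′ , (es′ , u′) , xs , there ∘ there ∘ sub ,
          ≤-trans (s≤s len) (≤-trans (≤-reflexive (sym (+-suc (length L′) _))) (+-monoʳ-≤ (length L′) (m≤n+m _ ⟦ A v ∧ not (adj G₀ x v) ⟧)))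

  degree-bound : ∀ {D} L → IsMatching (restrict G₀ A) L → length L + D ≡ K → ∀ x → deg (restrict G₀ B) x ≤ D + missing G₀ B A x
  degree-bound {D} L M eq x with bool (B x)
  ... | inj₂ ¬bx = no-edges {H = restrict G₀ B} (λ j e → true≢false (proj₁ (proj₂ (restrict⁻ G₀ B {x} {j} e))) ¬bx)
  ... | inj₁ bx with L′ , M′ , xL , _ , len ← keep x L M
    = ≤-trans (lin 0 (degree+matching bx L′ M′ xL ⊕ len ⊕ lost ⊕ ≤-reflexive (sym eq)) (ar (deg (restrict G₀ B) x) (length L) (length L′) D K (sumℓ (map (λ z → ⟦ A z ∧ not (adj G₀ x z) ⟧) (flat L))) (misses G₀ A x)))
        (≤-reflexive (cong (D +_) (trans (sym (*-identityˡ _)) (cong (λ b → ⟦ b ⟧ * misses G₀ A x) (sym bx)))))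
    where
    ar : ∀ d l l′ D K s m → d + (K + (l′ + s + (m + (l + D)))) + 0 ≡ D + m + (l′ + d + (l + (s + K)))
    ar = solve-∀
    lost : sumℓ (map (λ z → ⟦ A z ∧ not (adj G₀ x z) ⟧) (flat L)) ≤ misses G₀ A x
    lost = ≤-trans (∑-mem-≥ (flat L) _ (proj₂ M)) (∑-mono (λ z → ≤-trans (*-monoˡ-≤ _ (⟦⟧≤1 (mem (flat L) z))) (≤-reflexive (*-identityˡ _))))

-- Comparison with the extremal number

empty : SimpleGraph n
empty = record { adj = λ _ _ → false ; sym = λ _ _ → refl ; irrefl = λ _ → refl }

drop-colours : ∀ {r} (c : Fin n → Fin n → Fin r) → (∀ i j → c i j ≡ c j i) → SimpleGraph n → (α β : Fin r) → SimpleGraph n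
drop-colours c c-sym G α β = record
  { adj = λ i j → adj G i j ∧ (not (c i j == α) ∧ not (c i j == β))
  ; sym = λ i j → cong₂ (λ g x → g ∧ (not (x == α) ∧ not (x == β))) (adj-sym G i j) (c-sym i j)
  ; irrefl = λ i → cong (_∧ (not (c i i == α) ∧ not (c i i == β))) (adj-irrefl G i) }

module ColourClass {n r : ℕ} (c : Fin n → Fin n → Fin r) (G : SimpleGraph n) (G-rainbow : Rainbow c (Adj G)) (γ : Fin r) where

  class : Fin n → Fin n → Bool
  class i j = adj G i j ∧ (c i j == γ)

  class⁻ : ∀ {i j} → class i j ≡ true → adj G i j ≡ true × c i j ≡ γ
  class⁻ {i} {j} e = let e₁ , e₂ = ∧⁻ {adj G i j} e in e₁ , ==⁻ e₂

  class-rainbow : ∀ {i j i′ j′} → class i j ≡ true → class i′ j′ ≡ true → (i ≡ i′ × j ≡ j′) ⊎ (i ≡ j′ × j ≡ i′)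
  class-rainbow {i} {j} {i′} {j′} e e′ = let g , x = class⁻ {i} {j} e ; g′ , x′ = class⁻ {i′} {j′} e′ in G-rainbow g g′ (trans x (sym x′))

  row : ∀ i → # (class i) ≤ 1
  row i = #≤1 same
    where
    same : ∀ j j′ → class i ∋ j → class i ∋ j′ → j ≡ j′
    same j j′ e e′ with class-rainbow {i} {j} {i} {j′} e e′
    ... | inj₁ (_ , q) = q
    ... | inj₂ (q , q′) = trans q′ q

  -- A rainbow graph has at most one edge of the colour, counted here from both ends.
  total : ∑ (λ i → # (class i)) ≤ 2
  total = ≤-trans (∑-mono pt) rows
    where
    nonempty : Fin n → Bool
    nonempty i = does (1 ≤? # (class i))
    pt : ∀ i → # (class i) ≤ ⟦ nonempty i ⟧
    pt i with bool (nonempty i)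
    ... | inj₁ e = ≤-trans (row i) (≤-reflexive (cong ⟦_⟧ (sym e)))
    ... | inj₂ e = ≤-trans (≤-pred (≰⇒> (λ q → true≢false (does⁺ (1 ≤? # (class i)) q) e))) z≤n
    contra : (∃ λ xs → length xs ≡ 3 × Unique xs × All (nonempty ∋_) xs) → ⊥
    contra (x ∷ y ∷ z ∷ [] , refl , ((x≢y ∷ x≢z ∷ []) ∷ (y≢z ∷ []) ∷ _) , (ex ∷ ey ∷ ez ∷ []))
      with x′ , fx ← inhabited (does⁻ (1 ≤? # (class x)) ex) | y′ , fy ← inhabited (does⁻ (1 ≤? # (class y)) ey)
         | z′ , fz ← inhabited (does⁻ (1 ≤? # (class z)) ez)
      with class-rainbow {x} {x′} {y} {y′} fx fy | class-rainbow {x} {x′} {z} {z′} fx fz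
    ... | inj₁ (q , _) | _ = x≢y q
    ... | inj₂ _ | inj₁ (q , _) = x≢z q
    ... | inj₂ (_ , q) | inj₂ (_ , q′) = y≢z (trans (sym q) q′)
    rows : # nonempty ≤ 2
    rows = ≮⇒≥ (λ big → contra (choose 3 big))

-- `y`, `z` are the matching numbers of the parts, `D`, `D′` their distances from `K`, `a`, `b` the
-- doubled inner edges, `M` the missing edges and `ℓ` the doubled discarded edges. If `2 * y < K`,
-- then up to missing edges a cover by `2 * y` vertices of degree `D′` has at least `D′` edges fewer
-- than the `D′` stars that complete the other part; likewise for `z`. Otherwise the truncated
-- estimates add up to `2 * (K * K)` minus `2 * (D * D′)`. The hypotheses on `ℓ` are the margins of
-- the three cases.
extremal-arithmetic : ∀ {K y z D D′ a b M e t ℓ} → y + D ≡ K → z + D′ ≡ K →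
  (2 * y < K → a ≤ 2 * (2 * y * D′ + M)) → (2 * z < K → b ≤ 2 * (2 * z * D + M)) →
  (2 * D ≤ K → 2 * D′ ≤ K → a ≤ y * (K + D′) + M × b ≤ z * (K + D) + M) →
  b + 2 * (K * D′) + 2 * t ≤ 2 * e → a + 2 * (K * D) + 2 * t ≤ 2 * e → 2 * (K * K) + 2 * t ≤ 2 * e →
  2 * e + 4 + 2 * M ≤ a + b + ℓ + 2 * t →
  ℓ < 4 + 2 * D → ℓ < 4 + 2 * D′ → ℓ < 4 + 2 * (D * D′) → ⊥
extremal-arithmetic {K} {y} {z} {D} {D′} {a} {b} {M} {e} {t} {ℓ} y+D z+D′ ay bz both fb fa fK main ℓD ℓD′ ℓDD′
  with 2 * y <? K | 2 * z <? K
... | yes 2y<K | _ = 1+n≰n (lin {1} {0} 0 (ay 2y<K ⊕ fb ⊕ main ⊕ ℓD′ ⊕ *-monoʳ-≤ 2 (*-monoˡ-≤ D′ 2y<K)) (ar y D′ K a b M e t ℓ))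
  where
  ar : ∀ y D′ K a b M e t ℓ → 1 + (2 * (2 * y * D′ + M) + (2 * e + (a + b + ℓ + 2 * t + (4 + 2 * D′ + 2 * (K * D′))))) + 0 ≡
    0 + (a + (b + 2 * (K * D′) + 2 * t + (2 * e + 4 + 2 * M + (suc ℓ + 2 * (suc (2 * y) * D′)))))
  ar = solve-∀
... | no _ | yes 2z<K = 1+n≰n (lin {1} {0} 0 (bz 2z<K ⊕ fa ⊕ main ⊕ ℓD ⊕ *-monoʳ-≤ 2 (*-monoˡ-≤ D 2z<K)) (ar z D K a b M e t ℓ))
  where
  ar : ∀ z D K a b M e t ℓ → 1 + (2 * (2 * z * D + M) + (2 * e + (a + b + ℓ + 2 * t + (4 + 2 * D + 2 * (K * D))))) + 0 ≡
    0 + (b + (a + 2 * (K * D) + 2 * t + (2 * e + 4 + 2 * M + (suc ℓ + 2 * (suc (2 * z) * D)))))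
  ar = solve-∀
... | no ¬y | no ¬z = 1+n≰n (lin {1} {0} 0 (proj₁ ab ⊕ proj₂ ab ⊕ fK ⊕ main ⊕ ℓDD′ ⊕ ≤-reflexive identity) (ar (y * (K + D′)) (z * (K + D)) (D * D′) (K * K) a b M e t ℓ))
  where
  half : ∀ {x d} → x + d ≡ K → ¬ 2 * x < K → 2 * d ≤ K
  half {x} {d} refl ≮ = lin 0 (≮⇒≥ ≮) (ar′ x d)
    where
    ar′ : ∀ x d → 2 * d + 2 * x + 0 ≡ x + d + (x + d)
    ar′ = solve-∀
  ab = both (half {y} {D} y+D ¬y) (half {z} {D′} z+D′ ¬z)
  identity : y * (K + D′) + z * (K + D) + 2 * (D * D′) ≡ 2 * (K * K)
  identity = begin
    y * (K + D′) + z * (K + D) + 2 * (D * D′) ≡⟨ ar₁ y z D D′ K ⟩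
    (y * K + (y + D) * D′) + (z * K + (z + D′) * D) ≡⟨ cong₂ (λ u v → (y * K + u * D′) + (z * K + v * D)) y+D z+D′ ⟩
    (y * K + K * D′) + (z * K + K * D) ≡⟨ ar₂ y z D D′ K ⟩
    (y + D) * K + (z + D′) * K ≡⟨ cong₂ (λ u v → u * K + v * K) y+D z+D′ ⟩
    K * K + K * K ≡⟨ cong (K * K +_) (sym (+-identityʳ (K * K))) ⟩
    2 * (K * K) ∎
    where
    open ≡-Reasoning
    ar₁ : ∀ y z D D′ K → y * (K + D′) + z * (K + D) + 2 * (D * D′) ≡ (y * K + (y + D) * D′) + (z * K + (z + D′) * D)
    ar₁ = solve-∀
    ar₂ : ∀ y z D D′ K → (y * K + K * D′) + (z * K + K * D) ≡ (y + D) * K + (z + D′) * K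
    ar₂ = solve-∀
  ar : ∀ u v d k a b M e t ℓ → 1 + (u + M + (v + M + (2 * e + (a + b + ℓ + 2 * t + (4 + 2 * d + 2 * k))))) + 0 ≡
    0 + (a + (b + (2 * k + 2 * t + (2 * e + 4 + 2 * M + (suc ℓ + (u + v + 2 * d))))))
  ar = solve-∀

truncated-sum : (H : SimpleGraph n) {y K D : ℕ} {ms : Fin n → ℕ} → ν≤ H y → (∀ i → deg H i ≤ K) → 2 * D ≤ K →
  (∀ i → deg H i ≤ D + ms i) → edges₂ H ≤ y * (K + D) + ∑ ms
truncated-sum H {y} {K} {D} {ms} ν Δ 2D≤K h = begin
  ∑ (deg H) ≤⟨ ∑-mono (λ i → pt (deg H i) (h i)) ⟩
  ∑ (λ i → deg H i ⊓ D + ms i) ≡⟨ ∑-+ _ _ ⟩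
  ∑ (λ i → deg H i ⊓ D) + ∑ ms ≤⟨ +-monoˡ-≤ (∑ ms) (truncated-degree-bound y H ν Δ 2D≤K) ⟩
  y * (K + D) + ∑ ms ∎
  where
  open ≤-Reasoning
  pt : ∀ d {mi} → d ≤ D + mi → d ≤ d ⊓ D + mi
  pt d {mi} le with ≤-total d D
  ... | inj₁ d≤D = ≤-trans (≤-reflexive (sym (m≤n⇒m⊓n≡m d≤D))) (m≤m+n _ mi)
  ... | inj₂ D≤d = ≤-trans le (≤-reflexive (cong (_+ mi) (sym (m≥n⇒m⊓n≡n D≤d))))

module Contradiction {n r : ℕ} (c : Fin n → Fin n → Fin r) (c-sym : ∀ i j → c i j ≡ c j i)
  (G : SimpleGraph n) (G-rainbow : Rainbow c (Adj G)) (K : ℕ) (1≤K : 1 ≤ K)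
  (no-rainbow : ¬ HasRainbow c (FriendEdge (suc (suc K))))
  (e : ℕ) (ub : ∀ (H : SimpleGraph n) → ¬ Contains H (FriendEdge (suc K)) → edgeCount H ≤ e)
  (size : 4 * K * suc K + suc K ≤ n)
  (U A B : Fin n → Bool) (St : Structure G (suc K) U A B)
  (excess : 2 * τ (# U) + (2 * (e + 2) + 2 * n) ≤ edges₂ (restrict G U) + 2 * # U + 2 * τ n) where

  open Structure St
  open Partition parts

  -- This comes from `K` stars alone, adjoined to the empty graph.
  fK : 2 * (K * K) + 2 * τ n ≤ 2 * e
  fK = ≤-trans (+-monoˡ-≤ (2 * τ n) (m≤n+m (2 * (K * K)) (edges₂ {n} empty)))
    (ex-lower-bound {n} {0} {K} empty 1≤K size refl (λ { [] _ → z≤n ; (_ ∷ _) (() ∷ _ , _) }) (λ i → no-edges {H = empty} {i} (λ j ())) ub)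

  AB≤τ : # A * # B ≤ τ (# U)
  AB≤τ = ≤-trans (*≤τ (# A) (# B)) (≤-reflexive (cong τ (#-partition parts)))

  module FA = Far c c-sym G G-rainbow (suc K) no-rainbow U A B St
  module FB = Far c c-sym G G-rainbow (suc K) no-rainbow U B A (flip-structure St)

  -- More missing edges would outweigh the inner edges, at most `2 * (suc K * suc K)` in each part,
  -- and leave no excess.
  missing-bound : ∀ {M} → cross G A B + M ≡ # A * # B → M ≤ 4 * (suc K * suc K)
  missing-bound {M} eq = *-cancelˡ-≤ 2 (lin (2 * (K * K) + 4)
      (excess ⊕ edges₂-partition G parts ⊕ FA.inner-edges ⊕ FB.inner-edges ⊕ fK ⊕ *-monoʳ-≤ 2 (#≤n U) ⊕ *-monoʳ-≤ 2 (≤-trans (≤-reflexive eq) AB≤τ))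
      (ar M e n K (τ (# U)) (τ n) (# U) (edges₂ (restrict G U)) (edges₂ (restrict G A)) (edges₂ (restrict G B)) (cross G A B)))
    where
    ar : ∀ M e n K t T N E a b x → 2 * M + (E + 2 * N + 2 * T + (a + b + 2 * x + (4 * (suc K * suc K) + (4 * (suc K * suc K) + (2 * e + (2 * n + 2 * t)))))) + (2 * (K * K) + 4) ≡
      2 * (4 * (suc K * suc K)) + (2 * t + (2 * (e + 2) + 2 * n) + (E + (a + (b + (2 * (K * K) + 2 * T + (2 * N + 2 * (x + M)))))))
    ar = solve-∀

  cross-flip : (H : SimpleGraph n) → cross H B A ≡ cross H A B
  cross-flip H = trans (∑-swap _) (∑-cong (λ i → ∑-cong (λ j → cong ⟦_⟧ (cong₂ _∧_ (adj-sym H j i) (∧-comm (B j) (A i))))))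

  manyA : 2 * suc (suc K) ≤ # FA.far
  manyA = FA.far-many (missing-bound (cross+missing G A B))

  manyB : 2 * suc (suc K) ≤ # FB.far
  manyB = FB.far-many (missing-bound (trans (cong (_+ ∑ (missing G B A)) (sym (cross-flip G))) (trans (cross+missing G B A) (*-comm (# B) (# A)))))

  enough : ∀ {m} → 2 * suc (suc K) ≤ m → suc (suc (suc K)) ≤ m
  enough le = ≤-trans (lin (suc K) (≤-refl {0}) (ar K)) le
    where
    ar : ∀ K → suc (suc (suc K)) + 0 + suc K ≡ 2 * suc (suc K) + 0
    ar = solve-∀

  module Pairs (a a′ b b′ : Fin n) (aa : FarPair c G A B a a′) (bb : FarPair c G B A b b′) where

    α β : Fin r
    α = c a a′
    β = c b b′
    G₀ = drop-colours c c-sym G α β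

    G₀⊆ : ∀ {i j} → adj G₀ i j ≡ true → adj G i j ≡ true × c i j ≢ α × c i j ≢ β
    G₀⊆ {i} {j} g = let g₁ , g₂ = ∧⁻ {adj G i j} g ; g₃ , g₄ = ∧⁻ {not (c i j == α)} g₂ in
      g₁ , (λ q → true≢false (==⁺ q) (not⁻ g₃)) , (λ q → true≢false (==⁺ q) (not⁻ g₄))

    G₀⊆′ : ∀ {i j} → adj G₀ i j ≡ true → adj G i j ≡ true × c i j ≢ β × c i j ≢ α
    G₀⊆′ g = let g₁ , g₂ , g₃ = G₀⊆ g in g₁ , g₃ , g₂

    G₀⊇ : ∀ {i j} → adj G i j ≡ true → c i j ≢ α → c i j ≢ β → adj G₀ i j ≡ true
    G₀⊇ g p q = ∧⁺ g (∧⁺ (not⁺ (¬true⇒false (p ∘ ==⁻))) (not⁺ (¬true⇒false (q ∘ ==⁻))))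

    module Cα = ColourClass c G G-rainbow α
    module Cβ = ColourClass c G G-rainbow β

    lost : ∀ {i j} → adj G i j ≡ true → adj G₀ i j ≡ true ⊎ (Cα.class i j ≡ true ⊎ Cβ.class i j ≡ true)
    lost {i} {j} g with bool (c i j == α) | bool (c i j == β)
    ... | inj₁ q | _ = inj₂ (inj₁ (∧⁺ g q))
    ... | inj₂ _ | inj₁ q = inj₂ (inj₂ (∧⁺ g q))
    ... | inj₂ q | inj₂ q′ = inj₁ (∧⁺ g (∧⁺ (not⁺ q) (not⁺ q′)))

    -- Each discarded colour removes at most one edge at `v`, which raises `3 + 2 * K` to
    -- `5 + 2 * K`.
    miss₀ : ∀ X v → misses G X v ≤ 1 + 2 * suc K → misses G₀ X v ≤ 5 + 2 * K
    miss₀ X v le = lin 0 (#-cover {p = λ w → X w ∧ not (adj G₀ v w)} {q = λ w → X w ∧ not (adj G v w)} {r = αβ} sp ⊕ #-cover {p = αβ} (λ w → ∨⁻) ⊕ Cα.row v ⊕ Cβ.row v ⊕ le)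
        (ar (misses G₀ X v) (misses G X v) (# αβ) (# (Cα.class v)) (# (Cβ.class v)) K)
      where
      αβ : Fin n → Bool
      αβ w = Cα.class v w ∨ Cβ.class v w
      ar : ∀ m₀ m s x y K → m₀ + (m + s + (x + y + (1 + (1 + (1 + 2 * suc K))))) + 0 ≡ 5 + 2 * K + (m₀ + (s + (x + (y + m))))
      ar = solve-∀
      sp : ∀ w → X w ∧ not (adj G₀ v w) ≡ true → X w ∧ not (adj G v w) ≡ true ⊎ αβ w ≡ true
      sp w q with xw , ¬g ← ∧⁻ {X w} q with bool (adj G v w)
      ... | inj₂ g = inj₁ (∧⁺ xw (not⁺ g))
      ... | inj₁ g with lost {v} {w} g
      ... | inj₁ g₀ = ⊥-elim (true≢false g₀ (not⁻ ¬g))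
      ... | inj₂ (inj₁ x) = inj₂ (∨⁺ˡ x)
      ... | inj₂ (inj₂ x) = inj₂ (∨⁺ʳ {Cα.class v w} x)

    edge-loss₂ : edges₂ (restrict G U) ≤ edges₂ (restrict G₀ U) + 4
    edge-loss₂ = ≤-trans (∑-mono (λ i → ≤-trans (#-cover {q = adj (restrict G₀ U) i} {r = αβ i} (sp i)) (+-monoʳ-≤ (deg (restrict G₀ U) i) (#-cover {q = Cα.class i} {r = Cβ.class i} (λ w → ∨⁻)))))
      (≤-trans (≤-reflexive (trans (∑-+ _ _) (cong (edges₂ (restrict G₀ U) +_) (∑-+ _ _)))) (+-monoʳ-≤ (edges₂ (restrict G₀ U)) (Cα.total ⊕ Cβ.total)))
      where
      αβ : Fin n → Fin n → Bool
      αβ i j = Cα.class i j ∨ Cβ.class i j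
      sp : ∀ i j → adj (restrict G U) i j ≡ true → adj (restrict G₀ U) i j ≡ true ⊎ αβ i j ≡ true
      sp i j g with g₁ , ui , uj ← restrict⁻ G U {i} {j} g with lost {i} {j} g₁
      ... | inj₁ g₀ = inj₁ (∧⁺ g₀ (∧⁺ ui uj))
      ... | inj₂ (inj₁ x) = inj₂ (∨⁺ˡ x)
      ... | inj₂ (inj₂ x) = inj₂ (∨⁺ʳ {Cα.class i j} x)

    edge-loss₁ : α ≡ β → edges₂ (restrict G U) ≤ edges₂ (restrict G₀ U) + 2
    edge-loss₁ α≡β = ≤-trans (∑-mono (λ i → #-cover {q = adj (restrict G₀ U) i} {r = Cα.class i} (sp i)))
      (≤-trans (≤-reflexive (∑-+ _ _)) (+-monoʳ-≤ (edges₂ (restrict G₀ U)) Cα.total))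
      where
      sp : ∀ i j → adj (restrict G U) i j ≡ true → adj (restrict G₀ U) i j ≡ true ⊎ Cα.class i j ≡ true
      sp i j g with g₁ , ui , uj ← restrict⁻ G U {i} {j} g with lost {i} {j} g₁
      ... | inj₁ g₀ = inj₁ (∧⁺ g₀ (∧⁺ ui uj))
      ... | inj₂ (inj₁ x) = inj₂ x
      ... | inj₂ (inj₂ x) = let g , q = Cβ.class⁻ {i} {j} x in inj₂ (∧⁺ g (==⁺ (trans q (sym α≡β))))

    module SA = Swap c c-sym G G-rainbow K no-rainbow U A B St a a′ b b′ aa bb G₀ G₀⊆ G₀⊇ (λ v bv → miss₀ A v (missB v bv))
    module SB = Swap c c-sym G G-rainbow K no-rainbow U B A (flip-structure St) b b′ a a′ bb aa G₀
      G₀⊆′ (λ g p q → G₀⊇ g q p) (λ v av → miss₀ B v (missA v av))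

    conclude : ∀ {ℓ D D′} LA LB → IsMatching (restrict G₀ A) LA → ν≤ (restrict G₀ A) (length LA) →
      IsMatching (restrict G₀ B) LB → ν≤ (restrict G₀ B) (length LB) →
      length LA + D ≡ K → length LB + D′ ≡ K →
      edges₂ (restrict G U) ≤ edges₂ (restrict G₀ U) + ℓ →
      ℓ < 4 + 2 * D → ℓ < 4 + 2 * D′ → ℓ < 4 + 2 * (D * D′) → ⊥
    conclude {ℓ} {D} {D′} LA LB MA νA MB νB y+D z+D′ loss = extremal-arithmetic {K} {length LA} {length LB} {D} {D′} {edges₂ GA} {edges₂ GB} {M} {e} {τ n} {ℓ} y+D z+D′
        (λ _ → edges₂-cover-bound GA νA dA) (λ _ → subst (λ m → edges₂ GB ≤ 2 * (2 * length LB * D + m)) M≡ (edges₂-cover-bound GB νB dB))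
        (λ 2D 2D′ → truncated-sum GA νA ΔA 2D′ dA , subst (λ m → edges₂ GB ≤ length LB * (K + D) + m) M≡ (truncated-sum GB νB ΔB 2D dB))
        (ex-lower-bound GB 1≤K size z+D′ νB ΔB ub) (ex-lower-bound GA 1≤K size y+D νA ΔA ub) fK main
      where
      GA = restrict G₀ A
      GB = restrict G₀ B
      M = ∑ (missing G₀ A B)
      M≡ : ∑ (missing G₀ B A) ≡ M
      M≡ = +-cancelˡ-≡ (cross G₀ A B) _ _ (trans (cong (_+ ∑ (missing G₀ B A)) (sym (cross-flip G₀)))
        (trans (cross+missing G₀ B A) (trans (*-comm (# B) (# A)) (sym (cross+missing G₀ A B)))))
      dA : ∀ i → deg GA i ≤ D′ + missing G₀ A B i
      dA = SB.degree-bound LB MB z+D′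
      dB : ∀ i → deg GB i ≤ D + missing G₀ B A i
      dB = SA.degree-bound LA MA y+D
      ΔA : ∀ i → deg GA i ≤ K
      ΔA i with bool (A i)
      -- Already the empty matching in the exchange argument bounds the inner degree by `K`.
      ... | inj₁ ai = SB.degree+matching ai [] ([] , []) []
      ... | inj₂ ¬ai = no-edges {H = GA} (λ j g → true≢false (proj₁ (proj₂ (restrict⁻ G₀ A {i} {j} g))) ¬ai)
      ΔB : ∀ i → deg GB i ≤ K
      ΔB i with bool (B i)
      ... | inj₁ bi = SA.degree+matching bi [] ([] , []) []
      ... | inj₂ ¬bi = no-edges {H = GB} (λ j g → true≢false (proj₁ (proj₂ (restrict⁻ G₀ B {i} {j} g))) ¬bi)
      main : 2 * e + 4 + 2 * M ≤ edges₂ GA + edges₂ GB + ℓ + 2 * τ n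
      -- Deletion has cost nothing: by `# U ≤ n` the term `2 * # U` cancels against `2 * n`.
      main = lin 0 (excess ⊕ loss ⊕ edges₂-partition G₀ parts ⊕ *-monoʳ-≤ 2 (≤-trans (≤-reflexive (cross+missing G₀ A B)) AB≤τ) ⊕ *-monoʳ-≤ 2 (#≤n U))
        (ar e M ℓ n (τ (# U)) (τ n) (# U) (edges₂ (restrict G U)) (edges₂ (restrict G₀ U)) (edges₂ GA) (edges₂ GB) (cross G₀ A B))
        where
        ar : ∀ e M ℓ n t T N E E₀ a b x → 2 * e + 4 + 2 * M + (E + 2 * N + 2 * T + (E₀ + ℓ + (a + b + 2 * x + (2 * t + 2 * n)))) + 0 ≡
          a + b + ℓ + 2 * T + (2 * t + (2 * (e + 2) + 2 * n) + (E + (E₀ + (2 * (x + M) + 2 * N))))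
        ar = solve-∀

    -- With `α ≡ β` at most one edge is discarded, and one of the two surplus edges remains. With
    -- `α ≢ β` both may go, but then `D` and `D′` are positive by `matching<K`, which gives a strict
    -- margin in all cases of `extremal-arithmetic`.
    contradiction : ⊥
    contradiction with α ≟ β
    ... | yes α≡β = max-matching (restrict G₀ A) νA λ (LA , MA , mA) → max-matching (restrict G₀ B) νB λ (LB , MB , mB) →
        conclude {2} LA LB MA mA MB mB (m+[n∸m]≡n (νA LA MA)) (m+[n∸m]≡n (νB LB MB)) (edge-loss₁ α≡β) 3≤ 3≤ 3≤
      where
      νA = SA.matching≤K α≡β
      νB = SB.matching≤K (sym α≡β)
      3≤ : ∀ {x} → 2 < 4 + x
      3≤ = s≤s (s≤s (s≤s z≤n))
    ... | no α≢β = max-matching (restrict G₀ A) (λ L M → ≤-trans (n≤1+n _) (νA L M)) λ (LA , MA , mA) → max-matching (restrict G₀ B) (λ L M → ≤-trans (n≤1+n _) (νB L M)) λ (LB , MB , mB) →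
        conclude {4} {K ∸ length LA} {K ∸ length LB} LA LB MA mA MB mB (m+[n∸m]≡n (≤-trans (n≤1+n _) (νA LA MA))) (m+[n∸m]≡n (≤-trans (n≤1+n _) (νB LB MB))) edge-loss₂
          (5≤ (m<n⇒0<n∸m (νA LA MA))) (5≤ (m<n⇒0<n∸m (νB LB MB))) (5≤ (*-mono-≤ (m<n⇒0<n∸m (νA LA MA)) (m<n⇒0<n∸m (νB LB MB))))
      where
      νA = SA.matching<K α≢β
      νB = SB.matching<K (≢-sym α≢β)
      5≤ : ∀ {x} → 1 ≤ x → 4 < 4 + 2 * x
      5≤ {x} le = +-monoʳ-≤ 4 (≤-trans le (m≤m+n x _))

  contradiction : ⊥
  contradiction =
    let a , a′ , a≢ , fa , fa′ , ga = FA.good-pair manyA FB.far FB.far⊆ FB.far-complete (enough manyB)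
        b , b′ , b≢ , fb , fb′ , gb = FB.good-pair manyB FA.far FA.far⊆ FA.far-complete (enough manyA)
    in Pairs.contradiction a a′ b b′
      (record { a∈ = FA.far⊆ fa ; a′∈ = FA.far⊆ fa′ ; a≢a′ = a≢ ; complete = λ w → FA.far-complete fa w , FA.far-complete fa′ w
              ; untouched = FA.far-untouched fa , FA.far-untouched fa′ ; good = ga })
      (record { a∈ = FB.far⊆ fb ; a′∈ = FB.far⊆ fb′ ; a≢a′ = b≢ ; complete = λ w → FB.far-complete fb w , FB.far-complete fb′ w
              ; untouched = FB.far-untouched fb , FB.far-untouched fb′ ; good = gb })

-- Searching finite types

-- Predicates must respect the relation, because functions are enumerated only up to pointwise
-- equality.
Searchable : (X : Set) → (X → X → Set) → Set₁
Searchable X _≈_ = (P : X → Set) → (∀ {x y} → x ≈ y → P x → P y) → (∀ x → Dec (P x)) → Dec (Σ X P)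

search-Fin : Searchable (Fin n) _≡_
search-Fin P _ P? = any? P?

search-Bool : Searchable Bool _≡_
search-Bool P _ P? with P? true | P? false
... | yes p | _ = yes (true , p)
... | no _ | yes p = yes (false , p)
... | no ¬t | no ¬f = no λ { (true , p) → ¬t p ; (false , p) → ¬f p }

search-→ : {X : Set} {_≈_ : X → X → Set} → (∀ {x} → x ≈ x) → Searchable X _≈_ → ∀ m →
  Searchable (Fin m → X) (λ f g → ∀ i → f i ≈ g i)
search-→ ≈-refl search zero P resp P? with P? (λ ())
... | yes p = yes ((λ ()) , p)
... | no ¬p = no λ (f , p) → ¬p (resp (λ ()) p)
search-→ {X} {_≈_} ≈-refl search (suc m) P resp P? = map′
  (λ (x , f , p) → cons x f , p)
  (λ (f , p) → f zero , (f ∘ suc) , resp (λ { zero → ≈-refl ; (suc i) → ≈-refl }) p)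
  (search (λ x → ∃ λ f → P (cons x f))
    (λ x≈y (f , p) → f , resp (λ { zero → x≈y ; (suc i) → ≈-refl }) p)
    (λ x → search-→ {X} {_≈_} ≈-refl search m (P ∘ cons x) (λ f≈g → resp (λ { zero → ≈-refl ; (suc i) → f≈g i })) (P? ∘ cons x)))
  where
  cons : X → (Fin m → X) → Fin (suc m) → X
  cons x f zero = x
  cons x f (suc i) = f i

half-odd : ∀ i → ⌊ suc (2 * i) /2⌋ ≡ i
half-odd i = trans (cong (λ z → ⌊ suc (i + z) /2⌋) (+-identityʳ i)) (sym (n≡⌈n+n/2⌉ i))

friendEdge? : ∀ k a b → Dec (FriendEdge k a b)
friendEdge? k a b = dec (toℕ a) (toℕ b)
  where
  -- The existential is decidable because `i` can only be `⌊ a /2⌋`.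
  rim? : ∀ a b → Dec (∃ λ i → a ≡ suc (2 * i) × b ≡ suc (suc (2 * i)))
  rim? a b = map′ (λ (p , q) → ⌊ a /2⌋ , p , q)
    (λ { (i , refl , refl) → let e = half-odd i in cong (λ z → suc (2 * z)) (sym e) , cong (λ z → suc (suc (2 * z))) (sym e) })
    ((a ℕ.≟ suc (2 * ⌊ a /2⌋)) ×-dec (b ℕ.≟ suc (suc (2 * ⌊ a /2⌋))))
  dec : ∀ a b → Dec (FriendEdgeℕ a b)
  dec a b = ((a ℕ.≟ 0) ×-dec ¬? (b ℕ.≟ 0)) ⊎-dec (((b ℕ.≟ 0) ×-dec ¬? (a ℕ.≟ 0)) ⊎-dec
    map′ [ (λ (i , p) → i , inj₁ p) , (λ (i , p) → i , inj₂ p) ]′ (λ { (i , inj₁ p) → inj₁ (i , p) ; (i , inj₂ p) → inj₂ (i , p) })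
      (rim? a b ⊎-dec rim? b a))

injective? : (φ : Fin m → Fin n) → Dec (Injective _≡_ _≡_ φ)
injective? φ = map′ (λ h {i} {j} → h i j) (λ h i j → h) (all? λ i → all? λ j → (φ i ≟ φ j) →-dec (i ≟ j))

hasRainbow? : ∀ {r} (c : Fin n → Fin n → Fin r) k → Dec (HasRainbow c (FriendEdge k))
hasRainbow? c k = search-→ refl search-Fin (fsize k) _
  (λ {φ} {ψ} eq (inj , rb) → (λ {i} {j} e → inj (trans (eq i) (trans e (sym (eq j))))) ,
    λ a b a′ b′ E E′ e → rb a b a′ b′ E E′ (trans (cong₂ c (eq a) (eq b)) (trans e (sym (cong₂ c (eq a′) (eq b′))))))
  (λ φ → injective? φ ×-dec all? λ a → all? λ b → all? λ a′ → all? λ b′ →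
    friendEdge? k a b →-dec (friendEdge? k a′ b′ →-dec ((c (φ a) (φ b) ≟ c (φ a′) (φ b′)) →-dec
      (((a ≟ a′) ×-dec (b ≟ b′)) ⊎-dec ((a ≟ b′) ×-dec (b ≟ a′))))))

contains? : (G : SimpleGraph n) (k : ℕ) → Dec (Contains G (FriendEdge k))
contains? G k = search-→ refl search-Fin (fsize k) _
  (λ {φ} {ψ} eq (inj , ed) → (λ {i} {j} e → inj (trans (eq i) (trans e (sym (eq j))))) ,
    λ a b E → trans (sym (cong₂ (adj G) (eq a) (eq b))) (ed a b E))
  (λ φ → injective? φ ×-dec all? λ a → all? λ b → friendEdge? k a b →-dec (adj G (φ a) (φ b) Bool.≟ true))

edgeCount-cong : (G H : SimpleGraph n) → (∀ i j → adj G i j ≡ adj H i j) → edgeCount G ≡ edgeCount H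
edgeCount-cong G H eq = trans (edgeCount-∑ G) (trans (∑-cong (λ i → ∑-cong (λ j → cong (λ b → ⟦ b ∧ (toℕ i <ᵇ toℕ j) ⟧) (eq i j)))) (sym (edgeCount-∑ H)))

contains-cong : ∀ {k} (G H : SimpleGraph n) → (∀ i j → adj G i j ≡ adj H i j) → Contains G (FriendEdge k) → Contains H (FriendEdge k)
contains-cong G H eq (φ , inj , ed) = φ , inj , λ a b E → trans (sym (eq _ _)) (ed a b E)

FreeWith : ∀ n → ℕ → ℕ → Set
FreeWith n k e = Σ (SimpleGraph n) λ G → edgeCount G ≡ e × ¬ Contains G (FriendEdge k)

freeWith? : ∀ n k e → Dec (FreeWith n k e)
freeWith? n k e = map′ (λ (f , G , _ , p) → G , p) (λ (G , p) → adj G , G , (λ _ _ → refl) , p)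
  (search-→ (λ _ → refl) (search-→ refl search-Bool n) n P (λ eq (G , eq′ , p) → G , (λ i j → trans (eq′ i j) (eq i j)) , p) P?)
  where
  -- Asking for a graph that agrees with `f` pointwise, with its own proofs of symmetry and
  -- irreflexivity, makes the predicate respect pointwise equality.
  P : (Fin n → Fin n → Bool) → Set
  P f = Σ (SimpleGraph n) λ G → (∀ i j → adj G i j ≡ f i j) × edgeCount G ≡ e × ¬ Contains G (FriendEdge k)
  P? : ∀ f → Dec (P f)
  P? f with all? (λ i → all? λ j → f i j Bool.≟ f j i) | all? (λ i → f i i Bool.≟ false)
  ... | no ¬s | _ = no λ (G , eq , _) → ¬s (λ i j → trans (sym (eq i j)) (trans (adj-sym G i j) (eq j i)))
  ... | yes _ | no ¬i = no λ (G , eq , _) → ¬i (λ i → trans (sym (eq i i)) (adj-irrefl G i))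
  ... | yes s | yes ir = map′ (λ p → G , (λ _ _ → refl) , p)
      (λ (H , eq , ec , free) → trans (edgeCount-cong G H (λ i j → sym (eq i j))) ec , λ cont → free (contains-cong {k = k} G H (λ i j → sym (eq i j)) cont))
      ((edgeCount G ℕ.≟ e) ×-dec ¬? (contains? G k))
    where
    G : SimpleGraph n
    G = record { adj = f ; sym = s ; irrefl = ir }

maximum : (Q : ℕ → Set) → (∀ e → Dec (Q e)) → ∀ b → (∀ e → Q e → e ≤ b) → ∃ Q → ∃ λ e → Q e × (∀ e′ → Q e′ → e′ ≤ e)
maximum Q Q? b ub (e₀ , q₀) with Q? b
... | yes q = b , q , ub
maximum Q Q? zero ub (e₀ , q₀) | no ¬q = ⊥-elim (¬q (subst Q (n≤0⇒n≡0 (ub e₀ q₀)) q₀))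
maximum Q Q? (suc b) ub ex | no ¬q = maximum Q Q? b (λ e q → ≤-pred (≤∧≢⇒< (ub e q) (λ { refl → ¬q q }))) ex

-- The value `e` is part of the claim and must be exhibited: it is found by searching down from
-- `n * n`, and the search succeeds because the empty graph contains no `F_{K+1}`.
ex-exists : ∀ n K → ∃ λ e → IsEx n (suc K) e
ex-exists n K =
  let e , q , mx = maximum (FreeWith n (suc K)) (freeWith? n (suc K)) (n * n) bound (edgeCount {n} empty , empty , refl , free)
  in e , q , λ G free → mx (edgeCount G) (G , refl , free)
  where
  bound : ∀ e → FreeWith n (suc K) e → e ≤ n * n
  bound e (G , refl , _) = begin
    edgeCount G ≤⟨ m≤m+n (edgeCount G) _ ⟩
    2 * edgeCount G ≡⟨ sym (2*edgeCount G) ⟩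
    edges₂ G ≤⟨ ∑-mono (λ i → #≤n (adj G i)) ⟩
    ∑ (λ _ → n) ≡⟨ ∑-const n ⟩
    n * n ∎
    where open ≤-Reasoning
  free : ¬ Contains empty (FriendEdge (suc K))
  free cont with embedding⇒flower {R = Adj (empty {n})} {k = suc K} cont
  ... | x , [] , _ , ()
  ... | x , _ ∷ _ , ((() , _) ∷ _ , _) , _

-- A rainbow graph with one edge of each colour

module Representatives {n r : ℕ} (c : Fin n → Fin n → Fin r) (c-sym : ∀ i j → c i j ≡ c j i)
  (onto : ∀ x → ∃ λ i → ∃ λ j → i ≢ j × c i j ≡ x) where

  I J : Fin r → Fin n
  I x = proj₁ (onto x)
  J x = proj₁ (proj₂ (onto x))

  I≢J : ∀ x → I x ≢ J x
  I≢J x = proj₁ (proj₂ (proj₂ (onto x)))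

  colour : ∀ x → c (I x) (J x) ≡ x
  colour x = proj₂ (proj₂ (proj₂ (onto x)))

  is : Fin r → Fin n → Fin n → Bool
  is x i j = (i == I x) ∧ (j == J x)

  is⁻ : ∀ {x i j} → is x i j ≡ true → i ≡ I x × j ≡ J x
  is⁻ {x} {i} {j} e = let p , q = ∧⁻ {i == I x} e in ==⁻ p , ==⁻ q

  rep : Fin n → Fin n → Bool
  rep i j = is (c i j) i j ∨ is (c i j) j i

  rep⁻ : ∀ {i j} → rep i j ≡ true → (i ≡ I (c i j) × j ≡ J (c i j)) ⊎ (j ≡ I (c i j) × i ≡ J (c i j))
  rep⁻ {i} {j} e = Sum.map (is⁻ {c i j}) (is⁻ {c i j}) (∨⁻ {is (c i j) i j} e)

  G : SimpleGraph n
  G = record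
    { adj = rep
    ; sym = λ i j → trans (cong (λ x → is x i j ∨ is x j i) (c-sym i j)) (∨-comm (is (c j i) i j) (is (c j i) j i))
    ; irrefl = λ i → ¬true⇒false (λ e → loop i (rep⁻ {i} {i} e)) }
    where
    loop : ∀ i → (i ≡ I (c i i) × i ≡ J (c i i)) ⊎ (i ≡ I (c i i) × i ≡ J (c i i)) → ⊥
    loop i (inj₁ (p , q)) = I≢J (c i i) (trans (sym p) q)
    loop i (inj₂ (p , q)) = I≢J (c i i) (trans (sym p) q)

  G-rainbow : Rainbow c (Adj G)
  G-rainbow {i} {j} {i′} {j′} g g′ eq with c i j | rep⁻ {i} {j} g | c i′ j′ | rep⁻ {i′} {j′} g′
  G-rainbow g g′ refl | x | inj₁ (p , q) | _ | inj₁ (p′ , q′) = inj₁ (trans p (sym p′) , trans q (sym q′))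
  G-rainbow g g′ refl | x | inj₁ (p , q) | _ | inj₂ (p′ , q′) = inj₂ (trans p (sym p′) , trans q (sym q′))
  G-rainbow g g′ refl | x | inj₂ (p , q) | _ | inj₁ (p′ , q′) = inj₂ (trans q (sym q′) , trans p (sym p′))
  G-rainbow g g′ refl | x | inj₂ (p , q) | _ | inj₂ (p′ , q′) = inj₁ (trans q (sym q′) , trans p (sym p′))

  private
    once : ∀ x → ∑ (λ i → ∑ (λ j → ⟦ is x i j ⟧)) ≡ 1
    once x = trans (∑∑-product (single (I x)) (single (J x))) (cong₂ _*_ (#-single (I x)) (#-single (J x)))

    -- A pair can represent only its own colour, and in one order only, since `I x` and `J x`
    -- differ.
    pt : ∀ i j → ∑ (λ x → ⟦ is x i j ⟧ + ⟦ is x j i ⟧) ≤ ⟦ rep i j ⟧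
    pt i j = ≤-trans (∑-mono one) (≤-reflexive (∑-δ (c i j) (λ _ → ⟦ rep i j ⟧)))
      where
      one : ∀ x → ⟦ is x i j ⟧ + ⟦ is x j i ⟧ ≤ ⟦ x == c i j ⟧ * ⟦ rep i j ⟧
      one x with bool (is x i j) | bool (is x j i)
      ... | inj₂ p | inj₂ q rewrite p | q = z≤n
      ... | inj₁ p | inj₁ q = let a , b = is⁻ {x} {i} {j} p ; a′ , b′ = is⁻ {x} {j} {i} q in ⊥-elim (I≢J x (trans (sym a) b′))
      ... | inj₁ p | inj₂ q = let a , b = is⁻ {x} {i} {j} p
                                  col : x ≡ c i j
                                  col = trans (sym (colour x)) (sym (cong₂ c a b))
        in ≤-trans (≤-reflexive (cong₂ (λ u v → ⟦ u ⟧ + ⟦ v ⟧) p q)) (≤-reflexive (sym (cong₂ (λ u v → ⟦ u ⟧ * ⟦ v ⟧) (==⁺ col) (∨⁺ˡ (subst (λ y → is y i j ≡ true) col p)))))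
      ... | inj₂ p | inj₁ q = let a , b = is⁻ {x} {j} {i} q
                                  col : x ≡ c i j
                                  col = trans (sym (colour x)) (trans (sym (cong₂ c a b)) (c-sym j i))
        in ≤-trans (≤-reflexive (cong₂ (λ u v → ⟦ u ⟧ + ⟦ v ⟧) p q)) (≤-reflexive (sym (cong₂ (λ u v → ⟦ u ⟧ * ⟦ v ⟧) (==⁺ col) (∨⁺ʳ {is (c i j) i j} (subst (λ y → is y j i ≡ true) col q)))))

  many-edges : 2 * r ≤ edges₂ G
  many-edges = begin
    2 * r ≡⟨ *-comm 2 r ⟩
    r * 2 ≡⟨ sym (∑-const 2) ⟩
    ∑ {r} (λ _ → 2) ≡⟨ ∑-cong (λ x → sym (cong₂ _+_ (once x) (trans (∑-swap _) (once x)))) ⟩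
    ∑ (λ x → ∑ (λ i → ∑ (λ j → ⟦ is x i j ⟧)) + ∑ (λ i → ∑ (λ j → ⟦ is x j i ⟧))) ≡⟨ ∑-cong (λ x → sym (trans (∑-cong (λ i → ∑-+ _ _)) (∑-+ _ _))) ⟩
    ∑ (λ x → ∑ (λ i → ∑ (λ j → ⟦ is x i j ⟧ + ⟦ is x j i ⟧))) ≡⟨ trans (∑-swap _) (∑-cong (λ i → ∑-swap _)) ⟩
    ∑ (λ i → ∑ (λ j → ∑ (λ x → ⟦ is x i j ⟧ + ⟦ is x j i ⟧))) ≤⟨ ∑-mono (λ i → ∑-mono (λ j → pt i j)) ⟩
    edges₂ G ∎
    where open ≤-Reasoning

-- The upper bound

rainbow-graph-bound : ∀ {n r K e} (c : Fin n → Fin n → Fin r) → (∀ i j → c i j ≡ c j i) →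
  1 ≤ K → 50 * (suc (suc K) * suc (suc K)) ≤ n →
  (∀ (H : SimpleGraph n) → ¬ Contains H (FriendEdge (suc K)) → edgeCount H ≤ e) →
  (G : SimpleGraph n) → Rainbow c (Adj G) → 2 * (e + 2) ≤ edges₂ G →
  ¬ HasRainbow c (FriendEdge (suc (suc K))) → ⊥
rainbow-graph-bound {n} {r} {K} {e} c c-sym 1≤K n≥ ub G G-rainbow many none =
  -- `Y` and `Z` encode an excess of `e + 2 - τ n` edges over `τ n`; at the start `2 * n` cancels
  -- against `2 * # U`.
  go (delete-low G (2 * (e + 2) + 2 * n) (2 * τ n) n (λ _ → true) (#≤n _) start)
  where
  size : 4 * K * suc K + suc K ≤ n
  size = ≤-trans (≤-trans (m≤m+n (4 * K * suc K + suc K) (46 * (K * K) + 195 * K + 199)) (≤-reflexive (ar K))) n≥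
    where
    ar : ∀ K → 4 * K * suc K + suc K + (46 * (K * K) + 195 * K + 199) ≡ 50 * (suc (suc K) * suc (suc K))
    ar = solve-∀
  start : 2 * τ (# {n} (λ _ → true)) + (2 * (e + 2) + 2 * n) ≤ edges₂ (restrict G (λ _ → true)) + 2 * # {n} (λ _ → true) + 2 * τ n
  start = ≤-trans (≤-reflexive (cong (λ N → 2 * τ N + (2 * (e + 2) + 2 * n)) #-all))
    (≤-trans (lin 0 many (ar (τ n) e n (edges₂ G)))
      (≤-reflexive (cong₂ (λ E N → E + 2 * N + 2 * τ n) (∑-cong (λ i → ∑-cong (λ j → cong ⟦_⟧ (sym (∧-identityʳ (adj G i j)))))) (sym #-all))))
    where
    ar : ∀ t e n E → 2 * t + (2 * (e + 2) + 2 * n) + E + 0 ≡ E + 2 * n + 2 * t + 2 * (e + 2)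
    ar = solve-∀
  τ≤e : 2 * τ n ≤ 2 * e
  τ≤e = ≤-trans (m≤n+m (2 * τ n) (edges₂ {n} empty + 2 * (K * K))) (ex-lower-bound {n} {0} {K} empty 1≤K size refl
    (λ { [] _ → z≤n ; (_ ∷ _) (() ∷ _ , _) }) (λ i → no-edges {H = empty} {i} (λ j ())) ub)
  go : (∃ λ U → 2 * τ (# U) + (2 * (e + 2) + 2 * n) ≤ edges₂ (restrict G U) + 2 * # U + 2 * τ n ×
         (∀ v → U ∋ v → ⌊ # U /2⌋ ≤ deg (restrict G U) v)) → ⊥
  go (U , excess , mindeg) = structure G (suc K) (λ x L F le → none (rainbow-flower (adj-flip G) G-rainbow F le)) (s≤s 1≤K) n≥ U mindeg
    -- By `τ n ≤ e` the surplus over `e` is one over `τ`, the density hypothesis of `structure`.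
    (lin 4 (excess ⊕ τ≤e) (ar (τ (# U)) n e (edges₂ (restrict G U)) (# U) (τ n)))
    λ (A , B , St) → Contradiction.contradiction c c-sym G G-rainbow K 1≤K none e ub size U A B St excess
    where
    ar : ∀ t n e E N T → 2 * t + 2 * n + (E + 2 * N + 2 * T + 2 * e) + 4 ≡ E + 2 * N + (2 * t + (2 * (e + 2) + 2 * n) + 2 * T)
    ar = solve-∀

upper-bound : ∀ {n K e} → 1 ≤ K → 50 * (suc (suc K) * suc (suc K)) ≤ n →
  (∀ (H : SimpleGraph n) → ¬ Contains H (FriendEdge (suc K)) → edgeCount H ≤ e) → ARProp n (suc (suc K)) (e + 2)
upper-bound {n} {K} {e} 1≤K n≥ ub c (c-sym , onto) = decidable-stable (hasRainbow? c (suc (suc K)))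
  (rainbow-graph-bound c c-sym 1≤K n≥ ub G G-rainbow many-edges)
  where open Representatives c c-sym onto

-- Colourings without a rainbow flower

-- The position in the list, with `length es` reserved for everything absent; that value becomes the
-- common colour of all pairs outside the list.
idx : {A : Set} → ((x y : A) → Dec (x ≡ y)) → A → (es : List A) → Fin (suc (length es))
idx _≟′_ x [] = zero
idx _≟′_ x (y ∷ es) with x ≟′ y
... | yes _ = zero
... | no _ = suc (idx _≟′_ x es)

module _ {A : Set} (_≟′_ : (x y : A) → Dec (x ≡ y)) where

  idx-∉ : ∀ {x} es → x ∉ es → idx _≟′_ x es ≡ fromℕ (length es)
  idx-∉ [] _ = refl
  idx-∉ {x} (y ∷ es) x∉ with x ≟′ y
  ... | yes refl = ⊥-elim (x∉ (here refl))
  ... | no _ = cong suc (idx-∉ es (x∉ ∘ there))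

  idx-∈ : ∀ {x} es → idx _≟′_ x es ≢ fromℕ (length es) → x ∈ es
  idx-∈ [] ne = ⊥-elim (ne refl)
  idx-∈ {x} (y ∷ es) ne with x ≟′ y
  ... | yes refl = here refl
  ... | no _ = there (idx-∈ es (ne ∘ cong suc))

  idx-onto : ∀ es → Unique es → ∀ i → i ≡ fromℕ (length es) ⊎ (∃ λ x → x ∈ es × idx _≟′_ x es ≡ i)
  idx-onto [] _ zero = inj₁ refl
  idx-onto (y ∷ es) u zero = inj₂ (y , here refl , first)
    where
    first : idx _≟′_ y (y ∷ es) ≡ zero
    first with y ≟′ y
    ... | yes _ = refl
    ... | no ne = ⊥-elim (ne refl)
  idx-onto (y ∷ es) u (suc i) with idx-onto es (Unique-tail u) i
  ... | inj₁ eq = inj₁ (cong suc eq)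
  ... | inj₂ (x , x∈ , eq) = inj₂ (x , there x∈ , later)
    where
    later : idx _≟′_ x (y ∷ es) ≡ suc i
    later with x ≟′ y
    ... | yes refl = ⊥-elim (Unique-head u x∈)
    ... | no _ = cong suc eq

forward : SimpleGraph n → Fin n → Fin n → Bool
forward G i j = adj G i j ∧ (toℕ i <ᵇ toℕ j)

Forward : SimpleGraph n → Fin n × Fin n → Set
Forward G (i , j) = adj G i j ≡ true × toℕ i < toℕ j

edge-list : (G : SimpleGraph n) → ∃ λ es → length es ≡ edgeCount G × Unique es × All (Forward G) es
edge-list {n} G = let es , len , u , a , _ = go (allFin n) (allFin⁺ n) in
  es , trans len (trans (sum-allFin _) (sym (edgeCount-∑ G))) , u , a
  where
  go : ∀ is → Unique is → ∃ λ es → length es ≡ sumℓ (map (λ i → # (forward G i)) is) × Unique es × All (Forward G) es ×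
    (∀ {e} → e ∈ es → proj₁ e ∈ is)
  go [] _ = [] , refl , [] , [] , λ ()
  go (i ∷ is) u with es , len , ue , ae , sub ← go is (Unique-tail u) | js , lenj , uj , aj ← choose (# (forward G i)) {forward G i} ≤-refl
    = map (i ,_) js ++ es ,
      trans (length-++ (map (i ,_) js)) (cong₂ _+_ (trans (length-map (i ,_) js) lenj) len) ,
      Unique-++⁺ (map⁺ ,-injectiveʳ uj) ue disjoint ,
      All-++⁺ (All-map⁺ (All.map (λ {j} e → let e₁ , e₂ = ∧⁻ {adj G i j} e in e₁ , <ᵇ⁻ e₂) aj)) ae ,
      λ {e} p → [ (λ q → let _ , _ , eq = ∈-map⁻ (i ,_) q in here (cong proj₁ eq)) , (λ q → there (sub q)) ]′ (∈-++⁻ (map (i ,_) js) p)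
    where
    disjoint : ∀ {e} → ¬ (e ∈ map (i ,_) js × e ∈ es)
    disjoint (p , q) with ∈-map⁻ (i ,_) p
    ... | _ , _ , refl = Unique-head u (sub q)

-- `es` may be only a part of the edges of `G`, which yields every smaller number of colours;
-- `nonedge` guarantees that the common colour occurs even if all edges are listed.
module EdgeColouring {n : ℕ} (G : SimpleGraph n) (es : List (Fin n × Fin n)) (ue : Unique es) (ae : All (Forward G) es)
  (nonedge : ∃ λ i → ∃ λ j → i ≢ j × adj G i j ≡ false) where

  private
    _≟ₚ_ : (x y : Fin n × Fin n) → Dec (x ≡ y)
    _≟ₚ_ = ≡-dec _≟_ _≟_

  norm : Fin n → Fin n → Fin n × Fin n
  norm i j = if toℕ i <ᵇ toℕ j then (i , j) else (j , i)

  norm-cases : ∀ i j → norm i j ≡ (i , j) ⊎ norm i j ≡ (j , i)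
  norm-cases i j with toℕ i <ᵇ toℕ j
  ... | true = inj₁ refl
  ... | false = inj₂ refl

  norm-< : ∀ {i j} → toℕ i < toℕ j → norm i j ≡ (i , j)
  norm-< {i} {j} lt rewrite <ᵇ⁺ lt = refl

  norm-sym : ∀ i j → norm i j ≡ norm j i
  norm-sym i j with <-cmp (toℕ i) (toℕ j)
  ... | tri< lt _ _ rewrite <ᵇ⁺ lt | ≮ᵇ (<⇒≤ lt) = refl
  ... | tri> _ _ gt rewrite <ᵇ⁺ gt | ≮ᵇ (<⇒≤ gt) = refl
  ... | tri≈ _ eq _ with refl ← toℕ-injective eq = refl

  col : Fin n → Fin n → Fin (suc (length es))
  col i j = idx _≟ₚ_ (norm i j) es

  top : Fin (suc (length es))
  top = fromℕ (length es)

  norm-adj : ∀ {i j} → norm i j ∈ es → adj G i j ≡ true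
  norm-adj {i} {j} p with norm i j | norm-cases i j
  ... | _ | inj₁ refl = proj₁ (All.lookup ae p)
  ... | _ | inj₂ refl = adj-flip G (proj₁ (All.lookup ae p))

  col-adj : ∀ {i j} → col i j ≢ top → adj G i j ≡ true
  col-adj ne = norm-adj (idx-∈ _≟ₚ_ es ne)

  colouring : IsColouring col
  colouring = (λ i j → cong (λ x → idx _≟ₚ_ x es) (norm-sym i j)) , onto
    where
    onto : ∀ x → ∃ λ i → ∃ λ j → i ≢ j × col i j ≡ x
    onto x with idx-onto _≟ₚ_ es ue x
    ... | inj₁ refl = let i , j , i≢j , na = nonedge in
      i , j , i≢j , idx-∉ _≟ₚ_ es (λ p → true≢false (norm-adj {i} {j} p) na)
    ... | inj₂ ((i , j) , p , eq) = let lt = proj₂ (All.lookup ae p) in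
      i , j , (λ i≡j → <⇒≢ lt (cong toℕ i≡j)) , trans (cong (λ x → idx _≟ₚ_ x es) (norm-<  lt)) eq

  module _ {R : Fin n → Fin n → Set} (rb : Rainbow col R) where

    -- The orientation makes `z` a petal, which lies in no other blade; the end `y` may be the
    -- centre, which all blades share.
    TopEdge : Fin n → Fin n × Fin n → Set
    TopEdge x (u , v) = ∃ λ y → ∃ λ z → R y z × col y z ≡ top × (z ≡ u ⊎ z ≡ v) × (y ≡ x ⊎ y ≡ u)

    good-blade : ∀ {x u v} → Blade R x (u , v) → Blade (Adj G) x (u , v) ⊎ TopEdge x (u , v)
    good-blade {x} {u} {v} (xu , xv , uv) with col x u ≟ top | col x v ≟ top | col u v ≟ top
    ... | yes t | _ | _ = inj₂ (x , u , xu , t , inj₁ refl , inj₁ refl)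
    ... | no _ | yes t | _ = inj₂ (x , v , xv , t , inj₂ refl , inj₁ refl)
    ... | no _ | no _ | yes t = inj₂ (u , v , uv , t , inj₂ refl , inj₂ refl)
    ... | no a | no b | no c = inj₁ (col-adj a , col-adj b , col-adj c)

    -- A rainbow relation has at most one edge of colour top, so at most one blade is bad.
    rest-good : ∀ {x y₀ z₀} → R y₀ z₀ → col y₀ z₀ ≡ top → ∀ L → All (Blade R x) L → z₀ ∉ x ∷ flat L → All (Blade (Adj G) x) L
    rest-good r₀ t₀ [] [] _ = []
    rest-good {x} {y₀} {z₀} r₀ t₀ ((u , v) ∷ L) (b ∷ a) z∉ with good-blade b
    ... | inj₁ g = g ∷ rest-good r₀ t₀ L a (λ { (here q) → z∉ (here q) ; (there q) → z∉ (there (there (there q))) })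
    ... | inj₂ (y , z , r , t , z∈ , y∈) = ⊥-elim (clash (rb r₀ r (trans t₀ (sym t))) z∈ y∈)
      where
      clash : (y₀ ≡ y × z₀ ≡ z) ⊎ (y₀ ≡ z × z₀ ≡ y) → z ≡ u ⊎ z ≡ v → y ≡ x ⊎ y ≡ u → ⊥
      clash (inj₁ (_ , refl)) (inj₁ refl) _ = z∉ (there (here refl))
      clash (inj₁ (_ , refl)) (inj₂ refl) _ = z∉ (there (there (here refl)))
      clash (inj₂ (_ , refl)) _ (inj₁ refl) = z∉ (here refl)
      clash (inj₂ (_ , refl)) _ (inj₂ refl) = z∉ (there (here refl))

    drop-bad : ∀ {x} L → Flower R x L → ∃ λ L′ → Flower (Adj G) x L′ × length L ≤ suc (length L′) × (∀ {z} → z ∈ flat L′ → z ∈ flat L)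
    drop-bad [] ([] , u) = [] , ([] , u) , z≤n , id
    drop-bad {x} ((v , w) ∷ L) (b ∷ a , u) with good-blade b
    ... | inj₁ g with L′ , (g′ , u′) , len , sub ← drop-bad L (a , (λ q → Unique-head u (there (there q))) ∷ᵘ Unique-tail (Unique-tail (Unique-tail u)))
      = (v , w) ∷ L′ , (g ∷ g′ , (λ { (here q) → Unique-head u (here q) ; (there (here q)) → Unique-head u (there (here q)) ; (there (there q)) → Unique-head u (there (there (sub q))) })
          ∷ᵘ (λ { (here q) → Unique-head (Unique-tail u) (here q) ; (there q) → Unique-head (Unique-tail u) (there (sub q)) })
          ∷ᵘ (λ q → Unique-head (Unique-tail (Unique-tail u)) (sub q)) ∷ᵘ Unique-tail u′) , s≤s len ,
        λ { (here q) → here q ; (there (here q)) → there (here q) ; (there (there q)) → there (there (sub q)) }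
    ... | inj₂ (y , z , r , t , z∈ , y∈) = L , (rest-good r t L a (z∉ z∈) , (λ q → Unique-head u (there (there q))) ∷ᵘ Unique-tail (Unique-tail (Unique-tail u))) , ≤-refl , there ∘ there
      where
      z∉ : z ≡ v ⊎ z ≡ w → z ∉ x ∷ flat L
      z∉ (inj₁ refl) (here q) = Unique-head u (here (sym q))
      z∉ (inj₁ refl) (there q) = Unique-head (Unique-tail u) (there q)
      z∉ (inj₂ refl) (here q) = Unique-head u (there (here (sym q)))
      z∉ (inj₂ refl) (there q) = Unique-head (Unique-tail (Unique-tail u)) q

  no-rainbow : ∀ {k} → ¬ Contains G (FriendEdge k) → ¬ HasRainbow col (FriendEdge (suc k))
  no-rainbow {k} free (φ , inj , rb) = contra (embedding⇒flower {R = R} {k = suc k} (φ , inj , λ a b E → a , b , E , refl , refl))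
    where
    R : Fin n → Fin n → Set
    R i j = ∃ λ a → ∃ λ b → FriendEdge (suc k) a b × φ a ≡ i × φ b ≡ j
    R-rainbow : Rainbow col R
    R-rainbow (a , b , E , refl , refl) (a′ , b′ , E′ , refl , refl) eq with rb a b a′ b′ E E′ eq
    ... | inj₁ (refl , refl) = inj₁ (refl , refl)
    ... | inj₂ (refl , refl) = inj₂ (refl , refl)
    contra : (∃₂ λ x L → Flower R x L × length L ≡ suc k) → ⊥
    contra (x , L , F , len) =
      let L′ , F′ , len′ , _ = drop-bad R-rainbow L F
          L″ , F″ , len″ = flower-shrink L′ F′ (≤-pred (≤-trans (≤-reflexive (sym len)) len′))
      in free (subst (λ k → Contains G (FriendEdge k)) len″ (flower⇒embedding {R = Adj G} (adj-flip G) F″))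

-- The lower bound

non-edge : (G : SimpleGraph n) (k : ℕ) → suc (2 * k) ≤ n → ¬ Contains G (FriendEdge k) → ∃ λ i → ∃ λ j → i ≢ j × adj G i j ≡ false
non-edge {n} G k size free = search (any? λ i → any? λ j → ¬? (i ≟ j) ×-dec (adj G i j Bool.≟ false))
  where
  search : Dec _ → _
  search (yes found) = found
  search (no none) = ⊥-elim (from (choose (suc (2 * k)) {λ _ → true} (≤-trans size (≤-reflexive (sym #-all)))))
    where
    complete : ∀ {i j} → i ≢ j → adj G i j ≡ true
    complete {i} {j} i≢j with bool (adj G i j)
    ... | inj₁ e = e
    ... | inj₂ e = ⊥-elim (none (i , j , i≢j , e))
    blades : ∀ x L → Unique (x ∷ flat L) → All (Blade (Adj G) x) L
    blades x [] u = []
    blades x ((v , w) ∷ L) u@((x≢v ∷ x≢w ∷ _) ∷ ((v≢w ∷ _) ∷ _)) = (complete x≢v , complete x≢w , complete v≢w) ∷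
      blades x L ((λ q → Unique-head u (there (there q))) ∷ᵘ Unique-tail (Unique-tail (Unique-tail u)))
    from : (∃ λ xs → length xs ≡ suc (2 * k) × Unique xs × All ((λ _ → true) ∋_) xs) → ⊥
    from (x ∷ xs , len , u , _) with L , refl , lenL ← pair-up k xs (suc-injective len)
      = free (subst (λ k → Contains G (FriendEdge k)) lenL (flower⇒embedding {R = Adj G} (adj-flip G) (blades x L u , u)))

-- For `r = suc s` colours, `s` edges of the extremal graph keep their own colours and all other
-- pairs share the last one; `r < e + 2` says exactly that `s` edges are available.
lower-bound : ∀ {n k e} → suc (2 * k) ≤ n → FreeWith n k e → ∀ r → 1 ≤ r → r < e + 2 → ¬ ARProp n (suc k) r
lower-bound {n} {k} {e} size (G , refl , free) (suc s) _ r< AR = contra (edge-list G)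
  where
  contra : (∃ λ es → length es ≡ edgeCount G × Unique es × All (Forward G) es) → ⊥
  contra (es , len , u , a) = EC.no-rainbow free (subst (ARProp n (suc k)) (cong suc (sym len′)) AR EC.col EC.colouring)
    where
    module EC = EdgeColouring G (take s es) (take⁺ s u) (All-take⁺ s a) (non-edge G k size free)
    len′ : length (take s es) ≡ s
    len′ = trans (length-take s es) (m≤n⇒m⊓n≡m (≤-trans (≤-pred (≤-pred (≤-trans r< (≤-reflexive (+-comm e 2))))) (≤-reflexive (sym len))))

theorem1p1 : (n k : ℕ) → 2 ≤ k → 50 * (k + 1) ^ 2 ≤ n →
    Σ ℕ (λ e → IsEx n k e × IsAR n (suc k) (e + 2))
theorem1p1 n (suc K) (s≤s 1≤K) n≥ = from (ex-exists n K)
  where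
  n≥′ : 50 * (suc (suc K) * suc (suc K)) ≤ n
  n≥′ = ≤-trans (≤-reflexive (cong (50 *_) (ar K))) n≥
    where
    ar : ∀ K → suc (suc K) * suc (suc K) ≡ (suc K + 1) * ((suc K + 1) * 1)
    ar = solve-∀
  size : suc (2 * suc K) ≤ n
  size = ≤-trans (≤-trans (m≤m+n (suc (2 * suc K)) (50 * (K * K) + 198 * K + 197)) (≤-reflexive (ar K))) n≥′
    where
    ar : ∀ K → suc (2 * suc K) + (50 * (K * K) + 198 * K + 197) ≡ 50 * (suc (suc K) * suc (suc K))
    ar = solve-∀
  from : (∃ λ e → IsEx n (suc K) e) → Σ ℕ (λ e → IsEx n (suc K) e × IsAR n (suc (suc K)) (e + 2))
  from (e , free , ub) = e , (free , ub) , ≤-trans (s≤s z≤n) (m≤n+m 2 e) , upper-bound 1≤K n≥′ ub , lower-bound {k = suc K} size free
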